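{- Let $n\ge 2$ be an integer. If $m$ is the index of a peak (a maximal term) of the sequence $D(n,1),D(n,2),\dots,D(n,\lfloor n/2\rfloor)$, then $m$ is one of the two integers bracketing $$\mu_n=\frac{D(n+1)}{D(n)}-\frac{n\,D(n-1)}{D(n)},$$ that is, $m\in\{\lfloor \mu_n\rfloor,\lceil\mu_n\rceil\}$.
   Context: For positive integers $n,k$, $D(n,k)$ denotes the number of partitions of $[n]=\{1,\dots,n\}$ into exactly $k$ blocks, each block consisting of more than one element, and $D(n)=\sum_{k\ge1}D(n,k)$ (so $D(1)=0$). -}

module Defs where

open import Data.Fin.Base using (Fin)
open import Data.Fin.Properties using (all?)
open import Data.Fin.Subset using (Subset; inside; outside; _∈_; _∩_; ∣_∣; Nonempty; Empty; ⊤)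
open import Data.Fin.Subset.Properties using (_∈?_; nonempty?; ∈⊤; ∣⊤∣≡n)
open import Data.Integer.Base using (+_)
open import Data.List.Base using (List; []; _∷_; _++_; map; filter; length; upTo)
open import Data.List.Membership.Propositional using () renaming (_∈_ to _∈ₗ_)
open import Data.List.Membership.Propositional.Properties using (∈-filter⁺; ∈-map⁺; ∈-++⁺ˡ; ∈-++⁺ʳ; ∈-length)
open import Data.List.Relation.Unary.All as All using (All; []; _∷_)
open import Data.List.Relation.Unary.AllPairs as AllPairs using (AllPairs; []; _∷_)
open import Data.List.Relation.Unary.Any as Any using (Any; here; there)
open import Data.Nat.Base using (ℕ; zero; suc; pred; _*_; _≤_; _<_; ⌊_/2⌋; s≤s; NonZero; >-nonZero)
open import Data.Nat.ListAction using (sum)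
open import Data.Nat.Properties using (_≟_; _<?_; ≤-trans; m≤m+n)
open import Data.Product.Base using (_×_; _,_)
open import Data.Rational.Base using (ℚ; _/_; _-_)
open import Data.Vec.Base using ([]; _∷_)
open import Relation.Binary.PropositionalEquality using (_≡_; refl; sym; subst)
open import Relation.Nullary using (Dec; ¬?; _×-dec_)

-- The ground set [n] is modelled by Fin n.

subsets : ∀ n → List (Subset n)
subsets zero    = [] ∷ []
subsets (suc n) = map (outside ∷_) (subsets n) ++ map (inside ∷_) (subsets n)

sublists : ∀ {A : Set} → List A → List (List A)
sublists []       = [] ∷ []
sublists (x ∷ xs) = sublists xs ++ map (x ∷_) (sublists xs)

-- Since subsets n lists every subset of [n] exactly once, its sublists are in
-- bijection with the sets of subsets of [n].
families : ∀ n → List (List (Subset n))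
families n = sublists (subsets n)

Disjoint : ∀ {n} → Subset n → Subset n → Set
Disjoint p q = Empty (p ∩ q)

IsPartition : ∀ {n} → List (Subset n) → Set
IsPartition {n} P = All Nonempty P × AllPairs Disjoint P × (∀ (i : Fin n) → Any (i ∈_) P)

NoSingletons : ∀ {n} → List (Subset n) → Set
NoSingletons P = All (λ b → 1 < ∣ b ∣) P

IsCounted : ∀ n (k : ℕ) → List (Subset n) → Set
IsCounted n k P = IsPartition P × length P ≡ k × NoSingletons P

isCounted? : ∀ n k (P : List (Subset n)) → Dec (IsCounted n k P)
isCounted? n k P =
  (All.all? nonempty? P
    ×-dec AllPairs.allPairs? (λ p q → ¬? (nonempty? (p ∩ q))) P
    ×-dec all? (λ i → Any.any? (i ∈?_) P))
  ×-dec (length P ≟ k)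
  ×-dec All.all? (λ b → 1 <? ∣ b ∣) P

-- D₂ n k is D(n,k); the one-argument D below is D(n).
D₂ : ℕ → ℕ → ℕ
D₂ n k = length (filter (isCounted? n k) (families n))

-- Σ_{k ≥ 1} D(n,k), cut off at k = n: a partition of [n] has at most n blocks.
D : ℕ → ℕ
D n = sum (map (λ j → D₂ n (suc j)) (upTo n))

IsPeak : ℕ → ℕ → Set
IsPeak n m = (1 ≤ m × m ≤ ⌊ n /2⌋) × (∀ k → 1 ≤ k → k ≤ ⌊ n /2⌋ → D₂ n k ≤ D₂ n m)

-- Only used for n ≥ 2, so pred n is the honest n - 1.
μ : ∀ n → .{{NonZero (D n)}} → ℚ
μ n = (+ D (suc n)) / D n - (+ (n * D (pred n))) / D n

-- For n ≥ 2 the one-block partition shows D n ≠ 0.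

⊤∈subsets : ∀ n → ⊤ ∈ₗ subsets n
⊤∈subsets zero    = here refl
⊤∈subsets (suc n) = ∈-++⁺ʳ (map (outside ∷_) (subsets n)) (∈-map⁺ (inside ∷_) (⊤∈subsets n))

[]∈sublists : ∀ {A : Set} (xs : List A) → [] ∈ₗ sublists xs
[]∈sublists []       = here refl
[]∈sublists (x ∷ xs) = ∈-++⁺ˡ ([]∈sublists xs)

[x]∈sublists : ∀ {A : Set} {x : A} {xs} → x ∈ₗ xs → (x ∷ []) ∈ₗ sublists xs
[x]∈sublists {xs = x ∷ xs} (here refl) = ∈-++⁺ʳ (sublists xs) (∈-map⁺ (x ∷_) ([]∈sublists xs))
[x]∈sublists {xs = x ∷ xs} (there x∈) = ∈-++⁺ˡ ([x]∈sublists x∈)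

[⊤]-isCounted : ∀ {n} → 2 ≤ n → IsCounted n 1 (⊤ ∷ [])
[⊤]-isCounted {n} 2≤n@(s≤s _) =
  (((Fin.zero , ∈⊤) ∷ []) , ([] ∷ []) , (λ _ → here ∈⊤)) , refl , (subst (1 <_) (sym (∣⊤∣≡n n)) 2≤n ∷ [])

D-nonZero : ∀ {n} → 2 ≤ n → NonZero (D n)
D-nonZero {n@(suc _)} 2≤n = >-nonZero (≤-trans 0<D₂ (m≤m+n (D₂ n 1) _))
  where
  0<D₂ : 0 < D₂ n 1
  0<D₂ = ∈-length (∈-filter⁺ (isCounted? n 1) ([x]∈sublists (⊤∈subsets n)) ([⊤]-isCounted 2≤n))

{-# OPTIONS --safe #-}

-- Put D_n(x) = Σₖ D(n,k) xᵏ = x E_n(x). Counting partitions by the block of one element gives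
-- D(n+1,k) = k D(n,k) + n D(n−1,k−1), hence μ_n is the mean of the weights D(n,k), and E_{n+1} = E_n + x (E_n′ + n E_{n−1}).
-- Real-rootedness is certified over ℚ by positive definite Bezoutians: the Bezoutians of (E_{n+1} , E_n) are sums of squares
-- and Bezoutians of (E_n , E_n′) and (E_n , E_{n−1}), and the positivity of those of (f , f′) follows from that of (f , g) along
-- the Stieltjes continued fraction of g / f. By Darroch's theorem a mode of a real-rooted polynomial with nonnegative
-- coefficients lies at distance less than 1 from its mean. Writing f = f(1) ∏ (qᵢ + pᵢ x), pᵢ + qᵢ = 1, its usual proof by removing
-- one factor at a time is replaced by passing from f to T f = f(1) Σ pᵢ² f / (qᵢ + pᵢ x), which needs no roots and is again real-rooted;
-- the other inequality follows by reversing the coefficients.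
module Submission where

-- Positivity is therefore tracked at two strengths. Semidefiniteness is additive and passes along
-- the continued fraction; definiteness is recovered afterwards, because one summand is a positive
-- multiple of a polynomial whose form is already definite. Each pair carries two forms, one for the
-- reality of the roots and one for their sign. Reversing the coefficients exchanges the two, and
-- so, up to a square and a shift of the functional, does the passage from E_n to E_{n+1}. The
-- degree of E_n grows only at every second n, so two kinds of interlacing alternate, with degrees
-- differing by one or equal. Numerical facts come from testing a form on one functional: evaluation
-- at 1 gives the drop of the mean under T, and coefficient functionals give the signs of extreme
-- coefficients.

module Counting where

  open import Defs
  open import Data.Bool.Base using (if_then_else_)
  open import Data.Bool.Properties using () renaming (_≟_ to _≟ᵇ_)
  open import Data.Fin.Base using (zero; suc)
  open import Data.Fin.Subset using (Subset; inside; outside; _∈_; _∉_; _⊆_; _─_; ∣_∣; ⊤; ⊥; Nonempty)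
  open import Data.Fin.Subset.Properties using (_⊆?_; _∈?_; out⊆; in⊆in; drop-∷-⊆; Empty-unique; ∉⊥; ∈⊤; ∣⊤∣≡n; p─q⊆p; x∈p∧x∉q⇒x∈p─q; p─q─r≡p─r─q; x∈p∩q⁺; x∈p∩q⁻)
  open import Data.List.Base using (List; []; _∷_; _++_; map; filter; length)
  open import Data.List.Properties using (map-++; map-∘; map-cong; length-map; length-++)
  open import Data.List.Relation.Unary.All as All using (All; []; _∷_)
  open import Data.List.Relation.Unary.AllPairs using (AllPairs; []; _∷_)
  open import Data.List.Relation.Unary.Any using (Any; here; there)
  open import Data.Nat.Base using (ℕ; zero; suc; z≤n; s≤s; _+_; _*_; _<_)
  import Data.Nat.Properties as ℕₚ
  open import Data.Nat.ListAction using (sum)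
  open import Data.Nat.ListAction.Properties using (sum-++)
  open import Data.Nat.Solver using (module +-*-Solver)
  open import Data.Product.Base using (_×_; _,_; proj₁; proj₂)
  open import Data.Vec.Base using ([]; _∷_; here; there; tail)
  open import Data.Vec.Properties using (≡-dec)
  open import Function.Base using (_∘_)
  open import Relation.Binary.PropositionalEquality using (_≡_; refl; sym; trans; cong; cong₂; subst; module ≡-Reasoning)
  open import Relation.Nullary using (Dec; yes; no; ¬_; contradiction; does; _×-dec_)
  open import Relation.Unary using (Pred; Decidable)
  open +-*-Solver using (solve; _:+_; _:*_; _:=_; con)

  -- Indicator sums over lists and sublists

  ⟦_⟧ : {P : Set} → Dec P → ℕ
  ⟦ P? ⟧ = if does P? then 1 else 0

  ⟦⟧-⇔ : {P Q : Set} (P? : Dec P) (Q? : Dec Q) → (P → Q) → (Q → P) → ⟦ P? ⟧ ≡ ⟦ Q? ⟧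
  ⟦⟧-⇔ (yes p) (yes q) f g = refl
  ⟦⟧-⇔ (yes p) (no ¬q) f g = contradiction (f p) ¬q
  ⟦⟧-⇔ (no ¬p) (yes q) f g = contradiction (g q) ¬p
  ⟦⟧-⇔ (no ¬p) (no ¬q) f g = refl

  ⟦⟧-no : {P : Set} (P? : Dec P) → ¬ P → ⟦ P? ⟧ ≡ 0
  ⟦⟧-no (yes p) ¬p = contradiction p ¬p
  ⟦⟧-no (no _)  ¬p = refl

  ⟦⟧-× : {P Q : Set} (P? : Dec P) (Q? : Dec Q) → ⟦ P? ×-dec Q? ⟧ ≡ ⟦ P? ⟧ * ⟦ Q? ⟧
  ⟦⟧-× (yes p) (yes q) = refl
  ⟦⟧-× (yes p) (no ¬q) = refl
  ⟦⟧-× (no ¬p) _       = refl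

  ∑ : {A : Set} → (A → ℕ) → List A → ℕ
  ∑ f xs = sum (map f xs)

  ∑-cong : {A : Set} {f g : A → ℕ} → (∀ x → f x ≡ g x) → ∀ xs → ∑ f xs ≡ ∑ g xs
  ∑-cong eq xs = cong sum (map-cong eq xs)

  ∑-++ : {A : Set} (f : A → ℕ) → ∀ xs ys → ∑ f (xs ++ ys) ≡ ∑ f xs + ∑ f ys
  ∑-++ f xs ys = trans (cong sum (map-++ f xs ys)) (sum-++ (map f xs) (map f ys))

  ∑-map : {A B : Set} (f : B → ℕ) (g : A → B) → ∀ xs → ∑ f (map g xs) ≡ ∑ (f ∘ g) xs
  ∑-map f g xs = cong sum (sym (map-∘ xs))

  ∑-0 : {A : Set} {f : A → ℕ} → (∀ x → f x ≡ 0) → ∀ xs → ∑ f xs ≡ 0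
  ∑-0 eq []       = refl
  ∑-0 eq (x ∷ xs) = cong₂ _+_ (eq x) (∑-0 eq xs)

  ∑-+ : {A : Set} (f g : A → ℕ) → ∀ xs → ∑ (λ x → f x + g x) xs ≡ ∑ f xs + ∑ g xs
  ∑-+ f g []       = refl
  ∑-+ f g (x ∷ xs) = trans (cong (f x + g x +_) (∑-+ f g xs))
    (solve 4 (λ a b c d → a :+ b :+ (c :+ d) := a :+ c :+ (b :+ d)) refl (f x) (g x) (∑ f xs) (∑ g xs))

  ∑-*ˡ : {A : Set} (c : ℕ) (f : A → ℕ) → ∀ xs → ∑ (λ x → c * f x) xs ≡ c * ∑ f xs
  ∑-*ˡ c f []       = sym (ℕₚ.*-zeroʳ c)
  ∑-*ˡ c f (x ∷ xs) = trans (cong (c * f x +_) (∑-*ˡ c f xs)) (sym (ℕₚ.*-distribˡ-+ c (f x) (∑ f xs)))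

  ∑-swap : {A B : Set} (f : A → B → ℕ) → ∀ xs ys → ∑ (λ x → ∑ (f x) ys) xs ≡ ∑ (λ y → ∑ (λ x → f x y) xs) ys
  ∑-swap f []       ys = sym (∑-0 (λ _ → refl) ys)
  ∑-swap f (x ∷ xs) ys = trans (cong (∑ (f x) ys +_) (∑-swap f xs ys)) (sym (∑-+ (f x) (λ y → ∑ (λ x → f x y) xs) ys))

  length-filter-∑ : {A : Set} {P : Pred A _} (P? : Decidable P) → ∀ xs → length (filter P? xs) ≡ ∑ (λ x → ⟦ P? x ⟧) xs
  length-filter-∑ P? []       = refl
  length-filter-∑ P? (x ∷ xs) with P? x
  ... | yes _ = cong suc (length-filter-∑ P? xs)
  ... | no _  = length-filter-∑ P? xs

  ∑-sublists-++ : {A : Set} (φ : List A → ℕ) → ∀ xs ys →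
    ∑ φ (sublists (xs ++ ys)) ≡ ∑ (λ q → ∑ (λ p → φ (q ++ p)) (sublists ys)) (sublists xs)
  ∑-sublists-++ φ []       ys = sym (ℕₚ.+-identityʳ _)
  ∑-sublists-++ φ (x ∷ xs) ys = begin
    ∑ φ (sublists (xs ++ ys) ++ map (x ∷_) (sublists (xs ++ ys)))
      ≡⟨ ∑-++ φ (sublists (xs ++ ys)) _ ⟩
    ∑ φ (sublists (xs ++ ys)) + ∑ φ (map (x ∷_) (sublists (xs ++ ys)))
      ≡⟨ cong₂ _+_ (∑-sublists-++ φ xs ys) (trans (∑-map φ (x ∷_) (sublists (xs ++ ys))) (∑-sublists-++ (φ ∘ (x ∷_)) xs ys)) ⟩
    ∑ Φ (sublists xs) + ∑ (Φ ∘ (x ∷_)) (sublists xs)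
      ≡⟨ cong (∑ Φ (sublists xs) +_) (sym (∑-map Φ (x ∷_) (sublists xs))) ⟩
    ∑ Φ (sublists xs) + ∑ Φ (map (x ∷_) (sublists xs))
      ≡⟨ sym (∑-++ Φ (sublists xs) _) ⟩
    ∑ Φ (sublists (x ∷ xs)) ∎
    where
    open ≡-Reasoning
    Φ : List _ → ℕ
    Φ q = ∑ (λ p → φ (q ++ p)) (sublists ys)

  sublists-map : {A B : Set} (f : A → B) → ∀ xs → sublists (map f xs) ≡ map (map f) (sublists xs)
  sublists-map f []       = refl
  sublists-map f (x ∷ xs) = begin
    sublists (map f xs) ++ map (f x ∷_) (sublists (map f xs))
      ≡⟨ cong (λ l → l ++ map (f x ∷_) l) (sublists-map f xs) ⟩
    map (map f) (sublists xs) ++ map (f x ∷_) (map (map f) (sublists xs))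
      ≡⟨ cong (map (map f) (sublists xs) ++_) (trans (sym (map-∘ (sublists xs))) (map-∘ (sublists xs))) ⟩
    map (map f) (sublists xs) ++ map (map f) (map (x ∷_) (sublists xs))
      ≡⟨ sym (map-++ (map f) (sublists xs) _) ⟩
    map (map f) (sublists (x ∷ xs)) ∎
    where open ≡-Reasoning

  ∑-sublists-[] : {A : Set} (φ : List A → ℕ) → (∀ x p → φ (x ∷ p) ≡ 0) → ∀ xs → ∑ φ (sublists xs) ≡ φ []
  ∑-sublists-[] φ φ∷ []       = ℕₚ.+-identityʳ _
  ∑-sublists-[] φ φ∷ (x ∷ xs) = trans (∑-++ φ (sublists xs) _) (trans
    (cong₂ _+_ (∑-sublists-[] φ φ∷ xs) (trans (∑-map φ (x ∷_) (sublists xs)) (∑-0 (φ∷ x) (sublists xs)))) (ℕₚ.+-identityʳ _))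

  ∑-sublists-[x] : {A : Set} (φ : List A → ℕ) → φ [] ≡ 0 → (∀ x y p → φ (x ∷ y ∷ p) ≡ 0) → ∀ xs → ∑ φ (sublists xs) ≡ ∑ (λ x → φ (x ∷ [])) xs
  ∑-sublists-[x] φ φ[] φ∷∷ []       = trans (ℕₚ.+-identityʳ _) φ[]
  ∑-sublists-[x] φ φ[] φ∷∷ (x ∷ xs) = trans (∑-++ φ (sublists xs) _) (trans
    (cong₂ _+_ (∑-sublists-[x] φ φ[] φ∷∷ xs) (trans (∑-map φ (x ∷_) (sublists xs)) (∑-sublists-[] (φ ∘ (x ∷_)) (φ∷∷ x) xs)))
    (ℕₚ.+-comm _ (φ (x ∷ []))))

  -- Removing the blocks one by one from the uncovered part of the ground set turns disjointness and
  -- covering into a recursion on the list. The general `X` in place of `⊤` is what the recursion on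
  -- `X ─ b` requires.
  Valid : ∀ {n} → Subset n → List (Subset n) → Set
  Valid X []      = X ≡ ⊥
  Valid X (b ∷ P) = b ⊆ X × 1 < ∣ b ∣ × Valid (X ─ b) P

  valid? : ∀ {n} (X : Subset n) P → Dec (Valid X P)
  valid? X []      = ≡-dec _≟ᵇ_ X ⊥
  valid? X (b ∷ P) = (b ⊆? X) ×-dec (1 ℕₚ.<? ∣ b ∣) ×-dec valid? (X ─ b) P

  ∈─⇒∉ : ∀ {n} (p q : Subset n) {x} → x ∈ p ─ q → x ∉ q
  ∈─⇒∉ (a ∷ p) (outside ∷ q) (there x∈) (there x∈q) = ∈─⇒∉ p q x∈ x∈q
  ∈─⇒∉ (a ∷ p) (inside  ∷ q) (there x∈) (there x∈q) = ∈─⇒∉ p q x∈ x∈q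

  Within : ∀ {n} → Subset n → Subset n → Set
  Within X c = ∀ x → x ∈ c → x ∈ X

  Valid⇒ : ∀ {n} (X : Subset n) P → Valid X P →
    NoSingletons P × AllPairs Disjoint P × All (Within X) P × (∀ i → i ∈ X → Any (i ∈_) P)
  Valid⇒ X []      refl = [] , [] , [] , λ i i∈⊥ → contradiction i∈⊥ ∉⊥
  Valid⇒ X (b ∷ P) (b⊆X , 1<b , v) with Valid⇒ (X ─ b) P v
  ... | ns , dis , sub , cov =
      1<b ∷ ns
    , All.map (λ c⊆ (x , x∈) → ∈─⇒∉ X b (c⊆ x (proj₂ (x∈p∩q⁻ b _ x∈))) (proj₁ (x∈p∩q⁻ b _ x∈))) sub ∷ dis
    , (λ x → b⊆X) ∷ All.map (λ c⊆ x x∈c → p─q⊆p X b (c⊆ x x∈c)) sub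
    , cover
    where
    cover : ∀ i → i ∈ X → Any (i ∈_) (b ∷ P)
    cover i i∈X with i ∈? b
    ... | yes i∈b = here i∈b
    ... | no i∉b  = there (cov i (x∈p∧x∉q⇒x∈p─q i∈X i∉b))

  ⇒Valid : ∀ {n} (X : Subset n) P → NoSingletons P → AllPairs Disjoint P → All (Within X) P → (∀ i → i ∈ X → Any (i ∈_) P) → Valid X P
  ⇒Valid X []      ns dis sub cov = Empty-unique λ (i , i∈X) → contradiction (cov i i∈X) λ ()
  ⇒Valid X (b ∷ P) (1<b ∷ ns) (dis₁ ∷ dis) (b⊆X ∷ sub) cov =
    (λ {x} → b⊆X x) , 1<b , ⇒Valid (X ─ b) P ns dis (sub′ sub dis₁) cov′
    where
    sub′ : ∀ {P} → All (Within X) P → All (Disjoint b) P → All (Within (X ─ b)) P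
    sub′ []          []      = []
    sub′ (c⊆X ∷ sub) (d ∷ ds) = (λ x x∈c → x∈p∧x∉q⇒x∈p─q (c⊆X x x∈c) (λ x∈b → d (_ , x∈p∩q⁺ (x∈b , x∈c)))) ∷ sub′ sub ds
    cov′ : ∀ i → i ∈ X ─ b → Any (i ∈_) P
    cov′ i i∈ with cov i (p─q⊆p X b i∈)
    ... | here i∈b = contradiction i∈b (∈─⇒∉ X b i∈)
    ... | there a  = a

  IsCounted⇒Valid : ∀ {n k P} → IsCounted n k P → Valid ⊤ P × length P ≡ k
  IsCounted⇒Valid {P = P} ((_ , dis , cov) , len , ns) = ⇒Valid ⊤ P ns dis (All.universal (λ c _ _ → ∈⊤) P) (λ i _ → cov i) , len

  Valid⇒IsCounted : ∀ {n k P} → Valid ⊤ P × length P ≡ k → IsCounted n k P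
  Valid⇒IsCounted {P = P} (v , len) with Valid⇒ ⊤ P v
  ... | ns , dis , _ , cov = (All.map 1<⇒nonempty ns , dis , λ i → cov i ∈⊤) , len , ns
    where
    1<⇒nonempty : ∀ {n} {b : Subset n} → 1 < ∣ b ∣ → Nonempty b
    1<⇒nonempty {b = inside ∷ b}  _   = zero , here
    1<⇒nonempty {b = outside ∷ b} 1<b = let x , x∈ = 1<⇒nonempty 1<b in suc x , there x∈

  -- Splitting off the block of the first element

  module _ {n : ℕ} where
    -- `subsets (suc n)` lists the subsets avoiding the first element before those containing it, so
    -- each of its sublists arises exactly once in this form. In a valid one `p` has at most one
    -- entry.
    join : List (Subset n) → List (Subset n) → List (Subset (suc n))
    join q p = map (outside ∷_) q ++ map (inside ∷_) p

    Valid-out : ∀ {X} q → Valid (outside ∷ X) (join q []) → Valid X q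
    Valid-out []      refl = refl
    Valid-out (a ∷ q) (a⊆ , 1<a , v) = drop-∷-⊆ a⊆ , 1<a , Valid-out q v

    Valid-out⁻ : ∀ {X} q → Valid X q → Valid (outside ∷ X) (join q [])
    Valid-out⁻ []      refl = refl
    Valid-out⁻ (a ∷ q) (a⊆ , 1<a , v) = out⊆ a⊆ , 1<a , Valid-out⁻ q v

    ¬Valid-out-in : ∀ {X} q b p → ¬ Valid (outside ∷ X) (join q (b ∷ p))
    ¬Valid-out-in []      b p (b⊆ , _)    = contradiction (b⊆ here) λ ()
    ¬Valid-out-in (a ∷ q) b p (_ , _ , v) = ¬Valid-out-in q b p v

    ¬Valid-in-[] : ∀ {X} q → ¬ Valid (inside ∷ X) (join q [])
    ¬Valid-in-[] []      ()
    ¬Valid-in-[] (a ∷ q) (_ , _ , v) = ¬Valid-in-[] q v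

    ¬Valid-in-in : ∀ {X} q b c p → ¬ Valid (inside ∷ X) (join q (b ∷ c ∷ p))
    ¬Valid-in-in []      b c p (_ , _ , v) = ¬Valid-out-in [] c p v
    ¬Valid-in-in (a ∷ q) b c p (_ , _ , v) = ¬Valid-in-in q b c p v

    ⊆-swap : ∀ {X a b : Subset n} → a ⊆ X → b ⊆ X ─ a → a ⊆ X ─ b
    ⊆-swap {X} {a} {b} a⊆X b⊆ x∈a = x∈p∧x∉q⇒x∈p─q (a⊆X x∈a) λ x∈b → ∈─⇒∉ X a (b⊆ x∈b) x∈a

    -- The block of the first element stands last in the list. It is brought to the front by
    -- exchanging it with the blocks of `q`, whence `⊆-swap` and the commutation of differences.
    Valid-in : ∀ {X} q b → Valid (inside ∷ X) (join q (b ∷ [])) → (0 < ∣ b ∣ × b ⊆ X) × Valid (X ─ b) q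
    Valid-in []      b (b⊆ , s≤s 0<b , eq) = (0<b , drop-∷-⊆ b⊆) , cong (tail) eq
    Valid-in {X} (a ∷ q) b (a⊆ , 1<a , v) with Valid-in q b v
    ... | (0<b , b⊆) , v′ = (0<b , λ x∈ → p─q⊆p X a (b⊆ x∈)) , ⊆-swap {X} {a} {b} (drop-∷-⊆ a⊆) b⊆ , 1<a , subst (λ Y → Valid Y q) (p─q─r≡p─r─q X a b) v′

    Valid-in⁻ : ∀ {X} q b → (0 < ∣ b ∣ × b ⊆ X) × Valid (X ─ b) q → Valid (inside ∷ X) (join q (b ∷ []))
    Valid-in⁻ []      b ((0<b , b⊆) , eq) = in⊆in b⊆ , s≤s 0<b , cong (outside ∷_) eq
    Valid-in⁻ {X} (a ∷ q) b ((0<b , b⊆) , (a⊆ , 1<a , v)) =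
      out⊆ (λ x∈ → p─q⊆p X b (a⊆ x∈)) , 1<a ,
      Valid-in⁻ q b ((0<b , ⊆-swap {X} {b} {a} b⊆ a⊆) , subst (λ Y → Valid Y q) (p─q─r≡p─r─q X b a) v)

    length-join : ∀ q p → length (join q p) ≡ length q + length p
    length-join q p = trans (length-++ (map (outside ∷_) q)) (cong₂ _+_ (length-map (outside ∷_) q) (length-map (inside ∷_) p))

  valid#? : ∀ {n} (X : Subset n) k P → Dec (Valid X P × length P ≡ k)
  valid#? X k P = valid? X P ×-dec (length P ℕₚ.≟ k)

  #valid : ∀ {n} → Subset n → ℕ → ℕ
  #valid {n} X k = ∑ (λ P → ⟦ valid#? X k P ⟧) (families n)

  D₂≡#valid : ∀ n k → D₂ n k ≡ #valid (⊤ {n}) k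
  D₂≡#valid n k = trans (length-filter-∑ (isCounted? n k) (families n))
    (∑-cong (λ P → ⟦⟧-⇔ (isCounted? n k P) (valid#? ⊤ k P) IsCounted⇒Valid Valid⇒IsCounted) (families n))

  ∑-families-suc : ∀ {n} (φ : List (Subset (suc n)) → ℕ) → ∑ φ (families (suc n)) ≡ ∑ (λ q → ∑ (λ p → φ (join q p)) (families n)) (families n)
  ∑-families-suc {n} φ = begin
    ∑ φ (sublists (map (outside ∷_) S ++ map (inside ∷_) S))
      ≡⟨ ∑-sublists-++ φ (map (outside ∷_) S) (map (inside ∷_) S) ⟩
    ∑ (λ q → ∑ (λ p → φ (q ++ p)) (sublists (map (inside ∷_) S))) (sublists (map (outside ∷_) S))
      ≡⟨ cong₂ (λ U V → ∑ (λ q → ∑ (λ p → φ (q ++ p)) U) V) (sublists-map (inside ∷_) S) (sublists-map (outside ∷_) S) ⟩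
    ∑ (λ q → ∑ (λ p → φ (q ++ p)) (map (map (inside ∷_)) (families n))) (map (map (outside ∷_)) (families n))
      ≡⟨ ∑-map _ (map (outside ∷_)) (families n) ⟩
    ∑ (λ q → ∑ (λ p → φ (map (outside ∷_) q ++ p)) (map (map (inside ∷_)) (families n))) (families n)
      ≡⟨ ∑-cong (λ q → ∑-map (λ p → φ (map (outside ∷_) q ++ p)) (map (inside ∷_)) (families n)) (families n) ⟩
    ∑ (λ q → ∑ (λ p → φ (join q p)) (families n)) (families n) ∎
    where
    open ≡-Reasoning
    S = subsets n

  #valid-out : ∀ {n} (X : Subset n) k → #valid (outside ∷ X) k ≡ #valid X k
  #valid-out {n} X k = trans (∑-families-suc φ) (∑-cong (λ q → trans
      (∑-sublists-[] (λ p → φ (join q p)) (λ b p → ⟦⟧-no (valid#? (outside ∷ X) k (join q (b ∷ p))) (¬Valid-out-in q b p ∘ proj₁)) (subsets n))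
      (⟦⟧-⇔ (valid#? (outside ∷ X) k (join q [])) (valid#? X k q)
        (λ (v , len) → Valid-out q v , trans (sym (len-eq q)) len)
        (λ (v , len) → Valid-out⁻ q v , trans (len-eq q) len)))
    (families n))
    where
    φ : List (Subset (suc n)) → ℕ
    φ P = ⟦ valid#? (outside ∷ X) k P ⟧
    len-eq : ∀ q → length (join {n} q []) ≡ length q
    len-eq q = trans (length-join q []) (ℕₚ.+-identityʳ _)

  blocks? : ∀ {n} (X b : Subset n) → Dec (0 < ∣ b ∣ × b ⊆ X)
  blocks? X b = (0 ℕₚ.<? ∣ b ∣) ×-dec (b ⊆? X)

  #valid-in-0 : ∀ {n} (X : Subset n) → #valid (inside ∷ X) 0 ≡ 0
  #valid-in-0 {n} X = ∑-0 none (families (suc n))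
    where
    none : ∀ P → ⟦ valid#? (inside ∷ X) 0 P ⟧ ≡ 0
    none []      = refl
    none (b ∷ P) = ⟦⟧-no (valid#? (inside ∷ X) 0 (b ∷ P)) λ ()

  -- Exactly one block contains the first element. What else it contains is a subset `b` of `X`,
  -- nonempty because singletons are excluded, and the other blocks partition `X ─ b`.
  #valid-in : ∀ {n} (X : Subset n) k → #valid (inside ∷ X) (suc k) ≡ ∑ (λ b → ⟦ blocks? X b ⟧ * #valid (X ─ b) k) (subsets n)
  #valid-in {n} X k = begin
    #valid (inside ∷ X) (suc k)
      ≡⟨ ∑-families-suc φ ⟩
    ∑ (λ q → ∑ (λ p → φ (join q p)) (families n)) (families n)
      ≡⟨ ∑-cong (λ q → ∑-sublists-[x] (λ p → φ (join q p))
           (⟦⟧-no (valid#? (inside ∷ X) (suc k) (join q [])) (¬Valid-in-[] q ∘ proj₁))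
           (λ b c p → ⟦⟧-no (valid#? (inside ∷ X) (suc k) (join q (b ∷ c ∷ p))) (¬Valid-in-in q b c p ∘ proj₁)) (subsets n)) (families n) ⟩
    ∑ (λ q → ∑ (λ b → φ (join q (b ∷ []))) (subsets n)) (families n)
      ≡⟨ ∑-swap (λ q b → φ (join q (b ∷ []))) (families n) (subsets n) ⟩
    ∑ (λ b → ∑ (λ q → φ (join q (b ∷ []))) (families n)) (subsets n)
      ≡⟨ ∑-cong (λ b → trans (∑-cong (λ q → trans
           (⟦⟧-⇔ (valid#? (inside ∷ X) (suc k) (join q (b ∷ []))) (blocks? X b ×-dec valid#? (X ─ b) k q)
             (λ (v , len) → let bl , v′ = Valid-in q b v in bl , v′ , ℕₚ.suc-injective (trans (sym (len-eq q b)) len))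
             (λ (bl , v , len) → Valid-in⁻ q b (bl , v) , trans (len-eq q b) (cong suc len)))
           (⟦⟧-× (blocks? X b) (valid#? (X ─ b) k q))) (families n)) (∑-*ˡ ⟦ blocks? X b ⟧ _ (families n))) (subsets n) ⟩
    ∑ (λ b → ⟦ blocks? X b ⟧ * #valid (X ─ b) k) (subsets n) ∎
    where
    open ≡-Reasoning
    φ : List (Subset (suc n)) → ℕ
    φ P = ⟦ valid#? (inside ∷ X) (suc k) P ⟧
    len-eq : ∀ q b → length (join {n} q (b ∷ [])) ≡ suc (length q)
    len-eq q b = trans (length-join q (b ∷ [])) (ℕₚ.+-comm (length q) 1)

  -- Sums over subsets and the recurrence for D(n,k)

  -- subsetSum u m and subsetSum⁺ u m are the sums of u (m − ∣b∣) over all, respectively all nonempty, subsets b of [m].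
  subsetSum : (ℕ → ℕ) → ℕ → ℕ
  subsetSum u zero    = u 0
  subsetSum u (suc m) = subsetSum u m + subsetSum (u ∘ suc) m

  subsetSum⁺ : (ℕ → ℕ) → ℕ → ℕ
  subsetSum⁺ u zero    = 0
  subsetSum⁺ u (suc m) = subsetSum u m + subsetSum⁺ (u ∘ suc) m

  ∑-subsets : ∀ {n} (X : Subset n) u → ∑ (λ b → ⟦ b ⊆? X ⟧ * u ∣ X ─ b ∣) (subsets n) ≡ subsetSum u ∣ X ∣
  ∑-subsets []            u = trans (ℕₚ.+-identityʳ _) (ℕₚ.+-identityʳ _)
  ∑-subsets {suc n} (outside ∷ X) u = trans (∑-++ ψ (map (outside ∷_) (subsets n)) _) (trans (cong₂ _+_
      (trans (∑-map ψ (outside ∷_) (subsets n)) (trans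
        (∑-cong (λ b → cong (_* u ∣ X ─ b ∣) (⟦⟧-⇔ ((outside ∷ b) ⊆? (outside ∷ X)) (b ⊆? X) drop-∷-⊆ out⊆)) (subsets n)) (∑-subsets X u)))
      (trans (∑-map ψ (inside ∷_) (subsets n)) (∑-0 (λ b → cong (_* u ∣ X ─ b ∣) (⟦⟧-no ((inside ∷ b) ⊆? (outside ∷ X)) λ h → contradiction (h here) λ ())) (subsets n))))
    (ℕₚ.+-identityʳ _))
    where
    ψ : Subset (suc n) → ℕ
    ψ b = ⟦ b ⊆? (outside ∷ X) ⟧ * u ∣ (outside ∷ X) ─ b ∣
  ∑-subsets {suc n} (inside ∷ X) u = trans (∑-++ ψ (map (outside ∷_) (subsets n)) _) (trans (cong₂ _+_
      (trans (∑-map ψ (outside ∷_) (subsets n)) (trans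
        (∑-cong (λ b → cong (_* u (suc ∣ X ─ b ∣)) (⟦⟧-⇔ ((outside ∷ b) ⊆? (inside ∷ X)) (b ⊆? X) drop-∷-⊆ out⊆)) (subsets n)) (∑-subsets X (u ∘ suc))))
      (trans (∑-map ψ (inside ∷_) (subsets n)) (trans
        (∑-cong (λ b → cong (_* u ∣ X ─ b ∣) (⟦⟧-⇔ ((inside ∷ b) ⊆? (inside ∷ X)) (b ⊆? X) drop-∷-⊆ in⊆in)) (subsets n)) (∑-subsets X u))))
    (ℕₚ.+-comm (subsetSum (u ∘ suc) ∣ X ∣) (subsetSum u ∣ X ∣)))
    where
    ψ : Subset (suc n) → ℕ
    ψ b = ⟦ b ⊆? (inside ∷ X) ⟧ * u ∣ (inside ∷ X) ─ b ∣

  ∑-subsets⁺ : ∀ {n} (X : Subset n) u → ∑ (λ b → ⟦ blocks? X b ⟧ * u ∣ X ─ b ∣) (subsets n) ≡ subsetSum⁺ u ∣ X ∣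
  ∑-subsets⁺ []            u = refl
  ∑-subsets⁺ {suc n} (outside ∷ X) u = trans (∑-++ ψ (map (outside ∷_) (subsets n)) _) (trans (cong₂ _+_
      (trans (∑-map ψ (outside ∷_) (subsets n)) (trans
        (∑-cong (λ b → cong (_* u ∣ X ─ b ∣) (⟦⟧-⇔ (blocks? (outside ∷ X) (outside ∷ b)) (blocks? X b) (λ (p , s) → p , drop-∷-⊆ s) (λ (p , s) → p , out⊆ s))) (subsets n)) (∑-subsets⁺ X u)))
      (trans (∑-map ψ (inside ∷_) (subsets n)) (∑-0 (λ b → cong (_* u ∣ X ─ b ∣) (⟦⟧-no (blocks? (outside ∷ X) (inside ∷ b)) λ (_ , h) → contradiction (h here) λ ())) (subsets n))))
    (ℕₚ.+-identityʳ _))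
    where
    ψ : Subset (suc n) → ℕ
    ψ b = ⟦ blocks? (outside ∷ X) b ⟧ * u ∣ (outside ∷ X) ─ b ∣
  ∑-subsets⁺ {suc n} (inside ∷ X) u = trans (∑-++ ψ (map (outside ∷_) (subsets n)) _) (trans (cong₂ _+_
      (trans (∑-map ψ (outside ∷_) (subsets n)) (trans
        (∑-cong (λ b → cong (_* u (suc ∣ X ─ b ∣)) (⟦⟧-⇔ (blocks? (inside ∷ X) (outside ∷ b)) (blocks? X b) (λ (p , s) → p , drop-∷-⊆ s) (λ (p , s) → p , out⊆ s))) (subsets n)) (∑-subsets⁺ X (u ∘ suc))))
      (trans (∑-map ψ (inside ∷_) (subsets n)) (trans
        (∑-cong (λ b → cong (_* u ∣ X ─ b ∣) (⟦⟧-⇔ (blocks? (inside ∷ X) (inside ∷ b)) (b ⊆? X) (λ (_ , s) → drop-∷-⊆ s) (λ s → s≤s z≤n , in⊆in s))) (subsets n)) (∑-subsets X u))))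
    (ℕₚ.+-comm (subsetSum⁺ (u ∘ suc) ∣ X ∣) (subsetSum u ∣ X ∣)))
    where
    ψ : Subset (suc n) → ℕ
    ψ b = ⟦ blocks? (inside ∷ X) b ⟧ * u ∣ (inside ∷ X) ─ b ∣

  -- S₂ k m is D(m,k): the block of the first of suc m elements is determined by a nonempty subset of the other m.
  S₂ : ℕ → ℕ → ℕ
  S₂ zero    zero    = 1
  S₂ zero    (suc m) = 0
  S₂ (suc k) zero    = 0
  S₂ (suc k) (suc m) = subsetSum⁺ (S₂ k) m

  #valid≡S₂ : ∀ {n} (X : Subset n) k → #valid X k ≡ S₂ k ∣ X ∣
  #valid≡S₂ []            zero    = refl
  #valid≡S₂ []            (suc k) = refl
  #valid≡S₂ (outside ∷ X) k       = trans (#valid-out X k) (#valid≡S₂ X k)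
  #valid≡S₂ (inside ∷ X)  zero    = #valid-in-0 X
  #valid≡S₂ {suc n} (inside ∷ X) (suc k) = trans (#valid-in X k)
    (trans (∑-cong (λ b → cong (⟦ blocks? X b ⟧ *_) (#valid≡S₂ (X ─ b) k)) (subsets n)) (∑-subsets⁺ X (S₂ k)))

  D₂≡S₂ : ∀ n k → D₂ n k ≡ S₂ k n
  D₂≡S₂ n k = trans (D₂≡#valid n k) (trans (#valid≡S₂ (⊤ {n}) k) (cong (S₂ k) (∣⊤∣≡n n)))

  subsetSum-cong : ∀ {u v : ℕ → ℕ} → (∀ i → u i ≡ v i) → ∀ m → subsetSum u m ≡ subsetSum v m
  subsetSum-cong eq zero    = eq 0
  subsetSum-cong eq (suc m) = cong₂ _+_ (subsetSum-cong eq m) (subsetSum-cong (eq ∘ suc) m)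

  subsetSum⁺-cong : ∀ {u v : ℕ → ℕ} → (∀ i → u i ≡ v i) → ∀ m → subsetSum⁺ u m ≡ subsetSum⁺ v m
  subsetSum⁺-cong eq zero    = refl
  subsetSum⁺-cong eq (suc m) = cong₂ _+_ (subsetSum-cong eq m) (subsetSum⁺-cong (eq ∘ suc) m)

  subsetSum-split : ∀ u m → subsetSum u m ≡ u m + subsetSum⁺ u m
  subsetSum-split u zero    = sym (ℕₚ.+-identityʳ _)
  subsetSum-split u (suc m) = trans (cong (subsetSum u m +_) (subsetSum-split (u ∘ suc) m))
    (solve 3 (λ a b c → a :+ (b :+ c) := b :+ (a :+ c)) refl (subsetSum u m) (u (suc m)) (subsetSum⁺ (u ∘ suc) m))

  subsetSum-+ : ∀ u v m → subsetSum (λ i → u i + v i) m ≡ subsetSum u m + subsetSum v m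
  subsetSum-+ u v zero    = refl
  subsetSum-+ u v (suc m) = trans (cong₂ _+_ (subsetSum-+ u v m) (subsetSum-+ (u ∘ suc) (v ∘ suc) m))
    (solve 4 (λ a b c d → a :+ b :+ (c :+ d) := a :+ c :+ (b :+ d)) refl (subsetSum u m) (subsetSum v m) (subsetSum (u ∘ suc) m) (subsetSum (v ∘ suc) m))

  subsetSum⁺-+ : ∀ u v m → subsetSum⁺ (λ i → u i + v i) m ≡ subsetSum⁺ u m + subsetSum⁺ v m
  subsetSum⁺-+ u v zero    = refl
  subsetSum⁺-+ u v (suc m) = trans (cong₂ _+_ (subsetSum-+ u v m) (subsetSum⁺-+ (u ∘ suc) (v ∘ suc) m))
    (solve 4 (λ a b c d → a :+ b :+ (c :+ d) := a :+ c :+ (b :+ d)) refl (subsetSum u m) (subsetSum v m) (subsetSum⁺ (u ∘ suc) m) (subsetSum⁺ (v ∘ suc) m))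

  subsetSum-* : ∀ c u m → subsetSum (λ i → c * u i) m ≡ c * subsetSum u m
  subsetSum-* c u zero    = refl
  subsetSum-* c u (suc m) = trans (cong₂ _+_ (subsetSum-* c u m) (subsetSum-* c (u ∘ suc) m)) (sym (ℕₚ.*-distribˡ-+ c (subsetSum u m) _))

  subsetSum⁺-* : ∀ c u m → subsetSum⁺ (λ i → c * u i) m ≡ c * subsetSum⁺ u m
  subsetSum⁺-* c u zero    = sym (ℕₚ.*-zeroʳ c)
  subsetSum⁺-* c u (suc m) = trans (cong₂ _+_ (subsetSum-* c u m) (subsetSum⁺-* c (u ∘ suc) m)) (sym (ℕₚ.*-distribˡ-+ c (subsetSum u m) _))

  -- On exponential generating functions raise is multiplication by t, subsetSum by eᵗ.
  raise : (ℕ → ℕ) → ℕ → ℕ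
  raise u zero    = 0
  raise u (suc m) = suc m * u m

  -- A shift of the sequence differentiates its exponential generating function, so this is the
  -- product rule for t u.
  raise-suc : ∀ u i → raise u (suc i) ≡ u i + raise (u ∘ suc) i
  raise-suc u zero    = refl
  raise-suc u (suc i) = refl

  subsetSum-raise : ∀ u m → subsetSum (raise u) m ≡ raise (subsetSum u) m
  subsetSum-raise u zero    = refl
  subsetSum-raise u (suc m) = begin
    subsetSum (raise u) m + subsetSum (raise u ∘ suc) m                 ≡⟨ cong₂ _+_ (subsetSum-raise u m) (trans (subsetSum-cong (raise-suc u) m) (subsetSum-+ u (raise (u ∘ suc)) m)) ⟩
    raise (subsetSum u) m + (subsetSum u m + subsetSum (raise (u ∘ suc)) m)     ≡⟨ cong (λ z → raise (subsetSum u) m + (subsetSum u m + z)) (subsetSum-raise (u ∘ suc) m) ⟩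
    raise (subsetSum u) m + (subsetSum u m + raise (subsetSum (u ∘ suc)) m)     ≡⟨ collect m ⟩
    suc m * subsetSum u m                               ∎
    where
    open ≡-Reasoning
    collect : ∀ m → raise (subsetSum u) m + (subsetSum u m + raise (subsetSum (u ∘ suc)) m) ≡ suc m * subsetSum u m
    collect zero    = refl
    collect (suc m) = solve 3 (λ m a b → (con 1 :+ m) :* a :+ ((a :+ b) :+ (con 1 :+ m) :* b)
      := (con 2 :+ m) :* (a :+ b)) refl m (subsetSum u m) (subsetSum (u ∘ suc) m)

  subsetSum⁺-raise : ∀ u m → subsetSum⁺ (raise u) m ≡ raise (subsetSum⁺ u) m
  subsetSum⁺-raise u zero    = refl
  subsetSum⁺-raise u (suc m) = begin
    subsetSum (raise u) m + subsetSum⁺ (raise u ∘ suc) m                 ≡⟨ cong₂ _+_ (subsetSum-raise u m) (trans (subsetSum⁺-cong (raise-suc u) m) (subsetSum⁺-+ u (raise (u ∘ suc)) m)) ⟩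
    raise (subsetSum u) m + (subsetSum⁺ u m + subsetSum⁺ (raise (u ∘ suc)) m)     ≡⟨ cong (λ z → raise (subsetSum u) m + (subsetSum⁺ u m + z)) (subsetSum⁺-raise (u ∘ suc) m) ⟩
    raise (subsetSum u) m + (subsetSum⁺ u m + raise (subsetSum⁺ (u ∘ suc)) m)     ≡⟨ collect m ⟩
    suc m * subsetSum⁺ u m                               ∎
    where
    open ≡-Reasoning
    collect : ∀ m → raise (subsetSum u) m + (subsetSum⁺ u m + raise (subsetSum⁺ (u ∘ suc)) m) ≡ suc m * subsetSum⁺ u m
    collect zero    = refl
    collect (suc m) = solve 3 (λ m a b → (con 1 :+ m) :* a :+ ((a :+ b) :+ (con 1 :+ m) :* b)
      := (con 2 :+ m) :* (a :+ b)) refl m (subsetSum u m) (subsetSum⁺ (u ∘ suc) m)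

  -- The exponential generating function of `S₂ k` is F_k = (eᵗ - 1 - t)ᵏ / k!, and the claim reads
  -- F_{k+1}′ = (k + 1) F_{k+1} + t F_k. The induction differentiates the defining relation F_{k+1}′
  -- = (eᵗ - 1) F_k once more and applies the claim for the smaller k to the factor F_k′.
  S₂-recurrence : ∀ k m → S₂ (suc k) (suc m) ≡ suc k * S₂ (suc k) m + raise (S₂ k) m
  S₂-recurrence k zero = sym (trans (ℕₚ.+-identityʳ _) (ℕₚ.*-zeroʳ (suc k)))
  S₂-recurrence zero (suc m) = begin
    subsetSum (S₂ 0) m + subsetSum⁺ (λ _ → 0) m             ≡⟨ cong₂ _+_ (subsetSum-split (S₂ 0) m) (subsetSum⁺-0 m) ⟩
    S₂ 0 m + subsetSum⁺ (S₂ 0) m + 0                 ≡⟨ S₂-0 m ⟩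
    1 * subsetSum⁺ (S₂ 0) m + suc m * S₂ 0 m         ∎
    where
    open ≡-Reasoning
    subsetSum-0 : ∀ m → subsetSum (λ _ → 0) m ≡ 0
    subsetSum-0 zero    = refl
    subsetSum-0 (suc m) = cong₂ _+_ (subsetSum-0 m) (subsetSum-0 m)
    subsetSum⁺-0 : ∀ m → subsetSum⁺ (λ _ → 0) m ≡ 0
    subsetSum⁺-0 zero    = refl
    subsetSum⁺-0 (suc m) = cong₂ _+_ (subsetSum-0 m) (subsetSum⁺-0 m)
    S₂-0 : ∀ m → S₂ 0 m + subsetSum⁺ (S₂ 0) m + 0 ≡ 1 * subsetSum⁺ (S₂ 0) m + suc m * S₂ 0 m
    S₂-0 zero    = refl
    S₂-0 (suc m) = solve 2 (λ m x → x :+ con 0 := con 1 :* x :+ (con 2 :+ m) :* con 0) refl m (subsetSum⁺ (S₂ 0) (suc m))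
  S₂-recurrence (suc j) (suc m) = begin
    subsetSum (S₂ (suc j)) m + subsetSum⁺ (subsetSum⁺ (S₂ j)) m
      ≡⟨ cong₂ _+_ (subsetSum-split (S₂ (suc j)) m) (trans (subsetSum⁺-cong (S₂-recurrence j) m) (trans (subsetSum⁺-+ (λ i → suc j * S₂ (suc j) i) (raise (S₂ j)) m)
           (cong₂ _+_ (subsetSum⁺-* (suc j) (S₂ (suc j)) m) (trans (subsetSum⁺-raise (S₂ j) m) (raise-S₂ m))))) ⟩
    S₂ (suc j) m + subsetSum⁺ (S₂ (suc j)) m + (suc j * subsetSum⁺ (S₂ (suc j)) m + m * S₂ (suc j) m)
      ≡⟨ solve 4 (λ r b j m → r :+ b :+ ((con 1 :+ j) :* b :+ m :* r)
           := (con 2 :+ j) :* b :+ (con 1 :+ m) :* r) refl (S₂ (suc j) m) (subsetSum⁺ (S₂ (suc j)) m) j m ⟩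
    suc (suc j) * subsetSum⁺ (S₂ (suc j)) m + suc m * S₂ (suc j) m ∎
    where
    open ≡-Reasoning
    raise-S₂ : ∀ m → raise (subsetSum⁺ (S₂ j)) m ≡ m * S₂ (suc j) m
    raise-S₂ zero    = refl
    raise-S₂ (suc m) = refl

-- Polynomials over ℚ tested against linear functionals

module Polynomials where

  open import Algebra.Bundles using (CommutativeRing)
  import Algebra.Solver.Ring
  import Algebra.Solver.Ring.AlmostCommutativeRing as ACR
  open import Data.List.Base using (List; []; _∷_)
  import Data.Maybe.Base as Maybe
  open import Data.Nat.Base as ℕ using (ℕ; zero; suc; z≤n; s≤s)
  import Data.Nat.Properties as ℕₚ
  open import Data.Product.Base using (_×_; _,_; proj₁; proj₂; Σ)
  open import Data.Rational.Base hiding (NonZero)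
  open import Data.Rational.Properties
  open import Data.Rational.Solver using (module +-*-Solver)
  open import Data.Sum.Base using (_⊎_; inj₁; inj₂)
  open import Function.Base using (_∘_)
  open import Relation.Binary.PropositionalEquality using (_≡_; _≢_; refl; sym; trans; cong; cong₂; subst; subst₂; module ≡-Reasoning)
  open import Relation.Binary.Definitions using (WeaklyDecidable)
  open import Relation.Binary.Structures using (IsEquivalence)
  open import Relation.Nullary using (yes; no; contradiction)
  open import Relation.Nullary.Decidable using (dec⇒maybe)
  open +-*-Solver using (solve; _:+_; _:*_; _:-_; :-_; _:=_; con)

  Seq : Set
  Seq = ℕ → ℚ

  Poly : Set
  Poly = List ℚ

  infixl 8 _·_

  -- p · s is the value at p of the linear functional sending xⁱ to s i.
  _·_ : Poly → Seq → ℚ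
  []      · s = 0ℚ
  (a ∷ p) · s = a * s 0 + p · (s ∘ suc)

  ·-cong : ∀ p {s t : Seq} → (∀ i → s i ≡ t i) → p · s ≡ p · t
  ·-cong []      eq = refl
  ·-cong (a ∷ p) eq = cong₂ (λ x y → a * x + y) (eq 0) (·-cong p (eq ∘ suc))

  ·-+ : ∀ p (s t : Seq) → p · (λ i → s i + t i) ≡ p · s + p · t
  ·-+ []      s t = sym (+-identityˡ 0ℚ)
  ·-+ (a ∷ p) s t = trans (cong (a * (s 0 + t 0) +_) (·-+ p _ _))
    (solve 5 (λ a x y u v → a :* (x :+ y) :+ (u :+ v) := (a :* x :+ u) :+ (a :* y :+ v)) refl a (s 0) (t 0) _ _)

  ·-* : ∀ p c (s : Seq) → p · (λ i → c * s i) ≡ c * p · s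
  ·-* []      c s = sym (*-zeroʳ c)
  ·-* (a ∷ p) c s = trans (cong (a * (c * s 0) +_) (·-* p c _))
    (solve 4 (λ a c x u → a :* (c :* x) :+ c :* u := c :* (a :* x :+ u)) refl a c (s 0) _)

  ·-*ʳ : ∀ p (s : Seq) c → p · (λ i → s i * c) ≡ p · s * c
  ·-*ʳ p s c = trans (·-cong p (λ i → *-comm (s i) c)) (trans (·-* p c s) (*-comm c _))

  ·-neg : ∀ p (s : Seq) → p · (λ i → - s i) ≡ - (p · s)
  ·-neg []      s = refl
  ·-neg (a ∷ p) s = trans (cong (a * (- s 0) +_) (·-neg p _))
    (solve 3 (λ a x u → a :* (:- x) :+ (:- u) := :- (a :* x :+ u)) refl a (s 0) _)

  ·-- : ∀ p (s t : Seq) → p · (λ i → s i - t i) ≡ p · s - p · t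
  ·-- p s t = trans (·-+ p s _) (cong (p · s +_) (·-neg p t))

  ·-0 : ∀ p → p · (λ _ → 0ℚ) ≡ 0ℚ
  ·-0 []      = refl
  ·-0 (a ∷ p) = trans (cong (a * 0ℚ +_) (·-0 p)) (trans (+-identityʳ _) (*-zeroʳ a))

  ·-swap : ∀ p q (M : ℕ → ℕ → ℚ) → p · (λ i → q · M i) ≡ q · (λ j → p · (λ i → M i j))
  ·-swap []      q M = sym (·-0 q)
  ·-swap (a ∷ p) q M = begin
    a * q · M 0 + p · (λ i → q · M (suc i))                     ≡⟨ cong₂ _+_ (sym (·-* q a (M 0))) (·-swap p q (M ∘ suc)) ⟩
    q · (λ j → a * M 0 j) + q · (λ j → p · (λ i → M (suc i) j)) ≡⟨ sym (·-+ q _ _) ⟩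
    q · (λ j → a * M 0 j + p · (λ i → M (suc i) j))             ∎
    where open ≡-Reasoning

  infix 4 _≈_

  -- Testing against all functionals ignores trailing zeros and reduces every ring law to an
  -- identity in ℚ.
  record _≈_ (p q : Poly) : Set where
    constructor mk≈
    field at : ∀ s → p · s ≡ q · s
  open _≈_

  infixl 6 _⊕_
  infixl 7 _⊗_
  infix  8 ⊖_

  C : ℚ → Poly
  C a = a ∷ []

  X : Poly
  X = 0ℚ ∷ 1ℚ ∷ []

  infixr 8 _⋆_

  -- The transpose of multiplication by p, see ⊗-·.
  _⋆_ : Poly → Seq → Seq
  (p ⋆ s) j = p · (λ i → s (j ℕ.+ i))

  opaque
    _⊕_ : Poly → Poly → Poly
    []      ⊕ q       = q
    (a ∷ p) ⊕ []      = a ∷ p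
    (a ∷ p) ⊕ (b ∷ q) = a + b ∷ p ⊕ q

    _⊙_ : ℚ → Poly → Poly
    c ⊙ []      = []
    c ⊙ (a ∷ p) = c * a ∷ c ⊙ p

    ⊖_ : Poly → Poly
    ⊖ p = (- 1ℚ) ⊙ p

    _⊗_ : Poly → Poly → Poly
    []      ⊗ q = []
    (a ∷ p) ⊗ q = a ⊙ q ⊕ (0ℚ ∷ p ⊗ q)

    ⊕-· : ∀ p q s → (p ⊕ q) · s ≡ p · s + q · s
    ⊕-· []      q       s = sym (+-identityˡ _)
    ⊕-· (a ∷ p) []      s = sym (+-identityʳ _)
    ⊕-· (a ∷ p) (b ∷ q) s = trans (cong ((a + b) * s 0 +_) (⊕-· p q _))
      (solve 5 (λ a b x u v → (a :+ b) :* x :+ (u :+ v) := (a :* x :+ u) :+ (b :* x :+ v)) refl a b (s 0) _ _)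

    ⊙-· : ∀ c p s → (c ⊙ p) · s ≡ c * p · s
    ⊙-· c []      s = sym (*-zeroʳ c)
    ⊙-· c (a ∷ p) s = trans (cong (c * a * s 0 +_) (⊙-· c p _))
      (solve 4 (λ c a x u → c :* a :* x :+ c :* u := c :* (a :* x :+ u)) refl c a (s 0) _)

    ⊖-· : ∀ p s → (⊖ p) · s ≡ - (p · s)
    ⊖-· p s = trans (⊙-· (- 1ℚ) p s) (solve 1 (λ x → (:- con 1ℚ) :* x := :- x) refl (p · s))

    ⊗-· : ∀ p q s → (p ⊗ q) · s ≡ q · (p ⋆ s)
    ⊗-· []      q s = sym (·-0 q)
    ⊗-· (a ∷ p) q s = begin
      (a ⊙ q ⊕ (0ℚ ∷ p ⊗ q)) · s
        ≡⟨ ⊕-· (a ⊙ q) _ s ⟩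
      (a ⊙ q) · s + (0ℚ * s 0 + (p ⊗ q) · (s ∘ suc))
        ≡⟨ cong₂ _+_ (⊙-· a q s) (cong₂ _+_ (*-zeroˡ (s 0)) (⊗-· p q _)) ⟩
      a * q · s + (0ℚ + q · (p ⋆ (s ∘ suc)))
        ≡⟨ cong₂ _+_ (sym (·-* q a s)) (+-identityˡ _) ⟩
      q · (λ j → a * s j) + q · (p ⋆ (s ∘ suc))
        ≡⟨ sym (·-+ q _ _) ⟩
      q · (λ j → a * s j + (p ⋆ (s ∘ suc)) j)
        ≡⟨ ·-cong q (λ j → cong₂ (λ x y → a * x + y) (cong s (sym (ℕₚ.+-identityʳ j)))
                              (·-cong p λ i → cong s (sym (ℕₚ.+-suc j i)))) ⟩
      q · ((a ∷ p) ⋆ s) ∎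
      where open ≡-Reasoning

    C-⊕ : ∀ a b → C a ⊕ C b ≡ C (a + b)
    C-⊕ a b = refl

  X⊗-· : ∀ p s → (X ⊗ p) · s ≡ p · (s ∘ suc)
  X⊗-· p s = trans (⊗-· X p s) (·-cong p λ j → trans
    (solve 2 (λ x y → con 0ℚ :* x :+ (con 1ℚ :* y :+ con 0ℚ) := y) refl (s (j ℕ.+ 0)) (s (j ℕ.+ 1)))
    (cong s (trans (ℕₚ.+-suc j 0) (cong suc (ℕₚ.+-identityʳ j)))))

  C⊗-· : ∀ c p s → (C c ⊗ p) · s ≡ c * p · s
  C⊗-· c p s = trans (⊗-· (C c) p s) (trans
    (·-cong p (λ j → trans (+-identityʳ _) (cong (λ k → c * s k) (ℕₚ.+-identityʳ j)))) (·-* p c s))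

  polyRing : CommutativeRing _ _
  polyRing = record
    { Carrier = Poly
    ; _≈_ = _≈_
    ; _+_ = _⊕_
    ; _*_ = _⊗_
    ; -_ = ⊖_
    ; 0# = []
    ; 1# = C 1ℚ
    ; isCommutativeRing = record
      { isRing = record
        { +-isAbelianGroup = record
          { isGroup = record
            { isMonoid = record
              { isSemigroup = record
                { isMagma = record { isEquivalence = ≈-isEquivalence ; ∙-cong = ⊕-cong }
                ; assoc = λ p q r → mk≈ λ s → begin
                    ((p ⊕ q) ⊕ r) · s       ≡⟨ ⊕-·₃ p q r s ⟩
                    p · s + q · s + r · s   ≡⟨ +-assoc (p · s) _ _ ⟩
                    p · s + (q · s + r · s) ≡⟨ cong (p · s +_) (sym (⊕-· q r s)) ⟩
                    p · s + (q ⊕ r) · s     ≡⟨ sym (⊕-· p (q ⊕ r) s) ⟩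
                    (p ⊕ (q ⊕ r)) · s       ∎
                }
              ; identity = (λ p → mk≈ λ s → trans (⊕-· [] p s) (+-identityˡ _)) , λ p → mk≈ λ s → trans (⊕-· p [] s) (+-identityʳ _)
              }
            ; inverse = (λ p → mk≈ λ s → trans (⊕-· (⊖ p) p s) (trans (cong (_+ p · s) (⊖-· p s)) (+-inverseˡ (p · s))))
                      , (λ p → mk≈ λ s → trans (⊕-· p (⊖ p) s) (trans (cong (p · s +_) (⊖-· p s)) (+-inverseʳ (p · s))))
            ; ⁻¹-cong = λ {p} {q} eq → mk≈ λ s → trans (⊖-· p s) (trans (cong -_ (at eq s)) (sym (⊖-· q s)))
            }
          ; comm = ⊕-comm
          }
        ; *-cong = ⊗-cong
        ; *-assoc = ⊗-assoc
        ; *-identity = ⊗-identityˡ , λ p → ≈-trans (⊗-comm p (C 1ℚ)) (⊗-identityˡ p)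
        ; distrib = ⊗-distribˡ , λ p q r → ≈-trans (⊗-comm (q ⊕ r) p) (≈-trans (⊗-distribˡ p q r) (⊕-cong (⊗-comm p q) (⊗-comm p r)))
        }
      ; *-comm = ⊗-comm
      }
    }
    where
    open ≡-Reasoning
    ≈-isEquivalence : IsEquivalence _≈_
    ≈-isEquivalence = record
      { refl = mk≈ λ s → refl
      ; sym = λ eq → mk≈ λ s → sym (at eq s)
      ; trans = λ eq eq′ → mk≈ λ s → trans (at eq s) (at eq′ s)
      }
    open IsEquivalence ≈-isEquivalence using () renaming (trans to ≈-trans)
    ⊕-·₃ : ∀ p q r s → ((p ⊕ q) ⊕ r) · s ≡ p · s + q · s + r · s
    ⊕-·₃ p q r s = trans (⊕-· (p ⊕ q) r s) (cong (_+ r · s) (⊕-· p q s))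
    ⊕-cong : ∀ {p q u v} → p ≈ q → u ≈ v → p ⊕ u ≈ q ⊕ v
    ⊕-cong {p} {q} {u} {v} eq eq′ = mk≈ λ s → trans (⊕-· p u s) (trans (cong₂ _+_ (at eq s) (at eq′ s)) (sym (⊕-· q v s)))
    ⊕-comm : ∀ p q → p ⊕ q ≈ q ⊕ p
    ⊕-comm p q = mk≈ λ s → trans (⊕-· p q s) (trans (+-comm (p · s) _) (sym (⊕-· q p s)))
    ⊗-comm : ∀ p q → p ⊗ q ≈ q ⊗ p
    ⊗-comm p q = mk≈ λ s → begin
      (p ⊗ q) · s                      ≡⟨ ⊗-· p q s ⟩
      q · (λ j → p · (λ i → s (j ℕ.+ i))) ≡⟨ ·-swap q p _ ⟩
      p · (λ i → q · (λ j → s (j ℕ.+ i))) ≡⟨ ·-cong p (λ i → ·-cong q λ j → cong s (ℕₚ.+-comm j i)) ⟩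
      p · (q ⋆ s)                      ≡⟨ sym (⊗-· q p s) ⟩
      (q ⊗ p) · s                      ∎
    ⊗-cong : ∀ {p q u v} → p ≈ q → u ≈ v → p ⊗ u ≈ q ⊗ v
    ⊗-cong {p} {q} {u} {v} eq eq′ = mk≈ λ s → begin
      (p ⊗ u) · s ≡⟨ ⊗-· p u s ⟩
      u · (p ⋆ s) ≡⟨ ·-cong u (λ j → at eq _) ⟩
      u · (q ⋆ s) ≡⟨ at eq′ _ ⟩
      v · (q ⋆ s) ≡⟨ sym (⊗-· q v s) ⟩
      (q ⊗ v) · s ∎
    ⊗-assoc : ∀ p q r → (p ⊗ q) ⊗ r ≈ p ⊗ (q ⊗ r)
    ⊗-assoc p q r = mk≈ λ s → begin
      ((p ⊗ q) ⊗ r) · s     ≡⟨ ⊗-· (p ⊗ q) r s ⟩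
      r · ((p ⊗ q) ⋆ s)     ≡⟨ ·-cong r (λ k → trans (⊗-· p q _) (·-cong q λ j → ·-cong p λ i → cong s (sym (ℕₚ.+-assoc k j i)))) ⟩
      r · (q ⋆ p ⋆ s)       ≡⟨ sym (⊗-· q r _) ⟩
      (q ⊗ r) · (p ⋆ s)     ≡⟨ sym (⊗-· p (q ⊗ r) s) ⟩
      (p ⊗ (q ⊗ r)) · s     ∎
    ⊗-identityˡ : ∀ p → C 1ℚ ⊗ p ≈ p
    ⊗-identityˡ p = mk≈ λ s → trans (C⊗-· 1ℚ p s) (*-identityˡ _)
    ⊗-distribˡ : ∀ p q r → p ⊗ (q ⊕ r) ≈ p ⊗ q ⊕ p ⊗ r
    ⊗-distribˡ p q r = mk≈ λ s → begin
      (p ⊗ (q ⊕ r)) · s         ≡⟨ ⊗-· p (q ⊕ r) s ⟩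
      (q ⊕ r) · (p ⋆ s)         ≡⟨ ⊕-· q r _ ⟩
      q · (p ⋆ s) + r · (p ⋆ s) ≡⟨ cong₂ _+_ (sym (⊗-· p q s)) (sym (⊗-· p r s)) ⟩
      (p ⊗ q) · s + (p ⊗ r) · s ≡⟨ sym (⊕-· (p ⊗ q) _ s) ⟩
      (p ⊗ q ⊕ p ⊗ r) · s       ∎

  module ≈ = CommutativeRing polyRing

  C-homomorphism : +-*-rawRing ACR.-Raw-AlmostCommutative⟶ ACR.fromCommutativeRing polyRing
  C-homomorphism = record
    { ⟦_⟧    = C
    ; +-homo = λ a b → ≈.reflexive (sym (C-⊕ a b))
    ; *-homo = λ a b → mk≈ λ s → sym (trans (C⊗-· a (C b) s)
        (solve 3 (λ a b x → a :* (b :* x :+ con 0ℚ) := a :* b :* x :+ con 0ℚ) refl a b (s 0)))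
    ; -‿homo = λ a → mk≈ λ s → sym (trans (⊖-· (C a) s) (solve 2 (λ a x → :- (a :* x :+ con 0ℚ) := :- a :* x :+ con 0ℚ) refl a (s 0)))
    ; 0-homo = mk≈ λ s → solve 1 (λ x → con 0ℚ :* x :+ con 0ℚ := con 0ℚ) refl (s 0)
    ; 1-homo = ≈.refl
    }

  C-≟ : WeaklyDecidable (ACR.Induced-equivalence C-homomorphism)
  C-≟ a b = Maybe.map (λ { refl → ≈.refl }) (dec⇒maybe (a ≟ b))

  module PolySolver = Algebra.Solver.Ring +-*-rawRing (ACR.fromCommutativeRing polyRing) C-homomorphism C-≟

  open PolySolver using () renaming (solve to solveₚ; _:+_ to _⊞_; _:*_ to _⊠_; _:=_ to _≋_; con to conₚ)

  -- Order and inverses in ℚ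

  0≤+ : ∀ {a b} → 0ℚ ≤ a → 0ℚ ≤ b → 0ℚ ≤ a + b
  0≤+ = +-mono-≤

  0<+ : ∀ {a b} → 0ℚ < a → 0ℚ ≤ b → 0ℚ < a + b
  0<+ = +-mono-<-≤

  0≤* : ∀ {a b} → 0ℚ ≤ a → 0ℚ ≤ b → 0ℚ ≤ a * b
  0≤* {a} {b} 0≤a 0≤b = nonNegative⁻¹ (a * b) {{nonNeg*nonNeg⇒nonNeg a {{nonNegative 0≤a}} b {{nonNegative 0≤b}}}}

  0<* : ∀ {a b} → 0ℚ < a → 0ℚ < b → 0ℚ < a * b
  0<* {a} {b} 0<a 0<b = positive⁻¹ (a * b) {{pos*pos⇒pos a {{positive 0<a}} b {{positive 0<b}}}}

  ≤⇒0≤- : ∀ {a b} → a ≤ b → 0ℚ ≤ b - a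
  ≤⇒0≤- {a} {b} a≤b = subst (_≤ b - a) (+-inverseʳ a) (+-monoˡ-≤ (- a) a≤b)

  <⇒0<- : ∀ {a b} → a < b → 0ℚ < b - a
  <⇒0<- {a} {b} a<b = subst (_< b - a) (+-inverseʳ a) (+-monoˡ-< (- a) a<b)

  0≤-⇒≤ : ∀ {a b} → 0ℚ ≤ b - a → a ≤ b
  0≤-⇒≤ {a} {b} h = subst₂ _≤_ (+-identityˡ a) (solve 2 (λ a b → b :- a :+ a := b) refl a b) (+-monoˡ-≤ a h)

  0<-⇒< : ∀ {a b} → 0ℚ < b - a → a < b
  0<-⇒< {a} {b} h = subst₂ _<_ (+-identityˡ a) (solve 2 (λ a b → b :- a :+ a := b) refl a b) (+-monoˡ-< a h)

  0≤neg : ∀ {a} → a ≤ 0ℚ → 0ℚ ≤ - a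
  0≤neg = neg-antimono-≤

  0≤² : ∀ a → 0ℚ ≤ a * a
  0≤² a with ≤-total 0ℚ a
  ... | inj₁ 0≤a = 0≤* 0≤a 0≤a
  ... | inj₂ a≤0 = subst (0ℚ ≤_) (solve 1 (λ a → (:- a) :* (:- a) := a :* a) refl a) (0≤* (0≤neg a≤0) (0≤neg a≤0))

  0<⇒≢0 : ∀ {a} → 0ℚ < a → a ≢ 0ℚ
  0<⇒≢0 0<a a≡0 = <⇒≢ 0<a (sym a≡0)

  inverse : ∀ a → a ≢ 0ℚ → Σ ℚ λ b → b * a ≡ 1ℚ
  inverse a a≢0 = 1/_ a {{≢-nonZero a≢0}} , *-inverseˡ a {{≢-nonZero a≢0}}

  0<1 : 0ℚ < 1ℚ
  0<1 = positive⁻¹ 1ℚ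

  *≡0⇒≡0 : ∀ {a b} → a ≢ 0ℚ → a * b ≡ 0ℚ → b ≡ 0ℚ
  *≡0⇒≡0 {a} {b} a≢0 ab≡0 with inverse a a≢0
  ... | c , ca≡1 = begin
    b           ≡⟨ sym (*-identityˡ b) ⟩
    1ℚ * b      ≡⟨ cong (_* b) (sym ca≡1) ⟩
    c * a * b   ≡⟨ *-assoc c a b ⟩
    c * (a * b) ≡⟨ cong (c *_) ab≡0 ⟩
    c * 0ℚ      ≡⟨ *-zeroʳ c ⟩
    0ℚ          ∎
    where open ≡-Reasoning

  ²≤0⇒≡0 : ∀ {a} → a * a ≤ 0ℚ → a ≡ 0ℚ
  ²≤0⇒≡0 {a} h with a ≟ 0ℚ
  ... | yes a≡0 = a≡0
  ... | no a≢0  = contradiction (*≡0⇒≡0 a≢0 (≤-antisym h (0≤² a))) a≢0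

  +≤0ˡ : ∀ {a b} → 0ℚ ≤ b → a + b ≤ 0ℚ → a ≤ 0ℚ
  +≤0ˡ {a} {b} 0≤b h = ≤-trans (subst (_≤ a + b) (+-identityʳ a) (+-monoʳ-≤ a 0≤b)) h

  +≤0ʳ : ∀ {a b} → 0ℚ ≤ a → a + b ≤ 0ℚ → b ≤ 0ℚ
  +≤0ʳ {a} {b} 0≤a h = +≤0ˡ 0≤a (subst (_≤ 0ℚ) (+-comm a b) h)

  *≤0⇒≤0 : ∀ {a b} → 0ℚ < a → a * b ≤ 0ℚ → b ≤ 0ℚ
  *≤0⇒≤0 {a} {b} 0<a h = *-cancelˡ-≤-pos a {{positive 0<a}} (subst (a * b ≤_) (sym (*-zeroʳ a)) h)

  0<*⇒0< : ∀ {a b} → 0ℚ < a → 0ℚ < a * b → 0ℚ < b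
  0<*⇒0< {a} {b} 0<a h = *-cancelˡ-<-nonNeg a {{nonNegative (<⇒≤ 0<a)}} (subst (_< a * b) (sym (*-zeroʳ a)) h)

  0≤*⇒0≤ : ∀ {a b} → 0ℚ < a → 0ℚ ≤ a * b → 0ℚ ≤ b
  0≤*⇒0≤ {a} {b} 0<a h = *-cancelˡ-≤-pos a {{positive 0<a}} (subst (_≤ a * b) (sym (*-zeroʳ a)) h)

  -- Bezoutian forms

  -- bez s i j is s ⊗ s applied to the Bezoutian (xⁱ yʲ − yⁱ xʲ) / (x − y). It is the only antisymmetric solution
  -- of the recurrence bez-step, so identities between Bezoutians reduce to that recurrence.
  bezˡ : Seq → ℕ → ℕ → ℚ
  bezˡ s zero    j = 0ℚ
  bezˡ s (suc i) j = s i * s j + bezˡ s i (suc j)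

  bez : Seq → ℕ → ℕ → ℚ
  bez s i j = bezˡ s i j - bezˡ s j i

  bez-anti : ∀ s i j → bez s i j ≡ - bez s j i
  bez-anti s i j = solve 2 (λ a b → a :- b := :- (b :- a)) refl (bezˡ s i j) (bezˡ s j i)

  bez-step : ∀ s i j → bez s (suc i) j ≡ bez s i (suc j) + (s i * s j + s i * s j)
  bez-step s i j = solve 4 (λ x y u v → (x :* y :+ u) :- v := (u :- (y :* x :+ v)) :+ (x :* y :+ x :* y)) refl
    (s i) (s j) (bezˡ s i (suc j)) (bezˡ s j (suc i))

  -- The recurrence is required only below `d`, which is all that polynomials of degree at most `d`
  -- can see. A solution of simpler shape may then stand in for `bez s`.
  record IsBez (d : ℕ) (s : Seq) (M : ℕ → ℕ → ℚ) : Set where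
    field
      anti : ∀ i j → M i j ≡ - M j i
      step : ∀ {i j} → i ℕ.< d → j ℕ.< d → M (suc i) j ≡ M i (suc j) + (s i * s j + s i * s j)

  self-neg⇒0 : ∀ {x} → x ≡ - x → x ≡ 0ℚ
  self-neg⇒0 {x} eq = *≡0⇒≡0 {1ℚ + 1ℚ} (λ ()) (trans
    (solve 1 (λ x → (con 1ℚ :+ con 1ℚ) :* x := x :+ x) refl x) (trans (cong (_+ x) eq) (+-inverseˡ x)))

  -- The difference of two solutions is constant along the lines of constant i + j, hence symmetric.
  -- Being antisymmetric as well, it vanishes.
  bez-unique : ∀ {d s M} → IsBez d s M → ∀ {i j} → i ℕ.≤ d → j ℕ.≤ d → M i j ≡ bez s i j
  bez-unique {d} {s} {M} isBez {i} {j} i≤d j≤d = begin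
    M i j                 ≡⟨ solve 2 (λ a b → a := (a :- b) :+ b) refl (M i j) (bez s i j) ⟩
    Δ i j + bez s i j       ≡⟨ cong (_+ bez s i j) Δ≡0 ⟩
    0ℚ + bez s i j          ≡⟨ +-identityˡ _ ⟩
    bez s i j               ∎
    where
    open ≡-Reasoning
    open IsBez isBez
    Δ : ℕ → ℕ → ℚ
    Δ i j = M i j - bez s i j
    Δ-anti : ∀ i j → Δ i j ≡ - Δ j i
    Δ-anti i j = trans (cong₂ _-_ (anti i j) (bez-anti s i j))
      (solve 2 (λ a b → (:- a) :- (:- b) := :- (a :- b)) refl (M j i) (bez s j i))
    Δ-step : ∀ {i j} → i ℕ.< d → j ℕ.< d → Δ (suc i) j ≡ Δ i (suc j)
    Δ-step {i} {j} i<d j<d = trans (cong₂ _-_ (step i<d j<d) (bez-step s i j))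
      (solve 3 (λ a b c → (a :+ c) :- (b :+ c) := a :- b) refl (M i (suc j)) (bez s i (suc j)) (s i * s j + s i * s j))
    Δ-steps : ∀ k i j → k ℕ.+ i ℕ.≤ d → k ℕ.+ j ℕ.≤ d → Δ (k ℕ.+ i) j ≡ Δ i (k ℕ.+ j)
    Δ-steps zero    i j p q = refl
    Δ-steps (suc k) i j p q = trans (Δ-step p (ℕₚ.≤-trans (s≤s (ℕₚ.m≤n+m j k)) q))
      (trans (Δ-steps k i (suc j) (ℕₚ.<⇒≤ p) (subst (ℕ._≤ d) (sym (ℕₚ.+-suc k j)) q))
             (cong (Δ i) (ℕₚ.+-suc k j)))
    flip : ∀ {i j} → i ℕ.≤ j → j ℕ.≤ d → Δ j i ≡ Δ i j
    flip {i} {j} i≤j j≤d with ℕₚ.m≤n⇒∃[o]m+o≡n i≤j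
    ... | k , refl = subst (λ m → Δ m i ≡ Δ i m) (ℕₚ.+-comm k i)
          (Δ-steps k i i (subst (ℕ._≤ d) (ℕₚ.+-comm i k) j≤d) (subst (ℕ._≤ d) (ℕₚ.+-comm i k) j≤d))
    Δ≡0 : Δ i j ≡ 0ℚ
    Δ≡0 with ℕₚ.≤-total i j
    ... | inj₁ i≤j = self-neg⇒0 (trans (Δ-anti i j) (cong -_ (flip i≤j j≤d)))
    ... | inj₂ j≤i = self-neg⇒0 (trans (Δ-anti i j) (cong -_ (sym (flip j≤i i≤d))))

  ·-separate : ∀ f g (u v : Seq) → f · (λ i → g · (λ j → u i * v j)) ≡ f · u * g · v
  ·-separate f g u v = trans (·-cong f λ i → ·-* g (u i) v) (·-*ʳ f u (g · v))

  -- deg f < d.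
  record Below (d : ℕ) (f : Poly) : Set where
    constructor below
    field local : ∀ {s t : Seq} → (∀ i → i ℕ.< d → s i ≡ t i) → f · s ≡ f · t
  open Below

  opaque
    -- The Bezoutian (f(x) g(y) - g(x) f(y)) / (x - y) with `s` applied in both variables, regarded
    -- as a quadratic form in `s`.
    β : Seq → Poly → Poly → ℚ
    β s f g = f · (λ i → g · bez s i)

    β-def : ∀ s f g → β s f g ≡ f · (λ i → g · bez s i)
    β-def s f g = refl

    β-cong : ∀ s {f f′ g g′} → f ≈ f′ → g ≈ g′ → β s f g ≡ β s f′ g′
    β-cong s {f} {f′} f≈ g≈ = trans (at f≈ _) (·-cong f′ λ i → at g≈ _)

    β-⊕ˡ : ∀ s f f′ g → β s (f ⊕ f′) g ≡ β s f g + β s f′ g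
    β-⊕ˡ s f f′ g = ⊕-· f f′ _

    β-⊕ʳ : ∀ s f g g′ → β s f (g ⊕ g′) ≡ β s f g + β s f g′
    β-⊕ʳ s f g g′ = trans (·-cong f λ i → ⊕-· g g′ _) (·-+ f _ _)

    β-C⊗ˡ : ∀ s c f g → β s (C c ⊗ f) g ≡ c * β s f g
    β-C⊗ˡ s c f g = C⊗-· c f _

    β-C⊗ʳ : ∀ s c f g → β s f (C c ⊗ g) ≡ c * β s f g
    β-C⊗ʳ s c f g = trans (·-cong f λ i → C⊗-· c g _) (·-* f c _)

    β-anti : ∀ s f g → β s f g ≡ - β s g f
    β-anti s f g = trans (·-swap f g (bez s))
      (trans (·-cong g λ j → trans (·-cong f λ i → bez-anti s i j) (·-neg f _)) (·-neg g _))

    -- The numerators of the two Bezoutians differ by (x - y) (f(x) g(y) + g(x) f(y)), and x - y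
    -- cancels.
    β-X : ∀ s f g → β s (X ⊗ f) g ≡ β s f (X ⊗ g) + (f · s * g · s + f · s * g · s)
    β-X s f g = begin
      (X ⊗ f) · (λ i → g · bez s i)
        ≡⟨ X⊗-· f _ ⟩
      f · (λ i → g · bez s (suc i))
        ≡⟨ ·-cong f (λ i → trans (·-cong g (bez-step s i)) (trans (·-+ g _ _) (cong (g · _ +_) (·-+ g _ _)))) ⟩
      f · (λ i → g · (λ j → bez s i (suc j)) + (g · (λ j → s i * s j) + g · (λ j → s i * s j)))
        ≡⟨ trans (·-+ f _ _) (cong (f · _ +_) (·-+ f _ _)) ⟩
      f · (λ i → g · (λ j → bez s i (suc j))) + (f · (λ i → g · (λ j → s i * s j)) + f · (λ i → g · (λ j → s i * s j)))
        ≡⟨ cong₂ _+_ (·-cong f λ i → sym (X⊗-· g (bez s i))) (cong₂ _+_ (·-separate f g s s) (·-separate f g s s)) ⟩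
      β s f (X ⊗ g) + (f · s * g · s + f · s * g · s) ∎
      where open ≡-Reasoning

    -- A common factor comes out of the Bezoutian as a(x) a(y), which is then transposed to the
    -- functional in each variable.
    β-⊗ : ∀ s a f g → β s (a ⊗ f) (a ⊗ g) ≡ β (a ⋆ s) f g
    β-⊗ s a f g = begin
      (a ⊗ f) · (λ i → (a ⊗ g) · bez s i)
        ≡⟨ ⊗-· a f _ ⟩
      f · (λ i → a · (λ k → (a ⊗ g) · bez s (i ℕ.+ k)))
        ≡⟨ ·-cong f (λ i → trans (·-cong a λ k → ⊗-· a g _) (·-swap a g _)) ⟩
      f · (λ i → g · M i)
        ≡⟨ ·-cong f (λ i → ·-cong g λ j → bez-unique (isBez (i ℕ.+ j)) (ℕₚ.m≤m+n i j) (ℕₚ.m≤n+m j i)) ⟩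
      β (a ⋆ s) f g ∎
      where
      open ≡-Reasoning
      M : ℕ → ℕ → ℚ
      M i j = a · (λ k → a · (λ l → bez s (i ℕ.+ k) (j ℕ.+ l)))
      isBez : ∀ d → IsBez d (a ⋆ s) M
      isBez d = record
        { anti = λ i j → trans (·-swap a a _) (trans (·-cong a λ l → trans (·-cong a λ k → bez-anti s (i ℕ.+ k) (j ℕ.+ l)) (·-neg a _)) (·-neg a _))
        ; step = λ {i} {j} _ _ →
            let u k = s (i ℕ.+ k) ; v l = s (j ℕ.+ l)
                R k l = bez s (i ℕ.+ k) (suc j ℕ.+ l)
                uv≡ = ·-separate a a u v
            in trans (·-cong a λ k → trans (·-cong a λ l → bez-step s (i ℕ.+ k) (j ℕ.+ l))
                       (trans (·-+ a (R k) (λ l → u k * v l + u k * v l)) (cong (a · R k +_) (·-+ a (λ l → u k * v l) (λ l → u k * v l)))))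
                 (trans (·-+ a (λ k → a · R k) (λ k → a · (λ l → u k * v l) + a · (λ l → u k * v l)))
                   (cong (a · (λ k → a · R k) +_) (trans (·-+ a (λ k → a · (λ l → u k * v l)) (λ k → a · (λ l → u k * v l))) (cong₂ _+_ uv≡ uv≡))))
        }

    β-unique : ∀ {d s M f g} → Below (suc d) f → Below (suc d) g → IsBez d s M → β s f g ≡ f · (λ i → g · M i)
    β-unique f↓ g↓ isBez = local f↓ λ { i (s≤s i≤d) → local g↓ λ { j (s≤s j≤d) → sym (bez-unique isBez i≤d j≤d) } }

    β-seq-cong : ∀ {s t} f g → (∀ i → s i ≡ t i) → β s f g ≡ β t f g
    β-seq-cong {s} {t} f g s≡t = ·-cong f λ i → ·-cong g λ j → cong₂ _-_ (bezˡ-cong i j) (bezˡ-cong j i)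
      where
      bezˡ-cong : ∀ i j → bezˡ s i j ≡ bezˡ t i j
      bezˡ-cong zero    j = refl
      bezˡ-cong (suc i) j = cong₂ _+_ (cong₂ _*_ (s≡t i) (s≡t j)) (bezˡ-cong i (suc j))

  β-self : ∀ s f → β s f f ≡ 0ℚ
  β-self s f = self-neg⇒0 (β-anti s f f)

  β-X-swap : ∀ s f g → β s (X ⊗ f) g ≡ (f · s * g · s + f · s * g · s) - β s (X ⊗ g) f
  β-X-swap s f g = trans (β-X s f g) (trans (cong (_+ y) (β-anti s f (X ⊗ g))) (+-comm (- β s (X ⊗ g) f) y))
    where y = f · s * g · s + f · s * g · s

  β-X-self : ∀ s f → β s (X ⊗ f) f ≡ f · s * f · s
  β-X-self s f = begin
    b          ≡⟨ solve 2 (λ b y → b := (b :- y) :+ y) refl b y ⟩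
    (b - y) + y ≡⟨ cong (_+ y) (self-neg⇒0 (trans (cong (_- y) (β-X-swap s f f))
                     (solve 2 (λ b y → ((y :+ y) :- b) :- y := :- (b :- y)) refl b y))) ⟩
    0ℚ + y     ≡⟨ +-identityˡ y ⟩
    y          ∎
    where
    open ≡-Reasoning
    y = f · s * f · s
    b = β s (X ⊗ f) f

  -- Division by x - y lowers the degree, so in each variable the Bezoutian has degree below `d`.
  β-local : ∀ {d s t f g} → Below (suc d) f → Below (suc d) g → (∀ i → i ℕ.< d → s i ≡ t i) → β s f g ≡ β t f g
  β-local {d} {s} {t} f↓ g↓ s≡t = trans (β-unique f↓ g↓ isBez) (sym (β-def t _ _))
    where
    isBez : IsBez d s (bez t)
    isBez = record
      { anti = bez-anti t
      ; step = λ {i} {j} i<d j<d → trans (bez-step t i j)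
          (cong₂ (λ x y → bez t i (suc j) + (x * y + x * y)) (sym (s≡t i i<d)) (sym (s≡t j j<d)))
      }

  -- For a suitable `s`, such as an extreme coefficient or evaluation at 1, the relevant part of
  -- `bez s` is a difference of two products, and the form collapses to a 2 × 2 determinant.
  β-separated : ∀ {d s f g} (u v : Seq) → Below (suc d) f → Below (suc d) g → IsBez d s (λ i j → u i * v j - v i * u j) →
    β s f g ≡ f · u * g · v - f · v * g · u
  β-separated {f = f} {g} u v f↓ g↓ isBez = trans (β-unique f↓ g↓ isBez)
    (trans (·-cong f λ i → ·-- g (λ j → u i * v j) (λ j → v i * u j))
    (trans (·-- f (λ i → g · (λ j → u i * v j)) (λ i → g · (λ j → v i * u j))) (cong₂ _-_ (·-separate f g u v) (·-separate f g v u))))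

  Below-⊕ : ∀ {d f g} → Below d f → Below d g → Below d (f ⊕ g)
  Below-⊕ {d} {f} {g} f↓ g↓ = below λ s≡t → trans (⊕-· f g _) (trans (cong₂ _+_ (local f↓ s≡t) (local g↓ s≡t)) (sym (⊕-· f g _)))

  Below-C⊗ : ∀ {d f} c → Below d f → Below d (C c ⊗ f)
  Below-C⊗ {f = f} c f↓ = below λ s≡t → trans (C⊗-· c f _) (trans (cong (c *_) (local f↓ s≡t)) (sym (C⊗-· c f _)))

  Below-X⊗ : ∀ {d f} → Below d f → Below (suc d) (X ⊗ f)
  Below-X⊗ {f = f} f↓ = below λ s≡t → trans (X⊗-· f _) (trans (local f↓ λ i i<d → s≡t (suc i) (s≤s i<d)) (sym (X⊗-· f _)))

  Below-cong : ∀ {d f g} → f ≈ g → Below d f → Below d g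
  Below-cong f≈g f↓ = below λ s≡t → trans (sym (at f≈g _)) (trans (local f↓ s≡t) (at f≈g _))

  Below-≤ : ∀ {d e f} → d ℕ.≤ e → Below d f → Below e f
  Below-≤ d≤e f↓ = below λ s≡t → local f↓ λ i i<d → s≡t i (ℕₚ.≤-trans i<d d≤e)

  -- Coefficient functionals, definiteness and the Euclidean step

  δ : ℕ → Seq
  δ zero    zero    = 1ℚ
  δ zero    (suc i) = 0ℚ
  δ (suc k) zero    = 0ℚ
  δ (suc k) (suc i) = δ k i

  δ-diag : ∀ k → δ k k ≡ 1ℚ
  δ-diag zero    = refl
  δ-diag (suc k) = δ-diag k

  δ-< : ∀ {k i} → i ℕ.< k → δ k i ≡ 0ℚ
  δ-< {suc k} {zero}  _         = refl
  δ-< {suc k} {suc i} (s≤s i<k) = δ-< i<k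

  Below⇒coeff≡0 : ∀ {d f k} → Below d f → d ℕ.≤ k → f · δ k ≡ 0ℚ
  Below⇒coeff≡0 {f = f} f↓ d≤k = trans (local f↓ λ i i<d → δ-< (ℕₚ.≤-trans i<d d≤k)) (·-0 f)

  adjust : ℕ → ℚ → Seq → Seq
  adjust m c s i = s i + c * δ m i

  adjust-· : ∀ m c p s → p · adjust m c s ≡ p · s + c * p · δ m
  adjust-· m c p s = trans (·-+ p s _) (cong (p · s +_) (·-* p c (δ m)))

  adjust-< : ∀ {m i} c s → i ℕ.< m → adjust m c s i ≡ s i
  adjust-< c s i<m = trans (cong (λ x → s _ + c * x) (δ-< i<m)) (trans (cong (s _ +_) (*-zeroʳ c)) (+-identityʳ _))

  Below-drop : ∀ {d p} → Below (suc d) p → p · δ d ≡ 0ℚ → Below d p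
  Below-drop {d} {p} p↓ top≡0 = below λ {s} {t} s≡t → begin
    p · s                              ≡⟨ local p↓ (λ i i<1+d → agree {s} {t} s≡t i (ℕₚ.m<1+n⇒m<n∨m≡n i<1+d)) ⟩
    p · adjust d (s d - t d) t         ≡⟨ adjust-· d (s d - t d) p t ⟩
    p · t + (s d - t d) * p · δ d      ≡⟨ cong (λ x → p · t + (s d - t d) * x) top≡0 ⟩
    p · t + (s d - t d) * 0ℚ           ≡⟨ cong (p · t +_) (*-zeroʳ (s d - t d)) ⟩
    p · t + 0ℚ                         ≡⟨ +-identityʳ _ ⟩
    p · t                              ∎
    where
    open ≡-Reasoning
    agree : ∀ {s t : Seq} → (∀ i → i ℕ.< d → s i ≡ t i) → ∀ i → i ℕ.< d ⊎ i ≡ d → s i ≡ adjust d (s d - t d) t i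
    agree {s} {t} s≡t i (inj₁ i<d)  = trans (s≡t i i<d) (sym (adjust-< (s d - t d) t i<d))
    agree {s} {t} s≡t i (inj₂ refl) = sym (trans (cong (λ x → t d + (s d - t d) * x) (δ-diag d))
      (solve 2 (λ x y → y :+ (x :- y) :* con 1ℚ := x) refl (s d) (t d)))

  -- Positive definiteness in the first `m` values of `s`, in contrapositive form: nonnegative
  -- summands can be discarded directly from the hypothesis `Φ s ≤ 0ℚ`.
  Definite : ℕ → (Seq → ℚ) → Set
  Definite m Φ = ∀ s → Φ s ≤ 0ℚ → ∀ k → k ℕ.< m → s k ≡ 0ℚ

  -- At `δ m` the form is the coefficient of xᵐ yᵐ in the Bezoutian. Only the leading terms
  -- contribute, since `g` has no term of degree `suc m`.
  top-product : ∀ {m f g} → Below (suc (suc m)) f → Below (suc m) g → Definite (suc m) (λ s → β s f g) →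
    0ℚ < f · δ (suc m) * g · δ m
  top-product {m} {f} {g} f↓ g↓ def = ≰⇒> λ h →
    contradiction (trans (sym (δ-diag m)) (def (δ m) (subst (_≤ 0ℚ) (sym eq) h) m ℕₚ.≤-refl)) 1≢0
    where
    isBez : IsBez (suc m) (δ m) (λ i j → δ (suc m) i * δ m j - δ m i * δ (suc m) j)
    isBez = record
      { anti = λ i j → solve 4 (λ a b c d → a :* b :- c :* d := :- (d :* c :- b :* a)) refl (δ (suc m) i) (δ m j) (δ m i) (δ (suc m) j)
      ; step = λ {i} {j} i<m j<m → trans
          (cong (λ x → δ m i * δ m j - δ m (suc i) * x) (δ-< j<m))
          (trans (solve 3 (λ x y z → x :* y :- z :* con 0ℚ := (con 0ℚ :- x :* y) :+ (x :* y :+ x :* y)) refl (δ m i) (δ m j) (δ m (suc i)))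
            (cong (λ z → (z - δ m i * δ m j) + (δ m i * δ m j + δ m i * δ m j))
              (sym (trans (cong (_* δ m (suc j)) (δ-< i<m)) (*-zeroˡ (δ m (suc j)))))))
      }
    eq : β (δ m) f g ≡ f · δ (suc m) * g · δ m
    eq = trans (β-separated (δ (suc m)) (δ m) f↓ (Below-≤ (ℕₚ.n≤1+n _) g↓) isBez)
      (trans (cong (λ x → f · δ (suc m) * g · δ m - f · δ m * x) (Below⇒coeff≡0 g↓ ℕₚ.≤-refl))
        (solve 3 (λ a b c → a :* b :- c :* con 0ℚ := a :* b) refl (f · δ (suc m)) (g · δ m) (f · δ m)))

  -- One step of the Euclidean algorithm; restricting the form to the functionals s with g · s ≡ 0 removes the
  -- quotient, so definiteness passes to the remainder.
  record Reduction (m : ℕ) (f g : Poly) : Set where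
    field
      α       : ℚ
      0<α     : 0ℚ < α
      f₁      : Poly
      f≈      : f ≈ f₁ ⊕ C α ⊗ (X ⊗ g)
      f₁↓     : Below (suc m) f₁
      def     : Definite m (λ s → β s f₁ g)
      top≢0   : g · δ m ≢ 0ℚ

  reduce : ∀ {m f g} → Below (suc (suc m)) f → Below (suc m) g → Definite (suc m) (λ s → β s f g) → Reduction m f g
  reduce {m} {f} {g} f↓ g↓ def = record
    { α = α ; 0<α = 0<α ; f₁ = f₁ ; f≈ = f≈ ; f₁↓ = f₁↓ ; def = def₁ ; top≢0 = γ≢0 }
    where
    φ = f · δ (suc m)
    γ = g · δ m
    φγ>0 : 0ℚ < φ * γ
    φγ>0 = top-product f↓ g↓ def
    γ≢0 : γ ≢ 0ℚ
    γ≢0 γ≡0 = 0<⇒≢0 φγ>0 (trans (cong (φ *_) γ≡0) (*-zeroʳ φ))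
    γ⁻¹ = proj₁ (inverse γ γ≢0)
    γ⁻¹γ≡1 = proj₂ (inverse γ γ≢0)
    α = φ * γ⁻¹
    αγ≡φ : α * γ ≡ φ
    αγ≡φ = trans (*-assoc φ γ⁻¹ γ) (trans (cong (φ *_) γ⁻¹γ≡1) (*-identityʳ φ))
    γγ>0 : 0ℚ < γ * γ
    γγ>0 = ≰⇒> (λ h → γ≢0 (²≤0⇒≡0 h))
    0<α : 0ℚ < α
    0<α = 0<*⇒0< γγ>0 (subst (0ℚ <_) (trans (cong (_* γ) (sym αγ≡φ))
      (solve 2 (λ α γ → α :* γ :* γ := γ :* γ :* α) refl α γ)) φγ>0)
    f₁ = f ⊕ C (- α) ⊗ (X ⊗ g)
    f≈ : f ≈ f₁ ⊕ C α ⊗ (X ⊗ g)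
    f≈ = mk≈ λ s → sym (begin
      (f₁ ⊕ C α ⊗ (X ⊗ g)) · s                              ≡⟨ ⊕-· f₁ _ s ⟩
      f₁ · s + (C α ⊗ (X ⊗ g)) · s                          ≡⟨ cong₂ _+_ (trans (⊕-· f _ s) (cong (f · s +_) (C⊗-· (- α) _ s))) (C⊗-· α _ s) ⟩
      f · s + (- α) * (X ⊗ g) · s + α * (X ⊗ g) · s         ≡⟨ solve 3 (λ x a y → x :+ (:- a) :* y :+ a :* y := x) refl (f · s) α ((X ⊗ g) · s) ⟩
      f · s                                                 ∎)
      where open ≡-Reasoning
    f₁↓ : Below (suc m) f₁
    f₁↓ = Below-drop (Below-⊕ f↓ (Below-C⊗ (- α) (Below-X⊗ g↓))) (begin
      f₁ · δ (suc m)                       ≡⟨ ⊕-· f _ _ ⟩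
      φ + (C (- α) ⊗ (X ⊗ g)) · δ (suc m)  ≡⟨ cong (φ +_) (trans (C⊗-· (- α) (X ⊗ g) _) (cong ((- α) *_) (X⊗-· g _))) ⟩
      φ + (- α) * γ                        ≡⟨ cong (_+ (- α) * γ) (sym αγ≡φ) ⟩
      α * γ + (- α) * γ                    ≡⟨ solve 2 (λ a y → a :* y :+ (:- a) :* y := con 0ℚ) refl α γ ⟩
      0ℚ                                   ∎)
      where open ≡-Reasoning
    def₁ : Definite m (λ s → β s f₁ g)
    def₁ s h k k<m = trans (sym (adjust-< c s k<m)) (def ŝ (subst (_≤ 0ℚ) eq h) k (ℕₚ.m≤n⇒m≤1+n k<m))
      where
      open ≡-Reasoning
      -- The form of `f₁` and `g` ignores the value of `s` at `m`, so this value may be chosen to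
      -- make `g · ŝ` vanish. The form of `X ⊗ g` with `g`, a square of `g · ŝ`, then disappears.
      c = - (g · s * γ⁻¹)
      ŝ = adjust m c s
      gŝ≡0 : g · ŝ ≡ 0ℚ
      gŝ≡0 = begin
        g · ŝ                            ≡⟨ adjust-· m c g s ⟩
        g · s + c * γ                    ≡⟨ solve 3 (λ x y z → x :+ :- (x :* y) :* z := x :- x :* (y :* z)) refl (g · s) γ⁻¹ γ ⟩
        g · s - g · s * (γ⁻¹ * γ)        ≡⟨ cong (λ z → g · s - g · s * z) γ⁻¹γ≡1 ⟩
        g · s - g · s * 1ℚ               ≡⟨ solve 1 (λ x → x :- x :* con 1ℚ := con 0ℚ) refl (g · s) ⟩
        0ℚ                               ∎
      eq : β s f₁ g ≡ β ŝ f g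
      eq = begin
        β s f₁ g                                   ≡⟨ β-local f₁↓ g↓ (λ i i<m → sym (adjust-< c s i<m)) ⟩
        β ŝ f₁ g                                   ≡⟨ β-⊕ˡ ŝ f (C (- α) ⊗ (X ⊗ g)) g ⟩
        β ŝ f g + β ŝ (C (- α) ⊗ (X ⊗ g)) g        ≡⟨ cong (β ŝ f g +_) (trans (β-C⊗ˡ ŝ (- α) (X ⊗ g) g) (cong ((- α) *_) (trans (β-X-self ŝ g) (cong (λ z → z * z) gŝ≡0)))) ⟩
        β ŝ f g + (- α) * (0ℚ * 0ℚ)                ≡⟨ solve 2 (λ x a → x :+ a :* (con 0ℚ :* con 0ℚ) := x) refl (β ŝ f g) (- α) ⟩
        β ŝ f g                                    ∎

  -- The transpose of differentiation; ∂ one is the inclusion of ℕ into ℚ.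
  ∂ : Seq → Seq
  ∂ s zero    = 0ℚ
  ∂ s (suc i) = s i + ∂ (s ∘ suc) i

  deriv : Poly → Poly
  deriv []      = []
  deriv (a ∷ p) = p ⊕ X ⊗ deriv p

  deriv-· : ∀ p s → deriv p · s ≡ p · ∂ s
  deriv-· []      s = refl
  deriv-· (a ∷ p) s = begin
    (p ⊕ X ⊗ deriv p) · s              ≡⟨ ⊕-· p _ s ⟩
    p · s + (X ⊗ deriv p) · s          ≡⟨ cong (p · s +_) (trans (X⊗-· (deriv p) s) (deriv-· p _)) ⟩
    p · s + p · ∂ (s ∘ suc)            ≡⟨ sym (·-+ p s _) ⟩
    p · (λ i → s i + ∂ (s ∘ suc) i)    ≡⟨ solve 2 (λ a x → x := a :* con 0ℚ :+ x) refl a (p · (∂ s ∘ suc)) ⟩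
    a * 0ℚ + p · (∂ s ∘ suc)           ∎
    where open ≡-Reasoning

  deriv-cong : ∀ {p q} → p ≈ q → deriv p ≈ deriv q
  deriv-cong {p} {q} p≈q = mk≈ λ s → trans (deriv-· p s) (trans (at p≈q _) (sym (deriv-· q s)))

  deriv-⊕ : ∀ p q → deriv (p ⊕ q) ≈ deriv p ⊕ deriv q
  deriv-⊕ p q = mk≈ λ s → trans (deriv-· (p ⊕ q) s) (trans (⊕-· p q _)
    (trans (cong₂ _+_ (sym (deriv-· p s)) (sym (deriv-· q s))) (sym (⊕-· (deriv p) (deriv q) s))))

  deriv-C⊗ : ∀ c p → deriv (C c ⊗ p) ≈ C c ⊗ deriv p
  deriv-C⊗ c p = mk≈ λ s → trans (deriv-· (C c ⊗ p) s) (trans (C⊗-· c p _)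
    (trans (cong (c *_) (sym (deriv-· p s))) (sym (C⊗-· c (deriv p) s))))

  deriv-X⊗ : ∀ p → deriv (X ⊗ p) ≈ p ⊕ X ⊗ deriv p
  deriv-X⊗ p = mk≈ λ s → trans (deriv-· (X ⊗ p) s) (trans (X⊗-· p _) (trans (·-+ p s _)
    (sym (trans (⊕-· p _ s) (cong (p · s +_) (trans (X⊗-· (deriv p) s) (deriv-· p _)))))))

  ∂-local : ∀ i {s t : Seq} → (∀ k → k ℕ.< i → s k ≡ t k) → ∂ s i ≡ ∂ t i
  ∂-local zero    s≡t = refl
  ∂-local (suc i) s≡t = cong₂ _+_ (s≡t i ℕₚ.≤-refl) (∂-local i λ k k<i → s≡t (suc k) (s≤s k<i))

  Below-deriv : ∀ {d f} → Below (suc d) f → Below d (deriv f)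
  Below-deriv {f = f} f↓ = below λ s≡t → trans (deriv-· f _) (trans
    (local f↓ λ { i (s≤s i≤d) → ∂-local i λ k k<i → s≡t k (ℕₚ.≤-trans k<i i≤d) }) (sym (deriv-· f _)))

  -- Interlacing, continued fractions and the derivative

  -- If f = c ∏ (x + ρᵢ) and g = Σ cᵢ f / (x + ρᵢ), the two forms are Σ cᵢ (s bᵢ)² and Σ cᵢ ρᵢ (s bᵢ)² with
  -- bᵢ = f / (x + ρᵢ); their positivity says that f has negative real roots interlaced by those of g.
  record PSD (f g : Poly) : Set where
    constructor psd
    field
      K≥0 : ∀ s → 0ℚ ≤ β s f g
      L≥0 : ∀ s → 0ℚ ≤ β s (X ⊗ g) f
  open PSD

  PSD-cong : ∀ {f f′ g g′} → f ≈ f′ → g ≈ g′ → PSD f g → PSD f′ g′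
  PSD-cong f≈ g≈ p = psd (λ s → subst (0ℚ ≤_) (β-cong s f≈ g≈) (K≥0 p s))
                         (λ s → subst (0ℚ ≤_) (β-cong s (≈.*-congˡ {X} g≈) f≈) (L≥0 p s))

  PSD-0 : ∀ f → PSD f []
  PSD-0 f = psd (λ s → ≤-reflexive (sym (β-[]ʳ s)))
                (λ s → ≤-reflexive (sym (trans (β-cong s (≈.zeroʳ X) ≈.refl) (trans (β-anti s [] f) (cong -_ (β-[]ʳ s))))))
    where
    β-[]ʳ : ∀ s → β s f [] ≡ 0ℚ
    β-[]ʳ s = trans (β-cong s ≈.refl (≈.sym (≈.zeroʳ (C 0ℚ)))) (trans (β-C⊗ʳ s 0ℚ f []) (*-zeroˡ (β s f [])))

  PSD-⊕ : ∀ {f g h} → PSD f g → PSD f h → PSD f (g ⊕ h)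
  PSD-⊕ {f} {g} {h} p q = psd
    (λ s → subst (0ℚ ≤_) (sym (β-⊕ʳ s f g h)) (0≤+ (K≥0 p s) (K≥0 q s)))
    (λ s → subst (0ℚ ≤_) (sym (trans (β-cong s (≈.distribˡ X g h) ≈.refl) (β-⊕ˡ s (X ⊗ g) (X ⊗ h) f))) (0≤+ (L≥0 p s) (L≥0 q s)))

  PSD-C⊗ : ∀ {f g c} → 0ℚ ≤ c → PSD f g → PSD f (C c ⊗ g)
  PSD-C⊗ {f} {g} {c} 0≤c p = psd
    (λ s → subst (0ℚ ≤_) (sym (β-C⊗ʳ s c f g)) (0≤* 0≤c (K≥0 p s)))
    (λ s → subst (0ℚ ≤_) (sym (trans (β-cong s (solveₚ 3 (λ c x g → x ⊠ (c ⊠ g) ≋ c ⊠ (x ⊠ g)) ≈.refl (C c) X g) ≈.refl)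
                                     (β-C⊗ˡ s c (X ⊗ g) f))) (0≤* 0≤c (L≥0 p s)))

  -- The added term contributes α (Q · s)² to the first form, and to the second the Bezoutian of
  -- `X ⊗ Q` with itself, which is 0.
  PSD-stepP : ∀ {P Q α} → 0ℚ ≤ α → PSD P Q → PSD (P ⊕ C α ⊗ (X ⊗ Q)) Q
  PSD-stepP {P} {Q} {α} 0≤α p = psd
    (λ s → subst (0ℚ ≤_) (sym (trans (β-⊕ˡ s P _ Q) (cong (β s P Q +_) (trans (β-C⊗ˡ s α (X ⊗ Q) Q) (cong (α *_) (β-X-self s Q))))))
             (0≤+ (K≥0 p s) (0≤* 0≤α (0≤² (Q · s)))))
    (λ s → subst (0ℚ ≤_) (sym (trans (β-⊕ʳ s (X ⊗ Q) P _) (trans (cong (β s (X ⊗ Q) P +_) (trans (β-C⊗ʳ s α (X ⊗ Q) (X ⊗ Q))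
              (trans (cong (α *_) (β-self s (X ⊗ Q))) (*-zeroʳ α)))) (+-identityʳ _)))) (L≥0 p s))

  PSD-stepQ : ∀ {P Q α} → 0ℚ ≤ α → PSD P Q → PSD P (Q ⊕ C α ⊗ P)
  PSD-stepQ {P} {Q} {α} 0≤α p = PSD-⊕ p (PSD-C⊗ 0≤α (psd
    (λ s → ≤-reflexive (sym (β-self s P))) (λ s → subst (0ℚ ≤_) (sym (β-X-self s P)) (0≤² (P · s)))))

  -- Each of the two summands shares a factor with `A ⊗ Q`. Pulling it out leaves the first form of
  -- one pair and the second form of the other, at transposed functionals.
  PSD-AQ : ∀ {P Q A B} → PSD P Q → PSD A B → PSD (A ⊗ P ⊕ X ⊗ (B ⊗ Q)) (A ⊗ Q)
  PSD-AQ {P} {Q} {A} {B} p a = psd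
    (λ s → subst (0ℚ ≤_) (sym (trans (β-⊕ˡ s (A ⊗ P) _ (A ⊗ Q)) (cong₂ _+_ (β-⊗ s A P Q)
        (trans (β-cong s (solveₚ 3 (λ x b q → x ⊠ (b ⊠ q) ≋ q ⊠ (x ⊠ b)) ≈.refl X B Q) (≈.*-comm A Q)) (β-⊗ s Q (X ⊗ B) A)))))
      (0≤+ (K≥0 p (A ⋆ s)) (L≥0 a (Q ⋆ s))))
    (λ s → subst (0ℚ ≤_) (sym (trans (β-⊕ʳ s (X ⊗ (A ⊗ Q)) (A ⊗ P) _) (cong₂ _+_
        (trans (β-cong s (solveₚ 3 (λ x a q → x ⊠ (a ⊠ q) ≋ a ⊠ (x ⊠ q)) ≈.refl X A Q) ≈.refl) (β-⊗ s A (X ⊗ Q) P))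
        (trans (β-cong s (solveₚ 3 (λ x a q → x ⊠ (a ⊠ q) ≋ x ⊠ q ⊠ a) ≈.refl X A Q) (solveₚ 3 (λ x a q → x ⊠ (a ⊠ q) ≋ x ⊠ q ⊠ a) ≈.refl X B Q))
          (β-⊗ s (X ⊗ Q) A B)))))
      (0≤+ (L≥0 p (A ⋆ s)) (K≥0 a ((X ⊗ Q) ⋆ s))))

  PSD-BP : ∀ {P Q A B} → PSD P Q → PSD A B → PSD (A ⊗ P ⊕ X ⊗ (B ⊗ Q)) (B ⊗ P)
  PSD-BP {P} {Q} {A} {B} p a = psd
    (λ s → subst (0ℚ ≤_) (sym (trans (β-⊕ˡ s (A ⊗ P) _ (B ⊗ P)) (cong₂ _+_
        (trans (β-cong s (≈.*-comm A P) (≈.*-comm B P)) (β-⊗ s P A B))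
        (trans (β-cong s (solveₚ 3 (λ x b q → x ⊠ (b ⊠ q) ≋ b ⊠ (x ⊠ q)) ≈.refl X B Q) ≈.refl) (β-⊗ s B (X ⊗ Q) P)))))
      (0≤+ (K≥0 a (P ⋆ s)) (L≥0 p (B ⋆ s))))
    (λ s → subst (0ℚ ≤_) (sym (trans (β-⊕ʳ s (X ⊗ (B ⊗ P)) (A ⊗ P) _) (cong₂ _+_
        (trans (β-cong s (solveₚ 3 (λ x b q → x ⊠ (b ⊠ q) ≋ q ⊠ (x ⊠ b)) ≈.refl X B P) (≈.*-comm A P)) (β-⊗ s P (X ⊗ B) A))
        (trans (β-cong s (≈.sym (≈.*-assoc X B P)) (≈.sym (≈.*-assoc X B Q))) (β-⊗ s (X ⊗ B) P Q)))))
      (0≤+ (L≥0 a (P ⋆ s)) (K≥0 p ((X ⊗ B) ⋆ s))))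

  -- The Stieltjes continued fraction of Q / P.
  data Chain : Poly → Poly → Set where
    base  : ∀ {P Q} → Below 1 P → Q ≈ [] → Chain P Q
    stepP : ∀ {P P₁ Q α} → 0ℚ < α → P ≈ P₁ ⊕ C α ⊗ (X ⊗ Q) → Chain P₁ Q → Chain P Q
    stepQ : ∀ {P Q Q₁ α} → 0ℚ < α → Q ≈ Q₁ ⊕ C α ⊗ P → Chain P Q₁ → Chain P Q

  Chain⇒PSD : ∀ {P Q} → Chain P Q → PSD P Q
  Chain⇒PSD {P} (base P↓ Q≈)         = PSD-cong ≈.refl (≈.sym Q≈) (PSD-0 P)
  Chain⇒PSD (stepP 0<α P≈ c) = PSD-cong (≈.sym P≈) ≈.refl (PSD-stepP (<⇒≤ 0<α) (Chain⇒PSD c))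
  Chain⇒PSD (stepQ 0<α Q≈ c) = PSD-cong ≈.refl (≈.sym Q≈) (PSD-stepQ (<⇒≤ 0<α) (Chain⇒PSD c))

  -- The steps add positive multiples of `X ⊗ Q` to `P` and of `P` to `Q`. Neither alters the
  -- constant coefficient of `P`, so its sign can be carried to the end of the chain.
  Chain⇒coeff≥0 : ∀ {P Q} → Chain P Q → 0ℚ ≤ P · δ 0 → ∀ i → 0ℚ ≤ P · δ i × 0ℚ ≤ Q · δ i
  Chain⇒coeff≥0 {P} (base P↓ Q≈) P₀≥0 i = P≥0 i , ≤-reflexive (sym (at Q≈ _))
    where
    P≥0 : ∀ i → 0ℚ ≤ P · δ i
    P≥0 zero    = P₀≥0
    P≥0 (suc i) = ≤-reflexive (sym (Below⇒coeff≡0 P↓ (s≤s z≤n)))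
  Chain⇒coeff≥0 {P} {Q} (stepP {P₁ = P₁} {α = α} 0<α P≈ c) P₀≥0 i =
    subst (0ℚ ≤_) (sym (P-coeff i)) (0≤+ (proj₁ (IH i)) (0≤* (<⇒≤ 0<α) (XQ≥0 i))) , proj₂ (IH i)
    where
    P-coeff : ∀ i → P · δ i ≡ P₁ · δ i + α * (X ⊗ Q) · δ i
    P-coeff i = trans (at P≈ _) (trans (⊕-· P₁ _ _) (cong (P₁ · δ i +_) (C⊗-· α (X ⊗ Q) _)))
    XQ₀≡0 : (X ⊗ Q) · δ 0 ≡ 0ℚ
    XQ₀≡0 = trans (X⊗-· Q _) (·-0 Q)
    IH : ∀ i → 0ℚ ≤ P₁ · δ i × 0ℚ ≤ Q · δ i
    IH = Chain⇒coeff≥0 c (subst (0ℚ ≤_) (trans (P-coeff 0) (trans (cong (λ z → P₁ · δ 0 + α * z) XQ₀≡0)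
           (solve 2 (λ x a → x :+ a :* con 0ℚ := x) refl (P₁ · δ 0) α))) P₀≥0)
    XQ≥0 : ∀ i → 0ℚ ≤ (X ⊗ Q) · δ i
    XQ≥0 zero    = ≤-reflexive (sym XQ₀≡0)
    XQ≥0 (suc i) = subst (0ℚ ≤_) (sym (X⊗-· Q _)) (proj₂ (IH i))
  Chain⇒coeff≥0 {P} {Q} (stepQ {Q₁ = Q₁} {α = α} 0<α Q≈ c) P₀≥0 i =
    proj₁ IH , subst (0ℚ ≤_) (sym (trans (at Q≈ _) (trans (⊕-· Q₁ _ _) (cong (Q₁ · δ i +_) (C⊗-· α P _)))))
      (0≤+ (proj₂ IH) (0≤* (<⇒≤ 0<α) (proj₁ IH)))
    where IH = Chain⇒coeff≥0 c P₀≥0 i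

  two : ℚ
  two = 1ℚ + 1ℚ

  -- Along a chain the pair (P , Q) shrinks while F = Combine A B P Q stays fixed; Combine′ starts at 2 F′ (A = 1,
  -- B = 0), and each step splits off a multiple of A Q or B P, both of which interlace F.
  Combine : (A B P Q : Poly) → Poly
  Combine A B P Q = A ⊗ P ⊕ X ⊗ (B ⊗ Q)

  Combine′ : (A B P Q : Poly) → Poly
  Combine′ A B P Q = C two ⊗ (A ⊗ deriv P) ⊕ B ⊗ (Q ⊕ C two ⊗ (X ⊗ deriv Q))

  Combine-P : ∀ {A B P P₁ Q α} → P ≈ P₁ ⊕ C α ⊗ (X ⊗ Q) → Combine A (B ⊕ C α ⊗ A) P₁ Q ≈ Combine A B P Q
  Combine-P {A} {B} {P} {P₁} {Q} {α} P≈ = ≈.trans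
    (solveₚ 6 (λ a b p q x α → a ⊠ p ⊞ x ⊠ ((b ⊞ α ⊠ a) ⊠ q) ≋ a ⊠ (p ⊞ α ⊠ (x ⊠ q)) ⊞ x ⊠ (b ⊠ q)) ≈.refl A B P₁ Q X (C α))
    (≈.+-congʳ (≈.*-congˡ {A} (≈.sym P≈)))

  Combine-Q : ∀ {A B P Q Q₁ α} → Q ≈ Q₁ ⊕ C α ⊗ P → Combine (A ⊕ C α ⊗ (X ⊗ B)) B P Q₁ ≈ Combine A B P Q
  Combine-Q {A} {B} {P} {Q} {Q₁} {α} Q≈ = ≈.trans
    (solveₚ 6 (λ a b p q x α → (a ⊞ α ⊠ (x ⊠ b)) ⊠ p ⊞ x ⊠ (b ⊠ q) ≋ a ⊠ p ⊞ x ⊠ (b ⊠ (q ⊞ α ⊠ p))) ≈.refl A B P Q₁ X (C α))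
    (≈.+-congˡ {A ⊗ P} (≈.*-congˡ {X} (≈.*-congˡ {B} (≈.sym Q≈))))

  Combine′-P : ∀ {A B P P₁ Q α} → P ≈ P₁ ⊕ C α ⊗ (X ⊗ Q) →
    Combine′ A (B ⊕ C α ⊗ A) P₁ Q ⊕ C α ⊗ (A ⊗ Q) ≈ Combine′ A B P Q
  Combine′-P {A} {B} {P} {P₁} {Q} {α} P≈ = ≈.trans
    (solveₚ 7 (λ a b p′ q q′ x α → conₚ two ⊠ (a ⊠ p′) ⊞ (b ⊞ α ⊠ a) ⊠ (q ⊞ conₚ two ⊠ (x ⊠ q′)) ⊞ α ⊠ (a ⊠ q)
                                     ≋ (conₚ two ⊠ (a ⊠ (p′ ⊞ α ⊠ (q ⊞ x ⊠ q′)))) ⊞ b ⊠ (q ⊞ conₚ two ⊠ (x ⊠ q′)))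
      ≈.refl A B (deriv P₁) Q (deriv Q) X (C α))
    (≈.+-congʳ (≈.*-congˡ {C two} (≈.*-congˡ {A} (≈.sym (≈.trans (deriv-cong P≈) (≈.trans (deriv-⊕ P₁ _)
      (≈.+-congˡ {deriv P₁} (≈.trans (deriv-C⊗ α (X ⊗ Q)) (≈.*-congˡ {C α} (deriv-X⊗ Q))))))))))

  Combine′-Q : ∀ {A B P Q Q₁ α} → Q ≈ Q₁ ⊕ C α ⊗ P →
    Combine′ (A ⊕ C α ⊗ (X ⊗ B)) B P Q₁ ⊕ C α ⊗ (B ⊗ P) ≈ Combine′ A B P Q
  Combine′-Q {A} {B} {P} {Q} {Q₁} {α} Q≈ = ≈.trans
    (solveₚ 9 (λ a b p p′ q q′ x α t → t ⊠ ((a ⊞ α ⊠ (x ⊠ b)) ⊠ p′) ⊞ b ⊠ (q ⊞ t ⊠ (x ⊠ q′)) ⊞ α ⊠ (b ⊠ p)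
                                        ≋ t ⊠ (a ⊠ p′) ⊞ b ⊠ ((q ⊞ α ⊠ p) ⊞ t ⊠ (x ⊠ (q′ ⊞ α ⊠ p′))))
      ≈.refl A B P (deriv P) Q₁ (deriv Q₁) X (C α) (C two))
    (≈.+-congˡ {C two ⊗ (A ⊗ deriv P)} (≈.*-congˡ {B} (≈.+-cong (≈.sym Q≈) (≈.*-congˡ {C two} (≈.*-congˡ {X}
      (≈.sym (≈.trans (deriv-cong Q≈) (≈.trans (deriv-⊕ Q₁ _) (≈.+-congˡ {deriv Q₁} (deriv-C⊗ α P))))))))))

  ⊗≈[] : ∀ p {q} → q ≈ [] → p ⊗ q ≈ []
  ⊗≈[] p q≈ = ≈.trans (≈.*-congˡ {p} q≈) (≈.zeroʳ p)

  ⊕≈[] : ∀ {p q} → p ≈ [] → q ≈ [] → p ⊕ q ≈ []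
  ⊕≈[] p≈ q≈ = ≈.trans (≈.+-cong p≈ q≈) (≈.+-identityˡ [])

  -- The factor two comes from x = y²: y times `Combine′` is the y-derivative of A(y²) P(y²) +
  -- yB(y²) · yQ(y²) with A and yB held fixed. The steps that (P , Q) loses are gained by (A , B)
  -- with their two kinds exchanged, so (A , B) keeps interlacing. At the end of the chain `P` is
  -- constant and `Q` zero, and `Combine′` vanishes.
  Chain-deriv : ∀ {P Q A B} → Chain P Q → PSD A B → PSD (Combine A B P Q) (Combine′ A B P Q)
  Chain-deriv {P} {Q} {A} {B} (base P↓ Q≈) a = PSD-cong ≈.refl (≈.sym
    (⊕≈[] (⊗≈[] (C two) (⊗≈[] A P′≈0)) (⊗≈[] B (⊕≈[] Q≈ (⊗≈[] (C two) (⊗≈[] X (deriv-cong Q≈)))))))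
    (PSD-0 _)
    where
    P′≈0 : deriv P ≈ []
    P′≈0 = mk≈ λ s → trans (deriv-· P s) (trans (local P↓ λ { zero _ → refl ; (suc i) (s≤s ()) }) (·-0 P))
  Chain-deriv {P} {Q} {A} {B} (stepP {P₁ = P₁} {α = α} 0<α P≈ c) a = PSD-cong ≈.refl (Combine′-P P≈)
    (PSD-⊕ (PSD-cong (Combine-P P≈) ≈.refl (Chain-deriv c (PSD-stepQ (<⇒≤ 0<α) a)))
           (PSD-C⊗ (<⇒≤ 0<α) (PSD-AQ (Chain⇒PSD (stepP 0<α P≈ c)) a)))
  Chain-deriv {P} {Q} {A} {B} (stepQ {Q₁ = Q₁} {α = α} 0<α Q≈ c) a = PSD-cong ≈.refl (Combine′-Q Q≈)
    (PSD-⊕ (PSD-cong (Combine-Q Q≈) ≈.refl (Chain-deriv c (PSD-stepP (<⇒≤ 0<α) a)))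
           (PSD-C⊗ (<⇒≤ 0<α) (PSD-BP (Chain⇒PSD (stepQ 0<α Q≈ c)) a)))

  -- Strict interlacing with degree bounds

  Definite-cong : ∀ {m} {Φ Ψ : Seq → ℚ} → (∀ s → Ψ s ≡ Φ s) → Definite m Φ → Definite m Ψ
  Definite-cong eq def s h = def s (subst (_≤ 0ℚ) (eq s) h)

  -- If Θ s ≤ 0, then Ψ s ≥ 0 forces Φ s ≤ 0. In this way a sum with a merely semidefinite part
  -- inherits definiteness from the other part.
  Definite-absorb : ∀ {m} {Φ Ψ Θ : Seq → ℚ} {a c} → 0ℚ < a → 0ℚ < c → (∀ s → 0ℚ ≤ Ψ s) → (∀ s → c * Θ s ≡ Ψ s + a * Φ s) →
    Definite m Φ → Definite m Θ
  Definite-absorb {Φ = Φ} {Ψ} {Θ} {a} {c} 0<a 0<c 0≤Ψ eq def s h = def s (*≤0⇒≤0 0<a (+≤0ʳ (0≤Ψ s)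
    (subst (_≤ 0ℚ) (eq s) (subst (c * Θ s ≤_) (*-zeroʳ c) (*-monoˡ-≤-nonNeg c {{nonNegative (<⇒≤ 0<c)}} h)))))

  Below-X⁻ : ∀ {d g} → Below (suc d) (X ⊗ g) → Below d g
  Below-X⁻ {d} {g} Xg↓ = below λ {s} {t} s≡t → trans (sym (X⊗-· g (0∷ s)))
    (trans (local Xg↓ λ { zero _ → refl ; (suc i) (s≤s i<d) → s≡t i i<d }) (X⊗-· g (0∷ t)))
    where
    0∷_ : Seq → Seq
    (0∷ s) zero    = 0ℚ
    (0∷ s) (suc i) = s i

  -- deg f ≤ d and deg g < d; in Interlacing⁼ both degrees are at most d.
  record Interlacing (d : ℕ) (f g : Poly) : Set where
    field
      f↓ : Below (suc d) f
      g↓ : Below d g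
      K  : Definite d (λ s → β s f g)
      L  : Definite d (λ s → β s (X ⊗ g) f)

  record Interlacing⁼ (d : ℕ) (f g : Poly) : Set where
    field
      f↓ : Below (suc d) f
      g↓ : Below (suc d) g
      K  : Definite d (λ s → β s f g)
      L  : Definite (suc d) (λ s → β s (X ⊗ g) f)

  β-C⊕ˡ : ∀ s f h c g → β s (f ⊕ C c ⊗ h) g ≡ β s f g + c * β s h g
  β-C⊕ˡ s f h c g = trans (β-⊕ˡ s f _ g) (cong (β s f g +_) (β-C⊗ˡ s c h g))

  β-C⊕ʳ : ∀ s f g c h → β s f (g ⊕ C c ⊗ h) ≡ β s f g + c * β s f h
  β-C⊕ʳ s f g c h = trans (β-⊕ʳ s f g _) (cong (β s f g +_) (β-C⊗ʳ s c f h))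

  ⊕-C-cancel : ∀ f c h → (f ⊕ C (- c) ⊗ h) ⊕ C c ⊗ h ≈ f
  ⊕-C-cancel f c h = mk≈ λ s → trans (⊕-· (f ⊕ C (- c) ⊗ h) _ s) (trans
    (cong₂ _+_ (trans (⊕-· f _ s) (cong (f · s +_) (C⊗-· (- c) h s))) (C⊗-· c h s))
    (solve 3 (λ x a y → x :+ (:- a) :* y :+ a :* y := x) refl (f · s) c (h · s)))

  absorb-K : ∀ f {g h k a c} → C c ⊗ k ≈ h ⊕ C a ⊗ g → ∀ s → c * β s f k ≡ β s f h + a * β s f g
  absorb-K f {g} {h} {k} {a} {c} k≈ s = trans (sym (β-C⊗ʳ s c f k)) (trans (β-cong s ≈.refl k≈) (β-C⊕ʳ s f h a g))

  absorb-L : ∀ f {g h k a c} → C c ⊗ k ≈ h ⊕ C a ⊗ g → ∀ s → c * β s (X ⊗ k) f ≡ β s (X ⊗ h) f + a * β s (X ⊗ g) f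
  absorb-L f {g} {h} {k} {a} {c} k≈ s = trans (sym (β-C⊗ˡ s c (X ⊗ k) f)) (trans
    (β-cong s (≈.trans (solveₚ 3 (λ c x k → c ⊠ (x ⊠ k) ≋ x ⊠ (c ⊠ k)) ≈.refl (C c) X k) (≈.trans (≈.*-congˡ {X} k≈)
      (solveₚ 4 (λ x h a g → x ⊠ (h ⊞ a ⊠ g) ≋ x ⊠ h ⊞ a ⊠ (x ⊠ g)) ≈.refl X h (C a) g))) ≈.refl)
    (β-C⊕ˡ s (X ⊗ h) (X ⊗ g) a f))

  -- The Euclidean step preserves definiteness of the first form. The second form does not change at
  -- all, because `X ⊗ g` has zero Bezoutian with itself.
  Interlacing-reduce : ∀ {d f g} → Interlacing (suc d) f g → Σ ℚ λ α → Σ Poly λ f₁ → 0ℚ < α × f ≈ f₁ ⊕ C α ⊗ (X ⊗ g) × g · δ d ≢ 0ℚ × Interlacing⁼ d f₁ g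
  Interlacing-reduce {d} {f} {g} t = α , f₁ , 0<α , f≈ , top≢0 , record
    { f↓ = f₁↓ ; g↓ = t.g↓ ; K = def
    ; L = Definite-cong (λ s → sym (trans (β-cong s ≈.refl f≈) (trans (β-C⊕ʳ s (X ⊗ g) f₁ α (X ⊗ g))
            (trans (cong (λ z → β s (X ⊗ g) f₁ + α * z) (β-self s (X ⊗ g)))
                   (solve 2 (λ x a → x :+ a :* con 0ℚ := x) refl (β s (X ⊗ g) f₁) α))))) t.L }
    where
    module t = Interlacing t
    open Reduction (reduce t.f↓ t.g↓ t.K)

  -- With equal degrees the Euclidean step is applied to (X g , f), whose form is the second one.
  -- The remainder X g - α X f is again divisible by X, which yields g₁.
  Interlacing⁼-reduce : ∀ {d f g} → Interlacing⁼ d f g → Σ ℚ λ α → Σ Poly λ g₁ → 0ℚ < α × g ≈ g₁ ⊕ C α ⊗ f × Interlacing d f g₁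
  Interlacing⁼-reduce {d} {f} {g} t = α , g₁ , 0<α , ≈.sym (⊕-C-cancel g α f) , record
    { f↓ = t.f↓
    ; g↓ = Below-X⁻ (Below-cong (≈.sym Xg₁≈) f₁↓)
    ; K  = Definite-cong (λ s → trans (β-C⊕ʳ s f g (- α) f) (trans (cong (λ z → β s f g + (- α) * z) (β-self s f))
             (solve 2 (λ x a → x :+ (:- a) :* con 0ℚ := x) refl (β s f g) α))) t.K
    ; L  = Definite-cong (λ s → β-cong s Xg₁≈ ≈.refl) def }
    where
    module t = Interlacing⁼ t
    open Reduction (reduce (Below-X⊗ t.g↓) t.f↓ t.L)
    g₁ = g ⊕ C (- α) ⊗ f
    Xg₁≈ : X ⊗ g₁ ≈ f₁
    Xg₁≈ = mk≈ λ s → trans (at (solveₚ 4 (λ x g a f → x ⊠ (g ⊞ a ⊠ f) ≋ x ⊠ g ⊞ a ⊠ (x ⊠ f)) ≈.refl X g (C (- α)) f) s)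
      (trans (⊕-· (X ⊗ g) _ s) (trans (cong₂ _+_ (trans (at f≈ s) (trans (⊕-· f₁ _ s) (cong (f₁ · s +_) (C⊗-· α (X ⊗ f) s)))) (C⊗-· (- α) (X ⊗ f) s))
        (solve 3 (λ x a y → x :+ a :* y :+ (:- a) :* y := x) refl (f₁ · s) α ((X ⊗ f) · s))))

  Interlacing⇒Chain  : ∀ d {f g} → Interlacing d f g → Chain f g
  Interlacing⁼⇒Chain : ∀ d {f g} → Interlacing⁼ d f g → Chain f g
  Interlacing⇒Chain zero {g = g} t = base (Interlacing.f↓ t) (mk≈ λ s → trans (local (Interlacing.g↓ t) λ i ()) (·-0 g))
  Interlacing⇒Chain (suc d) t = let α , f₁ , 0<α , f≈ , _ , t′ = Interlacing-reduce t in stepP 0<α f≈ (Interlacing⁼⇒Chain d t′)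
  Interlacing⁼⇒Chain d t = let α , g₁ , 0<α , g≈ , t′ = Interlacing⁼-reduce t in stepQ 0<α g≈ (Interlacing⇒Chain d t′)

  Interlacing⇒PSD : ∀ {d f g} → Interlacing d f g → PSD f g
  Interlacing⇒PSD t = Chain⇒PSD (Interlacing⇒Chain _ t)

  Combine-1 : ∀ f g → Combine (C 1ℚ) [] f g ≈ f
  Combine-1 f g = ≈.trans (≈.+-cong (≈.*-identityˡ f) (⊗≈[] X (≈.zeroˡ g))) (≈.+-identityʳ f)

  Combine′-1 : ∀ f g → Combine′ (C 1ℚ) [] f g ≈ C two ⊗ deriv f
  Combine′-1 f g = ≈.trans (≈.+-cong (≈.*-congˡ {C two} (≈.*-identityˡ (deriv f))) (≈.zeroˡ (g ⊕ C two ⊗ (X ⊗ deriv g)))) (≈.+-identityʳ _)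

  Chain-deriv₁ : ∀ {f g} → Chain f g → PSD f (C two ⊗ deriv f)
  Chain-deriv₁ {f} {g} c = PSD-cong (Combine-1 f g) (Combine′-1 f g) (Chain-deriv c (PSD-0 (C 1ℚ)))

  0<two : 0ℚ < two
  0<two = 0<+ 0<1 (<⇒≤ 0<1)

  Interlacing-absorb : ∀ {d f g h k a c} → 0ℚ < a → 0ℚ < c → PSD f h → C c ⊗ k ≈ h ⊕ C a ⊗ g → Below d k → Interlacing d f g → Interlacing d f k
  Interlacing-absorb {d} {f} {g} {h} {k} {a} {c} 0<a 0<c p k≈ k↓ t = record
    { f↓ = Interlacing.f↓ t ; g↓ = k↓
    ; K  = Definite-absorb 0<a 0<c (K≥0 p) (absorb-K f k≈) (Interlacing.K t)
    ; L  = Definite-absorb 0<a 0<c (L≥0 p) (absorb-L f k≈) (Interlacing.L t)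
    }

  -- The complete chain would give only semidefiniteness for (f , f′). Detaching its first step
  -- writes 2 f′ as a semidefinite part plus α g, and the definite pair (f , g) supplies strictness.
  Interlacing-deriv : ∀ d {f g} → Interlacing d f g → Interlacing d f (deriv f)
  Interlacing-deriv zero {f} t = record { f↓ = Interlacing.f↓ t ; g↓ = Below-deriv (Interlacing.f↓ t) ; K = λ _ _ _ () ; L = λ _ _ _ () }
  Interlacing-deriv (suc d) {f} {g} t =
    let α , f₁ , 0<α , f≈ , _ , t′ = Interlacing-reduce t
        h = Combine′ (C 1ℚ) ([] ⊕ C α ⊗ C 1ℚ) f₁ g
        p : PSD f h
        p = PSD-cong (≈.trans (Combine-P {C 1ℚ} {[]} f≈) (Combine-1 f g)) ≈.refl
              (Chain-deriv (Interlacing⁼⇒Chain d t′) (PSD-stepQ (<⇒≤ 0<α) (PSD-0 (C 1ℚ))))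
        2f′≈ : C two ⊗ deriv f ≈ h ⊕ C α ⊗ g
        2f′≈ = ≈.trans (≈.sym (Combine′-1 f g)) (≈.trans (≈.sym (Combine′-P {C 1ℚ} {[]} f≈))
                 (≈.+-congˡ {h} (≈.*-congˡ {C α} (≈.*-identityˡ g))))
    in Interlacing-absorb 0<α 0<two p 2f′≈ (Below-deriv (Interlacing.f↓ t)) t

  -- Division by X - 1 and the operator T

  one : Seq
  one _ = 1ℚ

  prefix : Seq → Seq
  prefix s zero    = 0ℚ
  prefix s (suc i) = s 0 + prefix (s ∘ suc) i

  prefix-suc : ∀ s i → prefix s (suc i) ≡ prefix s i + s i
  prefix-suc s zero    = +-comm (s 0) 0ℚ
  prefix-suc s (suc i) = trans (cong (s 0 +_) (prefix-suc (s ∘ suc) i)) (sym (+-assoc (s 0) (prefix (s ∘ suc) i) (s (suc i))))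

  prefix-local : ∀ i {s t : Seq} → (∀ k → k ℕ.< i → s k ≡ t k) → prefix s i ≡ prefix t i
  prefix-local zero    s≡t = refl
  prefix-local (suc i) s≡t = cong₂ _+_ (s≡t 0 (s≤s z≤n)) (prefix-local i λ k k<i → s≡t (suc k) (s≤s k<i))

  ·-const : ∀ p c → p · (λ _ → c) ≡ c * p · one
  ·-const p c = trans (·-cong p λ _ → sym (*-identityʳ c)) (·-* p c one)

  -- Synthetic division by X - 1 with the remainder `p · one` dropped; `prefix` is its transpose.
  quot : Poly → Poly
  quot []      = []
  quot (a ∷ p) = p · one ∷ quot p

  quot-· : ∀ p s → quot p · s ≡ p · prefix s
  quot-· []      s = refl
  quot-· (a ∷ p) s = begin
    p · one * s 0 + quot p · (s ∘ suc)                      ≡⟨ cong₂ _+_ (trans (*-comm (p · one) (s 0)) (sym (·-const p (s 0)))) (quot-· p _) ⟩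
    p · (λ _ → s 0) + p · prefix (s ∘ suc)                  ≡⟨ sym (·-+ p _ _) ⟩
    p · (prefix s ∘ suc)                                    ≡⟨ solve 2 (λ a x → x := a :* con 0ℚ :+ x) refl a (p · (prefix s ∘ suc)) ⟩
    a * 0ℚ + p · (prefix s ∘ suc)                           ∎
    where open ≡-Reasoning

  quot-X : ∀ p → p · one ≡ 0ℚ → X ⊗ quot p ≈ quot p ⊕ p
  quot-X p p1≡0 = mk≈ λ s → begin
    (X ⊗ quot p) · s                         ≡⟨ X⊗-· (quot p) s ⟩
    quot p · (s ∘ suc)                       ≡⟨ quot-· p _ ⟩
    p · prefix (s ∘ suc)                     ≡⟨ solve 1 (λ x → x := con 0ℚ :+ x) refl _ ⟩
    0ℚ + p · prefix (s ∘ suc)                ≡⟨ cong (_+ p · prefix (s ∘ suc)) (sym (trans (·-const p (s 0)) (trans (cong (s 0 *_) p1≡0) (*-zeroʳ (s 0))))) ⟩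
    p · (λ _ → s 0) + p · prefix (s ∘ suc)   ≡⟨ sym (·-+ p _ _) ⟩
    p · (prefix s ∘ suc)                     ≡⟨ ·-cong p (prefix-suc s) ⟩
    p · (λ i → prefix s i + s i)             ≡⟨ ·-+ p (prefix s) s ⟩
    p · prefix s + p · s                     ≡⟨ cong (_+ p · s) (sym (quot-· p s)) ⟩
    quot p · s + p · s                       ≡⟨ sym (⊕-· (quot p) p s) ⟩
    (quot p ⊕ p) · s                         ∎
    where open ≡-Reasoning

  Below-quot : ∀ {d p} → Below (suc d) p → Below d (quot p)
  Below-quot {p = p} p↓ = below λ s≡t → trans (quot-· p _) (trans
    (local p↓ λ { i (s≤s i≤d) → prefix-local i λ k k<i → s≡t k (ℕₚ.≤-trans k<i i≤d) }) (sym (quot-· p _)))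

  Numer : Poly → Poly
  Numer f = C (deriv f · one) ⊗ f ⊕ C (- (f · one)) ⊗ deriv f

  Numer-· : ∀ f s → Numer f · s ≡ deriv f · one * f · s - f · one * deriv f · s
  Numer-· f s = trans (⊕-· (C e₁ ⊗ f) _ s) (trans (cong₂ _+_ (C⊗-· e₁ f s) (C⊗-· (- e₀) (deriv f) s))
    (solve 4 (λ a b c d → a :* b :+ (:- c) :* d := a :* b :- c :* d) refl e₁ (f · s) e₀ (deriv f · s)))
    where
    e₀ = f · one
    e₁ = deriv f · one

  -- T f = (f′(1) f − f(1) f′) / (x − 1), that is f(1) Σ pᵢ² f / (qᵢ + pᵢ x) when f = f(1) ∏ (qᵢ + pᵢ x) with pᵢ + qᵢ = 1.
  T : Poly → Poly
  T f = quot (Numer f)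

  T-X : ∀ f → X ⊗ T f ≈ T f ⊕ Numer f
  T-X f = quot-X (Numer f) (trans (Numer-· f one) (solve 2 (λ a b → a :* b :- b :* a := con 0ℚ) refl (deriv f · one) (f · one)))

  module _ {d f} (0<f1 : 0ℚ < f · one) (t : Interlacing (suc d) f (deriv f)) where
    private
      module t = Interlacing t
      e₀ = f · one
      e₁ = deriv f · one
      f′ = deriv f
      p = Numer f
      Y : Poly
      Y = X ⊕ C (- 1ℚ)

      YT≈ : Y ⊗ T f ≈ p
      YT≈ = mk≈ λ s → trans (at (≈.distribʳ (T f) X (C (- 1ℚ))) s) (trans (⊕-· (X ⊗ T f) _ s)
        (trans (cong₂ _+_ (trans (at (T-X f) s) (⊕-· (T f) p s)) (C⊗-· (- 1ℚ) (T f) s))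
          (solve 2 (λ x y → x :+ y :+ (:- con 1ℚ) :* x := y) refl (T f · s) (p · s))))

      Y⋆ : ∀ (l : Seq) j → (Y ⋆ l) j ≡ l (suc j) - l j
      Y⋆ l j = trans (⊕-· X (C (- 1ℚ)) _) (trans
        (solve 3 (λ a b c → con 0ℚ :* a :+ (con 1ℚ :* b :+ con 0ℚ) :+ ((:- con 1ℚ) :* c :+ con 0ℚ) := b :- c) refl (l (j ℕ.+ 0)) (l (j ℕ.+ 1)) (l (j ℕ.+ 0)))
        (cong₂ (λ x y → l x - l y) (trans (ℕₚ.+-suc j 0) (cong suc (ℕₚ.+-identityʳ j))) (ℕₚ.+-identityʳ j)))

      -- A functional l with (x − 1) l = s is unique up to multiples of evaluation at 1, so it can be chosen to kill f.
      module Lift (s : Seq) where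
        e₀⁻¹ = proj₁ (inverse e₀ (0<⇒≢0 0<f1))
        c : ℚ
        c = - (f · prefix s * e₀⁻¹)
        l : Seq
        l i = prefix s i + c
        fl≡0 : f · l ≡ 0ℚ
        fl≡0 = begin
          f · l                                     ≡⟨ ·-+ f (prefix s) (λ _ → c) ⟩
          f · prefix s + f · (λ _ → c)              ≡⟨ cong (f · prefix s +_) (·-const f c) ⟩
          f · prefix s + c * e₀                     ≡⟨ solve 3 (λ x y z → x :+ :- (x :* y) :* z := x :- x :* (y :* z)) refl (f · prefix s) e₀⁻¹ e₀ ⟩
          f · prefix s - f · prefix s * (e₀⁻¹ * e₀) ≡⟨ cong (λ z → f · prefix s - f · prefix s * z) (proj₂ (inverse e₀ (0<⇒≢0 0<f1))) ⟩
          f · prefix s - f · prefix s * 1ℚ          ≡⟨ solve 1 (λ x → x :- x :* con 1ℚ := con 0ℚ) refl (f · prefix s) ⟩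
          0ℚ                                        ∎
          where open ≡-Reasoning
        l-suc : ∀ i → l (suc i) - l i ≡ s i
        l-suc i = trans (cong (λ z → z + c - l i) (prefix-suc s i)) (solve 3 (λ a b c → a :+ b :+ c :- (a :+ c) := b) refl (prefix s i) (s i) c)
        lift : ∀ u v → β s u v ≡ β l (Y ⊗ u) (Y ⊗ v)
        lift u v = sym (trans (β-⊗ l Y u v) (β-seq-cong u v λ i → trans (Y⋆ l i) (l-suc i)))
        βff₀ : β l (X ⊗ f) f ≡ 0ℚ
        βff₀ = trans (β-X-self l f) (trans (cong (λ z → z * z) fl≡0) refl)
        -- Since `l` kills `f`, the multiple of `f` inside `p` contributes nothing. What (x - 1) f
        -- gives against - e₀ f′ is e₀ times the sum of the two forms of (f , f′).
        KT≡ : β s f (T f) ≡ e₀ * (β l (X ⊗ f′) f + β l f f′)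
        KT≡ = begin
          β s f (T f)                       ≡⟨ lift f (T f) ⟩
          β l (Y ⊗ f) (Y ⊗ T f)             ≡⟨ β-cong l (≈.distribʳ f X (C (- 1ℚ))) YT≈ ⟩
          β l (X ⊗ f ⊕ C (- 1ℚ) ⊗ f) p      ≡⟨ β-C⊕ˡ l (X ⊗ f) f (- 1ℚ) p ⟩
          β l (X ⊗ f) p + (- 1ℚ) * β l f p  ≡⟨ cong₂ (λ x y → x + (- 1ℚ) * y) (βp (X ⊗ f)) (βp f) ⟩
          (e₁ * β l (X ⊗ f) f + (- e₀) * β l (X ⊗ f) f′) + (- 1ℚ) * (e₁ * β l f f + (- e₀) * β l f f′)
            ≡⟨ cong₂ (λ x y → (e₁ * x + (- e₀) * β l (X ⊗ f) f′) + (- 1ℚ) * (e₁ * y + (- e₀) * β l f f′)) βff₀ (β-self l f) ⟩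
          (e₁ * 0ℚ + (- e₀) * β l (X ⊗ f) f′) + (- 1ℚ) * (e₁ * 0ℚ + (- e₀) * β l f f′)
            ≡⟨ cong (λ x → (e₁ * 0ℚ + (- e₀) * x) + (- 1ℚ) * (e₁ * 0ℚ + (- e₀) * β l f f′)) (trans (β-X-swap l f f′)
                 (cong (λ z → (z * f′ · l + z * f′ · l) - β l (X ⊗ f′) f) fl≡0)) ⟩
          (e₁ * 0ℚ + (- e₀) * ((0ℚ * f′ · l + 0ℚ * f′ · l) - β l (X ⊗ f′) f)) + (- 1ℚ) * (e₁ * 0ℚ + (- e₀) * β l f f′)
            ≡⟨ solve 5 (λ e₁ e₀ x u v → (e₁ :* con 0ℚ :+ (:- e₀) :* ((con 0ℚ :* x :+ con 0ℚ :* x) :- u)) :+ (:- con 1ℚ) :* (e₁ :* con 0ℚ :+ (:- e₀) :* v)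
                          := e₀ :* (u :+ v)) refl e₁ e₀ (f′ · l) (β l (X ⊗ f′) f) (β l f f′) ⟩
          e₀ * (β l (X ⊗ f′) f + β l f f′)  ∎
          where
          open ≡-Reasoning
          βp : ∀ u → β l u p ≡ e₁ * β l u f + (- e₀) * β l u f′
          βp u = trans (β-C⊕ʳ l u (C e₁ ⊗ f) (- e₀) f′) (cong (_+ (- e₀) * β l u f′) (β-C⊗ʳ l e₁ u f))
        LT≡ : β s (X ⊗ T f) f ≡ e₀ * (β l (X ⊗ f′) f + β (X ⋆ l) f f′)
        LT≡ = begin
          β s (X ⊗ T f) f                             ≡⟨ lift (X ⊗ T f) f ⟩
          β l (Y ⊗ (X ⊗ T f)) (Y ⊗ f)                 ≡⟨ β-cong l (≈.trans (solveₚ 3 (λ y x t → y ⊠ (x ⊠ t) ≋ x ⊠ (y ⊠ t)) ≈.refl Y X (T f)) (≈.*-congˡ {X} YT≈)) (≈.distribʳ f X (C (- 1ℚ))) ⟩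
          β l (X ⊗ p) (X ⊗ f ⊕ C (- 1ℚ) ⊗ f)          ≡⟨ β-C⊕ʳ l (X ⊗ p) (X ⊗ f) (- 1ℚ) f ⟩
          β l (X ⊗ p) (X ⊗ f) + (- 1ℚ) * β l (X ⊗ p) f ≡⟨ cong₂ (λ x y → x + (- 1ℚ) * y) (βp (X ⊗ f)) (βp f) ⟩
          (e₁ * β l (X ⊗ f) (X ⊗ f) + (- e₀) * β l (X ⊗ f′) (X ⊗ f)) + (- 1ℚ) * (e₁ * β l (X ⊗ f) f + (- e₀) * β l (X ⊗ f′) f)
            ≡⟨ cong₂ (λ x y → (e₁ * x + (- e₀) * β l (X ⊗ f′) (X ⊗ f)) + (- 1ℚ) * (e₁ * y + (- e₀) * β l (X ⊗ f′) f)) (β-self l (X ⊗ f)) βff₀ ⟩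
          (e₁ * 0ℚ + (- e₀) * β l (X ⊗ f′) (X ⊗ f)) + (- 1ℚ) * (e₁ * 0ℚ + (- e₀) * β l (X ⊗ f′) f)
            ≡⟨ cong (λ x → (e₁ * 0ℚ + (- e₀) * x) + (- 1ℚ) * (e₁ * 0ℚ + (- e₀) * β l (X ⊗ f′) f)) (trans (β-⊗ l X f′ f) (β-anti (X ⋆ l) f′ f)) ⟩
          (e₁ * 0ℚ + (- e₀) * (- β (X ⋆ l) f f′)) + (- 1ℚ) * (e₁ * 0ℚ + (- e₀) * β l (X ⊗ f′) f)
            ≡⟨ solve 4 (λ e₁ e₀ u v → (e₁ :* con 0ℚ :+ (:- e₀) :* (:- v)) :+ (:- con 1ℚ) :* (e₁ :* con 0ℚ :+ (:- e₀) :* u)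
                          := e₀ :* (u :+ v)) refl e₁ e₀ (β l (X ⊗ f′) f) (β (X ⋆ l) f f′) ⟩
          e₀ * (β l (X ⊗ f′) f + β (X ⋆ l) f f′)  ∎
          where
          open ≡-Reasoning
          βp : ∀ u → β l (X ⊗ p) u ≡ e₁ * β l (X ⊗ f) u + (- e₀) * β l (X ⊗ f′) u
          βp u = trans (β-cong l (solveₚ 5 (λ x a f b g → x ⊠ (a ⊠ f ⊞ b ⊠ g) ≋ a ⊠ (x ⊠ f) ⊞ b ⊠ (x ⊠ g)) ≈.refl X (C e₁) f (C (- e₀)) f′) ≈.refl)
            (trans (β-C⊕ˡ l (C e₁ ⊗ (X ⊗ f)) (X ⊗ f′) (- e₀) u) (cong (_+ (- e₀) * β l (X ⊗ f′) u) (β-C⊗ˡ l e₁ (X ⊗ f) u)))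
        f-top≢0 : f · δ (suc d) ≢ 0ℚ
        f-top≢0 eq = 0<⇒≢0 (top-product t.f↓ t.g↓ t.K) (trans (cong (_* f′ · δ d) eq) (*-zeroˡ (f′ · δ d)))
        l≡0⇒s≡0 : (∀ k → k ℕ.< suc d → l k ≡ 0ℚ) → ∀ k → k ℕ.< suc d → s k ≡ 0ℚ
        l≡0⇒s≡0 l≡0 k k<1+d = trans (sym (l-suc k)) (cong₂ _-_ (l≡0′ (suc k) k<1+d) (l≡0 k k<1+d))
          where
          -- The index `suc d` is not covered by the hypothesis on `l`. With all earlier values
          -- zero, `f · l` is the leading coefficient of `f` times `l (suc d)`.
          l-top : l (suc d) ≡ 0ℚ
          l-top = *≡0⇒≡0 f-top≢0 (trans (*-comm (f · δ (suc d)) (l (suc d)))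
            (trans (sym (·-* f (l (suc d)) (δ (suc d)))) (trans (sym (local t.f↓ agree)) fl≡0)))
            where
            agree : ∀ i → i ℕ.< suc (suc d) → l i ≡ l (suc d) * δ (suc d) i
            agree i i<2+d with ℕₚ.m<1+n⇒m<n∨m≡n i<2+d
            ... | inj₁ i<1+d = trans (l≡0 i i<1+d) (sym (trans (cong (l (suc d) *_) (δ-< i<1+d)) (*-zeroʳ (l (suc d)))))
            ... | inj₂ refl  = sym (trans (cong (l (suc d) *_) (δ-diag d)) (*-identityʳ (l (suc d))))
          l≡0′ : ∀ i → i ℕ.≤ suc d → l i ≡ 0ℚ
          l≡0′ i i≤1+d with ℕₚ.m≤n⇒m<n∨m≡n i≤1+d
          ... | inj₁ i<1+d = l≡0 i i<1+d
          ... | inj₂ refl  = l-top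

      PSDf : PSD f f′
      PSDf = Interlacing⇒PSD t

    Interlacing-T : Interlacing (suc d) f (T f)
    Interlacing-T = record
      { f↓ = t.f↓
      ; g↓ = Below-quot (Below-⊕ (Below-C⊗ e₁ t.f↓) (Below-C⊗ (- e₀) (Below-≤ (ℕₚ.n≤1+n _) t.g↓)))
      ; K  = λ s h → let open Lift s in l≡0⇒s≡0 (t.L l (+≤0ˡ (K≥0 PSDf l) (*≤0⇒≤0 0<f1 (subst (_≤ 0ℚ) KT≡ h))))
      ; L  = λ s h → let open Lift s in l≡0⇒s≡0 (t.L l (+≤0ˡ (K≥0 PSDf (X ⋆ l)) (*≤0⇒≤0 0<f1 (subst (_≤ 0ℚ) LT≡ h))))
      }

  -- Darroch's theorem: coefficients rise before the mean

  record RealRooted (d : ℕ) (f : Poly) : Set where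
    field
      f₀>0 : 0ℚ < f · δ 0
      g    : Poly
      interlacing : Interlacing d f g

  RealRooted⇒coeff≥0 : ∀ {d f} → RealRooted d f → ∀ i → 0ℚ ≤ f · δ i
  RealRooted⇒coeff≥0 G i = proj₁ (Chain⇒coeff≥0 (Interlacing⇒Chain _ (RealRooted.interlacing G)) (<⇒≤ (RealRooted.f₀>0 G)) i)

  coeff-∷ : ∀ a p i → (a ∷ p) · δ (suc i) ≡ p · δ i
  coeff-∷ a p i = solve 2 (λ a x → a :* con 0ℚ :+ x := x) refl a (p · δ i)

  coeff-0 : ∀ a p → (a ∷ p) · δ 0 ≡ a
  coeff-0 a p = trans (cong (a * 1ℚ +_) (·-0 p)) (solve 1 (λ a → a :* con 1ℚ :+ con 0ℚ := a) refl a)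

  coeff≥0⇒·≥0 : ∀ p (s : Seq) → (∀ i → 0ℚ ≤ p · δ i) → (∀ i → 0ℚ ≤ s i) → 0ℚ ≤ p · s
  coeff≥0⇒·≥0 []      s p≥0 s≥0 = ≤-refl
  coeff≥0⇒·≥0 (a ∷ p) s p≥0 s≥0 = 0≤+ (0≤* (subst (0ℚ ≤_) (coeff-0 a p) (p≥0 0)) (s≥0 0))
    (coeff≥0⇒·≥0 p (s ∘ suc) (λ i → subst (0ℚ ≤_) (coeff-∷ a p i) (p≥0 (suc i))) (s≥0 ∘ suc))

  RealRooted⇒·one>0 : ∀ {d f} → RealRooted d f → 0ℚ < f · one
  RealRooted⇒·one>0 {f = f} G = subst (0ℚ <_) (sym split) (0<+ (RealRooted.f₀>0 G) (coeff≥0⇒·≥0 f _ (RealRooted⇒coeff≥0 G) (λ { zero → ≤-refl ; (suc i) → <⇒≤ 0<1 })))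
    where
    rest : Seq
    rest zero    = 0ℚ
    rest (suc i) = 1ℚ
    split : f · one ≡ f · δ 0 + f · rest
    split = trans (·-cong f λ { zero → refl ; (suc i) → refl }) (·-+ f (δ 0) rest)

  -- At `δ 0` the second form is the constant term of its Bezoutian, the product of the two constant
  -- coefficients.
  Interlacing⇒coeff₀>0 : ∀ {d f t} → 0ℚ < f · δ 0 → Interlacing (suc d) f t → 0ℚ < t · δ 0
  Interlacing⇒coeff₀>0 {d} {f} {t} f₀>0 ty = 0<*⇒0< f₀>0 (subst (0ℚ <_) eq (≰⇒> λ h → 1≢0 (Interlacing.L ty (δ 0) h 0 (s≤s z≤n))))
    where
    isBez : IsBez (suc d) (δ 0) (λ i j → δ 1 i * δ 0 j - δ 0 i * δ 1 j)
    isBez = record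
      { anti = λ i j → solve 4 (λ a b c d → a :* b :- c :* d := :- (d :* c :- b :* a)) refl (δ 1 i) (δ 0 j) (δ 0 i) (δ 1 j)
      ; step = λ {i} {j} _ _ → solve 4 (λ a b c d → a :* b :- con 0ℚ :* c := (d :* con 0ℚ :- a :* b) :+ (a :* b :+ a :* b)) refl (δ 0 i) (δ 0 j) (δ 1 j) (δ 1 i)
      }
    eq : β (δ 0) (X ⊗ t) f ≡ f · δ 0 * t · δ 0
    eq = trans (β-separated (δ 1) (δ 0) (Below-X⊗ (Interlacing.g↓ ty)) (Interlacing.f↓ ty) isBez)
      (trans (cong₂ (λ x y → x * f · δ 0 - y * f · δ 1) (X⊗-· t (δ 1)) (trans (X⊗-· t (δ 0)) (·-0 t)))
        (solve 3 (λ a b c → a :* b :- con 0ℚ :* c := b :* a) refl (t · δ 0) (f · δ 0) (f · δ 1)))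

  -- In terms of means: t′(1) / t(1) > f′(1) / f(1) − 1.
  mean-decrease : ∀ {d f t} → Interlacing (suc d) f t → 0ℚ < (t · one + t · ∂ one) * f · one - t · one * f · ∂ one
  mean-decrease {d} {f} {t} ty = subst (0ℚ <_) eq (≰⇒> λ h → 1≢0 (Interlacing.L ty one h 0 (s≤s z≤n)))
    where
    -- For evaluation at 1 the value `bez one i j` is i - j, so the form becomes the Wronskian at 1.
    isBez : IsBez (suc d) one (λ i j → ∂ one i * one j - one i * ∂ one j)
    isBez = record
      { anti = λ i j → solve 4 (λ a b c d → a :* b :- c :* d := :- (d :* c :- b :* a)) refl (∂ one i) 1ℚ 1ℚ (∂ one j)
      ; step = λ {i} {j} _ _ → solve 2 (λ a b → (con 1ℚ :+ a) :* con 1ℚ :- con 1ℚ :* b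
                  := (a :* con 1ℚ :- con 1ℚ :* (con 1ℚ :+ b)) :+ (con 1ℚ :* con 1ℚ :+ con 1ℚ :* con 1ℚ)) refl (∂ one i) (∂ one j)
      }
    eq : β one (X ⊗ t) f ≡ (t · one + t · ∂ one) * f · one - t · one * f · ∂ one
    eq = trans (β-separated (∂ one) one (Below-X⊗ (Interlacing.g↓ ty)) (Interlacing.f↓ ty) isBez)
      (cong₂ (λ x y → x * f · one - y * f · ∂ one) (trans (X⊗-· t (∂ one)) (·-+ t one (∂ one))) (X⊗-· t one))

  -- That `T f` interlaces `f` does not yet provide a polynomial interlacing `T f`. Minus the
  -- remainder of `f` modulo t = `T f` does: `f₁` is `f` less a multiple of X t, and in g′ = a t -
  -- f₁ the constant `a` cancels degree d. On functionals killing t the second form of (t , g′) is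
  -- that of (f₁ , t).
  RealRooted-T : ∀ {d f} → RealRooted (suc d) f → Interlacing (suc d) f (T f) × RealRooted d (T f)
  RealRooted-T {d} {f} G = ty , record { f₀>0 = Interlacing⇒coeff₀>0 (RealRooted.f₀>0 G) ty ; g = g′ ; interlacing = ty′ }
    where
    t = T f
    ty : Interlacing (suc d) f t
    ty = Interlacing-T (RealRooted⇒·one>0 G) (Interlacing-deriv (suc d) (RealRooted.interlacing G))
    red = Interlacing-reduce ty
    f₁ = proj₁ (proj₂ red)
    τ≢0 : t · δ d ≢ 0ℚ
    τ≢0 = proj₁ (proj₂ (proj₂ (proj₂ (proj₂ red))))
    module II = Interlacing⁼ (proj₂ (proj₂ (proj₂ (proj₂ (proj₂ red)))))
    τ = t · δ d
    φ = f₁ · δ d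
    τ⁻¹ = proj₁ (inverse τ τ≢0)
    τ⁻¹τ≡1 = proj₂ (inverse τ τ≢0)
    a = φ * τ⁻¹
    g′ = C a ⊗ t ⊕ C (- 1ℚ) ⊗ f₁
    g′↓ : Below d g′
    g′↓ = Below-drop (Below-⊕ (Below-C⊗ a II.g↓) (Below-C⊗ (- 1ℚ) II.f↓)) (begin
      g′ · δ d                  ≡⟨ ⊕-· (C a ⊗ t) _ _ ⟩
      (C a ⊗ t) · δ d + (C (- 1ℚ) ⊗ f₁) · δ d ≡⟨ cong₂ _+_ (C⊗-· a t _) (C⊗-· (- 1ℚ) f₁ _) ⟩
      a * τ + (- 1ℚ) * φ        ≡⟨ cong (_+ (- 1ℚ) * φ) (trans (*-assoc φ τ⁻¹ τ) (cong (φ *_) τ⁻¹τ≡1)) ⟩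
      φ * 1ℚ + (- 1ℚ) * φ       ≡⟨ solve 1 (λ x → x :* con 1ℚ :+ (:- con 1ℚ) :* x := con 0ℚ) refl φ ⟩
      0ℚ                        ∎)
      where open ≡-Reasoning
    K′ : ∀ s → β s t g′ ≡ β s f₁ t
    K′ s = begin
      β s t g′                                 ≡⟨ β-C⊕ʳ s t (C a ⊗ t) (- 1ℚ) f₁ ⟩
      β s t (C a ⊗ t) + (- 1ℚ) * β s t f₁      ≡⟨ cong₂ (λ x y → x + (- 1ℚ) * y) (trans (β-C⊗ʳ s a t t) (cong (a *_) (β-self s t))) (β-anti s t f₁) ⟩
      a * 0ℚ + (- 1ℚ) * (- β s f₁ t)           ≡⟨ solve 2 (λ a x → a :* con 0ℚ :+ (:- con 1ℚ) :* (:- x) := x) refl a (β s f₁ t) ⟩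
      β s f₁ t                                 ∎
      where open ≡-Reasoning
    L′ : ∀ s → t · s ≡ 0ℚ → β s (X ⊗ g′) t ≡ β s (X ⊗ t) f₁
    L′ s ts≡0 = begin
      β s (X ⊗ g′) t
        ≡⟨ β-cong s (solveₚ 5 (λ x a t b f → x ⊠ (a ⊠ t ⊞ b ⊠ f) ≋ a ⊠ (x ⊠ t) ⊞ b ⊠ (x ⊠ f)) ≈.refl X (C a) t (C (- 1ℚ)) f₁) ≈.refl ⟩
      β s (C a ⊗ (X ⊗ t) ⊕ C (- 1ℚ) ⊗ (X ⊗ f₁)) t
        ≡⟨ trans (β-C⊕ˡ s (C a ⊗ (X ⊗ t)) (X ⊗ f₁) (- 1ℚ) t) (cong₂ (λ x y → x + (- 1ℚ) * y)
             (trans (β-C⊗ˡ s a (X ⊗ t) t) (cong (a *_) (trans (β-X-self s t) (cong (λ z → z * z) ts≡0))))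
             (trans (β-X-swap s f₁ t) (cong (λ z → (f₁ · s * z + f₁ · s * z) - β s (X ⊗ t) f₁) ts≡0))) ⟩
      a * (0ℚ * 0ℚ) + (- 1ℚ) * ((f₁ · s * 0ℚ + f₁ · s * 0ℚ) - β s (X ⊗ t) f₁)
        ≡⟨ solve 3 (λ a x y → a :* (con 0ℚ :* con 0ℚ) :+ (:- con 1ℚ) :* ((x :* con 0ℚ :+ x :* con 0ℚ) :- y) := y) refl a (f₁ · s) (β s (X ⊗ t) f₁) ⟩
      β s (X ⊗ t) f₁ ∎
      where open ≡-Reasoning
    ty′ : Interlacing d t g′
    ty′ = record
      { f↓ = II.g↓
      ; g↓ = g′↓
      ; K  = Definite-cong K′ II.K
      ; L  = λ s h k k<d →
          -- The form of X g′ and t does not see the value of `s` at d, which is therefore free to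
          -- be set so that t vanishes on `ŝ`, as `L′` requires.
          let c = - (t · s * τ⁻¹)
              ŝ = adjust d c s
              tŝ≡0 : t · ŝ ≡ 0ℚ
              tŝ≡0 = trans (adjust-· d c t s) (trans
                (solve 3 (λ x y z → x :+ :- (x :* y) :* z := x :- x :* (y :* z)) refl (t · s) τ⁻¹ τ) (trans
                (cong (λ z → t · s - t · s * z) τ⁻¹τ≡1)
                (solve 1 (λ x → x :- x :* con 1ℚ := con 0ℚ) refl (t · s))))
              eq : β s (X ⊗ g′) t ≡ β ŝ (X ⊗ t) f₁
              eq = trans (β-local (Below-X⊗ g′↓) II.g↓ (λ i i<d → sym (adjust-< c s i<d))) (L′ ŝ tŝ≡0)
          in trans (sym (adjust-< c s k<d)) (II.L ŝ (subst (_≤ 0ℚ) eq h) k (ℕₚ.m≤n⇒m≤1+n k<d))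
      }

  ∂-0 : ∀ i → ∂ (λ _ → 0ℚ) i ≡ 0ℚ
  ∂-0 zero    = refl
  ∂-0 (suc i) = cong (0ℚ +_) (∂-0 i)

  ∂-δ : ∀ k i → ∂ (δ k) i ≡ ∂ one (suc k) * δ (suc k) i
  ∂-δ k       zero    = sym (*-zeroʳ (∂ one (suc k)))
  ∂-δ zero    (suc i) = trans (cong (δ 0 i +_) (∂-0 i)) (solve 1 (λ x → x :+ con 0ℚ := (con 1ℚ :+ con 0ℚ) :* x) refl (δ 0 i))
  ∂-δ (suc k) (suc i) = trans (cong (δ (suc k) i +_) (∂-δ k i))
    (solve 2 (λ x n → x :+ n :* x := (con 1ℚ :+ n) :* x) refl (δ (suc k) i) (∂ one (suc k)))

  ∂one≥0 : ∀ k → 0ℚ ≤ ∂ one k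
  ∂one≥0 zero    = ≤-refl
  ∂one≥0 (suc k) = 0≤+ (<⇒≤ 0<1) (∂one≥0 k)

  ∂one>0 : ∀ k → 0ℚ < ∂ one (suc k)
  ∂one>0 k = 0<+ 0<1 (∂one≥0 k)

  Numer-coeff : ∀ f k → Numer f · δ k ≡ f · ∂ one * f · δ k - f · one * (∂ one (suc k) * f · δ (suc k))
  Numer-coeff f k = trans (Numer-· f (δ k)) (cong₂ (λ x y → x * f · δ k - f · one * y) (deriv-· f one)
    (trans (deriv-· f (δ k)) (trans (·-cong f (∂-δ k)) (·-* f (∂ one (suc k)) (δ (suc k))))))

  -- Negativity of f′(1) fₖ - f(1) (k + 1) fₖ₊₁ says that fₖ₊₁ exceeds fₖ times the mean divided by
  -- k + 1, a factor that is at least 1.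
  darroch-step : ∀ {d f} k → RealRooted d f → ∂ one (suc k) * f · one ≤ f · ∂ one → Numer f · δ k < 0ℚ → f · δ k < f · δ (suc k)
  darroch-step {f = f} k G mean neg = 0<-⇒< (0<*⇒0< {f · one * ∂ one (suc k)} (0<* (RealRooted⇒·one>0 G) (∂one>0 k))
    (subst (0ℚ <_) eq (0<+ (neg-antimono-< neg) (0≤* (≤⇒0≤- mean) (RealRooted⇒coeff≥0 G k)))))
    where
    eq : - (Numer f · δ k) + (f · ∂ one - ∂ one (suc k) * f · one) * f · δ k ≡ f · one * ∂ one (suc k) * (f · δ (suc k) - f · δ k)
    eq = trans (cong (λ z → - z + (f · ∂ one - ∂ one (suc k) * f · one) * f · δ k) (Numer-coeff f k))
      (solve 5 (λ e₁ x e₀ n y → :- (e₁ :* x :- e₀ :* (n :* y)) :+ (e₁ :- n :* e₀) :* x := e₀ :* n :* (y :- x)) refl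
        (f · ∂ one) (f · δ k) (f · one) (∂ one (suc k)) (f · δ (suc k)))

  -- The differences of the coefficients of T f are f(1) (k + 1) fₖ₊₁ − f′(1) fₖ, and T f satisfies the same hypothesis with k − 1.
  darroch : ∀ k d {f} → RealRooted d f → ∂ one (suc k) * f · one ≤ f · ∂ one → f · δ k < f · δ (suc k)
  darroch k zero {f} G mean = contradiction (<-≤-trans (0<* (∂one>0 k) (RealRooted⇒·one>0 G)) (subst (∂ one (suc k) * f · one ≤_) f′≡0 mean)) (<-irrefl refl)
    where
    f′≡0 : f · ∂ one ≡ 0ℚ
    f′≡0 = trans (local (Interlacing.f↓ (RealRooted.interlacing G)) λ { zero _ → refl ; (suc i) (s≤s ()) }) (·-0 f)
  darroch zero (suc d) {f} G mean = darroch-step 0 G mean (subst (_< 0ℚ) eq (neg-antimono-< (RealRooted.f₀>0 (proj₂ (RealRooted-T G)))))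
    where
    t = T f
    eq : - (t · δ 0) ≡ Numer f · δ 0
    eq = begin
      - (t · δ 0)                                   ≡⟨ solve 1 (λ x → :- x := con 0ℚ :- x) refl (t · δ 0) ⟩
      0ℚ - t · δ 0                                  ≡⟨ cong (_- t · δ 0) (sym (trans (X⊗-· t (δ 0)) (·-0 t))) ⟩
      (X ⊗ t) · δ 0 - t · δ 0                       ≡⟨ cong (_- t · δ 0) (trans (at (T-X f) (δ 0)) (⊕-· t (Numer f) (δ 0))) ⟩
      t · δ 0 + Numer f · δ 0 - t · δ 0             ≡⟨ solve 2 (λ x y → x :+ y :- x := y) refl (t · δ 0) (Numer f · δ 0) ⟩
      Numer f · δ 0                                 ∎
      where open ≡-Reasoning
  darroch (suc k) (suc d) {f} G mean = darroch-step (suc k) G mean (subst (_< 0ℚ) eq (neg-antimono-< (<⇒0<- IH)))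
    where
    t = T f
    G′ : RealRooted d t
    G′ = proj₂ (RealRooted-T G)
    n = ∂ one (suc k)
    mean′ : n * t · one ≤ t · ∂ one
    mean′ = 0≤-⇒≤ (0≤*⇒0≤ (RealRooted⇒·one>0 G) (subst (0ℚ ≤_)
      (solve 5 (λ t₀ t₁ e₀ e₁ n → ((t₀ :+ t₁) :* e₀ :- t₀ :* e₁) :+ t₀ :* (e₁ :- (con 1ℚ :+ n) :* e₀) := e₀ :* (t₁ :- n :* t₀)) refl
        (t · one) (t · ∂ one) (f · one) (f · ∂ one) n)
      (0≤+ (<⇒≤ (mean-decrease (proj₁ (RealRooted-T G)))) (0≤* (<⇒≤ (RealRooted⇒·one>0 G′)) (≤⇒0≤- mean)))))
    IH : t · δ k < t · δ (suc k)
    IH = darroch k d G′ mean′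
    eq : - (t · δ (suc k) - t · δ k) ≡ Numer f · δ (suc k)
    eq = begin
      - (t · δ (suc k) - t · δ k)                              ≡⟨ solve 2 (λ x y → :- (x :- y) := y :- x) refl (t · δ (suc k)) (t · δ k) ⟩
      t · δ k - t · δ (suc k)                                  ≡⟨ cong (_- t · δ (suc k)) (sym (X⊗-· t (δ (suc k)))) ⟩
      (X ⊗ t) · δ (suc k) - t · δ (suc k)                      ≡⟨ cong (_- t · δ (suc k)) (trans (at (T-X f) _) (⊕-· t (Numer f) _)) ⟩
      t · δ (suc k) + Numer f · δ (suc k) - t · δ (suc k)      ≡⟨ solve 2 (λ x y → x :+ y :- x := y) refl (t · δ (suc k)) (Numer f · δ (suc k)) ⟩
      Numer f · δ (suc k)                                      ∎
      where open ≡-Reasoning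

  -- Reversal: coefficients fall after the mean

  δ-≢ : ∀ {k i} → k ≢ i → δ k i ≡ 0ℚ
  δ-≢ {zero}  {zero}  k≢i = contradiction refl k≢i
  δ-≢ {zero}  {suc i} k≢i = refl
  δ-≢ {suc k} {zero}  k≢i = refl
  δ-≢ {suc k} {suc i} k≢i = δ-≢ (k≢i ∘ cong suc)

  δ-flip : ∀ {d i j} → i ℕ.≤ d → j ℕ.≤ d → δ j (d ℕ.∸ i) ≡ δ (d ℕ.∸ j) i
  δ-flip {d} {i} {j} i≤d j≤d with j ℕₚ.≟ d ℕ.∸ i
  ... | yes refl = trans (δ-diag (d ℕ.∸ i)) (sym (trans (cong (λ k → δ k i) (ℕₚ.m∸[m∸n]≡n i≤d)) (δ-diag i)))
  ... | no j≢    = trans (δ-≢ j≢) (sym (δ-≢ {d ℕ.∸ j} {i} λ eq → j≢ (trans (sym (ℕₚ.m∸[m∸n]≡n j≤d)) (cong (d ℕ.∸_) eq))))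

  ∸-suc : ∀ {d i} → i ℕ.< d → d ℕ.∸ i ≡ suc (d ℕ.∸ suc i)
  ∸-suc {suc d} {zero}  _         = refl
  ∸-suc {suc d} {suc i} (s≤s i<d) = ∸-suc i<d

  ∂one-+ : ∀ i j → ∂ one (i ℕ.+ j) ≡ ∂ one i + ∂ one j
  ∂one-+ zero    j = sym (+-identityˡ _)
  ∂one-+ (suc i) j = trans (cong (1ℚ +_) (∂one-+ i j)) (sym (+-assoc 1ℚ (∂ one i) (∂ one j)))

  ∂one-∸ : ∀ {d i} → i ℕ.≤ d → ∂ one (d ℕ.∸ i) ≡ ∂ one d - ∂ one i
  ∂one-∸ {d} {i} i≤d = trans (solve 2 (λ x y → x := x :+ y :- y) refl (∂ one (d ℕ.∸ i)) (∂ one i))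
    (cong (_- ∂ one i) (trans (sym (∂one-+ (d ℕ.∸ i) i)) (cong (∂ one) (ℕₚ.m∸n+n≡m i≤d))))

  mono : ℕ → Poly
  mono zero    = C 1ℚ
  mono (suc d) = X ⊗ mono d

  mono-· : ∀ d s → mono d · s ≡ s d
  mono-· zero    s = trans (+-identityʳ _) (*-identityˡ (s 0))
  mono-· (suc d) s = trans (X⊗-· (mono d) s) (mono-· d _)

  -- Truncated subtraction: a term of degree above d would land on the constant coefficient.
  rev : ℕ → Poly → Poly
  rev d []      = []
  rev d (a ∷ p) = C a ⊗ mono d ⊕ rev (d ℕ.∸ 1) p

  rev-· : ∀ d p s → rev d p · s ≡ p · (λ i → s (d ℕ.∸ i))
  rev-· d []      s = refl
  rev-· d (a ∷ p) s = trans (⊕-· (C a ⊗ mono d) _ s) (cong₂ _+_ (trans (C⊗-· a (mono d) s) (cong (a *_) (mono-· d s)))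
    (trans (rev-· (d ℕ.∸ 1) p s) (·-cong p λ i → cong s (ℕₚ.∸-+-assoc d 1 i))))

  flip : ℕ → Seq → Seq
  flip d s i = s (d ℕ.∸ suc i)

  -- Reversal substitutes 1/x and 1/y, and 1/x - 1/y = - (x - y) / (x y). This explains the sign,
  -- and why `flip` reverses with respect to degree d - 1 instead of d.
  β-rev : ∀ {d} s {f g} → Below (suc d) f → Below (suc d) g → β s (rev d f) (rev d g) ≡ - β (flip d s) f g
  β-rev {d} s {f} {g} f↓ g↓ = begin
    β s (rev d f) (rev d g)                             ≡⟨ β-def s (rev d f) (rev d g) ⟩
    rev d f · (λ i → rev d g · bez s i)                   ≡⟨ rev-· d f _ ⟩
    f · (λ i → rev d g · bez s (d ℕ.∸ i))                 ≡⟨ ·-cong f (λ i → rev-· d g _) ⟩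
    f · (λ i → g · (λ j → bez s (d ℕ.∸ i) (d ℕ.∸ j)))     ≡⟨ solve 1 (λ x → x := :- (:- x)) refl _ ⟩
    - - (f · (λ i → g · (λ j → bez s (d ℕ.∸ i) (d ℕ.∸ j)))) ≡⟨ cong -_ (sym (trans (·-cong f λ i → ·-neg g _) (·-neg f _))) ⟩
    - (f · (λ i → g · M i))                             ≡⟨ cong -_ (sym (β-unique f↓ g↓ isBez)) ⟩
    - β (flip d s) f g                                  ∎
    where
    open ≡-Reasoning
    M : ℕ → ℕ → ℚ
    M i j = - bez s (d ℕ.∸ i) (d ℕ.∸ j)
    isBez : IsBez d (flip d s) M
    isBez = record
      { anti = λ i j → cong -_ (bez-anti s (d ℕ.∸ i) (d ℕ.∸ j))
      ; step = λ {i} {j} i<d j<d →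
          let a = d ℕ.∸ suc i ; b = d ℕ.∸ suc j in begin
          - bez s a (d ℕ.∸ j)                                 ≡⟨ cong (λ k → - bez s a k) (∸-suc j<d) ⟩
          - bez s a (suc b)                                   ≡⟨ solve 2 (λ x y → :- x := :- (x :+ y) :+ y) refl (bez s a (suc b)) (s a * s b + s a * s b) ⟩
          - (bez s a (suc b) + (s a * s b + s a * s b)) + (s a * s b + s a * s b) ≡⟨ cong (λ z → - z + (s a * s b + s a * s b)) (sym (bez-step s a b)) ⟩
          - bez s (suc a) b + (s a * s b + s a * s b)         ≡⟨ cong (λ k → - bez s k b + (s a * s b + s a * s b)) (sym (∸-suc i<d)) ⟩
          - bez s (d ℕ.∸ i) b + (s a * s b + s a * s b)       ∎
      }

  flip-0 : ∀ d {s} → (∀ k → k ℕ.< d → flip d s k ≡ 0ℚ) → ∀ k → k ℕ.< d → s k ≡ 0ℚ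
  flip-0 d {s} h k k<d = trans (cong s (sym eq)) (h (d ℕ.∸ suc k) (ℕₚ.≤-trans (ℕₚ.≤-reflexive (sym (∸-suc k<d))) (ℕₚ.m∸n≤m d k)))
    where
    eq : d ℕ.∸ suc (d ℕ.∸ suc k) ≡ k
    eq = trans (cong (d ℕ.∸_) (sym (∸-suc k<d))) (ℕₚ.m∸[m∸n]≡n (ℕₚ.<⇒≤ k<d))

  rev-coeff : ∀ {d f j} → Below (suc d) f → j ℕ.≤ d → rev d f · δ j ≡ f · δ (d ℕ.∸ j)
  rev-coeff {d} {f} f↓ j≤d = trans (rev-· d f _) (local f↓ λ { i (s≤s i≤d) → δ-flip i≤d j≤d })

  -- The reversal of X g interlaces the reversal of f: its first form is the second form of (f , g),
  -- and conversely.
  RealRooted-rev : ∀ {d f} → RealRooted d f → RealRooted d (rev d f)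
  RealRooted-rev {d} {f} G = record
    { f₀>0 = subst (0ℚ <_) (sym (rev-coeff t.f↓ z≤n)) (top>0 d f G)
    ; g    = g*
    ; interlacing = record
      { f↓ = below λ s≡t → trans (rev-· d f _) (trans (·-cong f λ i → s≡t (d ℕ.∸ i) (s≤s (ℕₚ.m∸n≤m d i))) (sym (rev-· d f _)))
      ; g↓ = below λ s≡t → trans (g*-· _) (trans (local t.g↓ λ i i<d → s≡t (d ℕ.∸ suc i) (ℕₚ.≤-trans (ℕₚ.≤-reflexive (sym (∸-suc i<d))) (ℕₚ.m∸n≤m d i))) (sym (g*-· _)))
      ; K  = λ s h → flip-0 d (t.L (flip d s) (subst (_≤ 0ℚ) (K-eq s) h))
      ; L  = λ s h → flip-0 d (t.K (flip d s) (subst (_≤ 0ℚ) (L-eq s) h))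
      }
    }
    where
    open RealRooted G
    module t = Interlacing interlacing
    g* = rev d (X ⊗ g)
    g*-· : ∀ s → g* · s ≡ g · (λ i → s (d ℕ.∸ suc i))
    g*-· s = trans (rev-· d (X ⊗ g) s) (X⊗-· g _)
    K-eq : ∀ s → β s (rev d f) g* ≡ β (flip d s) (X ⊗ g) f
    K-eq s = trans (β-rev s t.f↓ (Below-X⊗ t.g↓)) (sym (β-anti (flip d s) (X ⊗ g) f))
    Xg*≈ : X ⊗ g* ≈ rev d g
    Xg*≈ = mk≈ λ s → trans (X⊗-· g* s) (trans (g*-· _) (trans (local t.g↓ λ i i<d → cong s (sym (∸-suc i<d))) (sym (rev-· d g s))))
    L-eq : ∀ s → β s (X ⊗ g*) (rev d f) ≡ β (flip d s) f g
    L-eq s = trans (β-cong s Xg*≈ ≈.refl) (trans (β-rev s (Below-≤ (ℕₚ.n≤1+n d) t.g↓) t.f↓) (sym (β-anti (flip d s) f g)))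
    top>0 : ∀ d f → RealRooted d f → 0ℚ < f · δ d
    top>0 zero    f G = RealRooted.f₀>0 G
    top>0 (suc d) f G = ≰⇒> λ h → 0<⇒≢0 (top-product (Interlacing.f↓ ty) (Interlacing.g↓ ty) (Interlacing.K ty))
        (trans (cong (_* RealRooted.g G · δ d) (≤-antisym h (RealRooted⇒coeff≥0 G (suc d)))) (*-zeroˡ (RealRooted.g G · δ d)))
      where ty = RealRooted.interlacing G

  -- Reversal turns a mean into `d` minus that mean, so a mean of at most k becomes one of at least
  -- d - k, which is `suc j`.
  darroch-rev : ∀ {d f k} → RealRooted d f → k ℕ.< d → f · ∂ one ≤ ∂ one k * f · one → f · δ (suc k) < f · δ k
  darroch-rev {d} {f} {k} G k<d mean = subst₂ _<_
    (trans (rev-coeff f↓ (ℕₚ.m∸n≤m d (suc k))) (cong (λ i → f · δ i) (ℕₚ.m∸[m∸n]≡n k<d)))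
    (trans (cong (λ i → rev d f · δ i) (sym (∸-suc k<d))) (trans (rev-coeff f↓ (ℕₚ.m∸n≤m d k)) (cong (λ i → f · δ i) (ℕₚ.m∸[m∸n]≡n (ℕₚ.<⇒≤ k<d)))))
    (darroch j d (RealRooted-rev G) mean*)
    where
    f↓ = Interlacing.f↓ (RealRooted.interlacing G)
    j = d ℕ.∸ suc k
    mean*₁ : rev d f · ∂ one ≡ ∂ one d * f · one - f · ∂ one
    mean*₁ = trans (rev-· d f (∂ one)) (trans (local f↓ λ { i (s≤s i≤d) → ∂one-∸ i≤d })
      (trans (·-- f (λ _ → ∂ one d) (∂ one)) (cong (_- f · ∂ one) (·-const f (∂ one d)))))
    mean* : ∂ one (suc j) * rev d f · one ≤ rev d f · ∂ one
    mean* = 0≤-⇒≤ (subst (0ℚ ≤_) (trans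
        (solve 4 (λ n e₀ e₁ m → n :* e₀ :- e₁ := (m :* e₀ :- e₁) :- (m :- n) :* e₀) refl (∂ one k) (f · one) (f · ∂ one) (∂ one d))
        (cong₂ _-_ (sym mean*₁) (cong₂ _*_ (trans (sym (∂one-∸ (ℕₚ.<⇒≤ k<d))) (cong (∂ one) (∸-suc k<d))) (sym (rev-· d f one)))))
      (≤⇒0≤- mean))

  -- Real-rootedness of the polynomials E

  Interlacing⁼-absorb : ∀ {d f g h k a c} → 0ℚ < a → 0ℚ < c → PSD f h → C c ⊗ k ≈ h ⊕ C a ⊗ g → Below (suc d) k → Interlacing⁼ d f g → Interlacing⁼ d f k
  Interlacing⁼-absorb {d} {f} {g} {h} {k} {a} {c} 0<a 0<c p k≈ k↓ t = record
    { f↓ = Interlacing⁼.f↓ t ; g↓ = k↓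
    ; K  = Definite-absorb 0<a 0<c (K≥0 p) (absorb-K f k≈) (Interlacing⁼.K t)
    ; L  = Definite-absorb 0<a 0<c (L≥0 p) (absorb-L f k≈) (Interlacing⁼.L t)
    }

  Slope : ℚ → Poly → Poly → Poly
  Slope c f g = deriv f ⊕ C c ⊗ g

  Slope≈ : ∀ c f g → C two ⊗ Slope c f g ≈ C two ⊗ deriv f ⊕ C (two * c) ⊗ g
  Slope≈ c f g = ≈.trans (≈.distribˡ (C two) (deriv f) (C c ⊗ g)) (≈.+-congˡ {C two ⊗ deriv f} (mk≈ λ s →
    trans (C⊗-· two (C c ⊗ g) s) (trans (cong (two *_) (C⊗-· c g s)) (trans (sym (*-assoc two c (g · s))) (sym (C⊗-· (two * c) g s))))))

  -- The chain contributes a semidefinite form for 2 f′, and the positive multiple of `g` makes the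
  -- sum definite.
  Interlacing-Slope : ∀ {d f g c} → 0ℚ < c → Interlacing d f g → Interlacing d f (Slope c f g)
  Interlacing-Slope {d} {f} {g} {c} 0<c t = Interlacing-absorb (0<* 0<two 0<c) 0<two (Chain-deriv₁ (Interlacing⇒Chain d t)) (Slope≈ c f g)
    (Below-⊕ (Below-deriv (Interlacing.f↓ t)) (Below-C⊗ c (Interlacing.g↓ t))) t

  Interlacing⁼-Slope : ∀ {d f g c} → 0ℚ < c → Interlacing⁼ d f g → Interlacing⁼ d f (Slope c f g)
  Interlacing⁼-Slope {d} {f} {g} {c} 0<c t = Interlacing⁼-absorb (0<* 0<two 0<c) 0<two (Chain-deriv₁ (Interlacing⁼⇒Chain d t)) (Slope≈ c f g)
    (Below-⊕ (Below-≤ (ℕₚ.n≤1+n d) (Below-deriv (Interlacing⁼.f↓ t))) (Below-C⊗ c (Interlacing⁼.g↓ t))) t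

  ascend-K : ∀ s f h → β s (f ⊕ X ⊗ h) f ≡ β s (X ⊗ h) f
  ascend-K s f h = trans (β-⊕ˡ s f (X ⊗ h) f) (trans (cong (_+ β s (X ⊗ h) f) (β-self s f)) (+-identityˡ _))

  -- The form is (f · s)² plus the first form of (f , h) at the shifted functional. If it is at most
  -- 0, both parts vanish: definiteness kills s 1, ..., s d, and then f · s reduces to f₀ s₀.
  ascend-L : ∀ {d f h} → Below (suc d) f → f · δ 0 ≢ 0ℚ → PSD f h → Definite d (λ s → β s f h) →
    Definite (suc d) (λ s → β s (X ⊗ f) (f ⊕ X ⊗ h))
  ascend-L {d} {f} {h} f↓ f₀≢0 p def s le = λ { zero _ → s₀≡0 ; (suc k) (s≤s k<d) → s₊≡0 k k<d }
    where
    eq : β s (X ⊗ f) (f ⊕ X ⊗ h) ≡ f · s * f · s + β (X ⋆ s) f h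
    eq = trans (β-⊕ʳ s (X ⊗ f) f (X ⊗ h)) (cong₂ _+_ (β-X-self s f) (β-⊗ s X f h))
    le′ : f · s * f · s + β (X ⋆ s) f h ≤ 0ℚ
    le′ = subst (_≤ 0ℚ) eq le
    X⋆ : ∀ k → (X ⋆ s) k ≡ s (suc k)
    X⋆ k = trans (solve 2 (λ x y → con 0ℚ :* x :+ (con 1ℚ :* y :+ con 0ℚ) := y) refl (s (k ℕ.+ 0)) (s (k ℕ.+ 1)))
      (cong s (trans (ℕₚ.+-suc k 0) (cong suc (ℕₚ.+-identityʳ k))))
    s₊≡0 : ∀ k → k ℕ.< d → s (suc k) ≡ 0ℚ
    s₊≡0 k k<d = trans (sym (X⋆ k)) (def (X ⋆ s) (+≤0ʳ (0≤² (f · s)) le′) k k<d)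
    fs≡0 : f · s ≡ 0ℚ
    fs≡0 = ²≤0⇒≡0 (+≤0ˡ (K≥0 p (X ⋆ s)) le′)
    s₀≡0 : s 0 ≡ 0ℚ
    s₀≡0 = *≡0⇒≡0 f₀≢0 (trans (*-comm (f · δ 0) (s 0)) (trans (sym (·-* f (s 0) (δ 0))) (trans (sym (local f↓ agree)) fs≡0)))
      where
      agree : ∀ i → i ℕ.< suc d → s i ≡ s 0 * δ 0 i
      agree zero    _         = sym (*-identityʳ (s 0))
      agree (suc i) (s≤s i<d) = trans (s₊≡0 i i<d) (sym (*-zeroʳ (s 0)))

  Interlacing-ascend : ∀ {d f h} → f · δ 0 ≢ 0ℚ → Interlacing d f h → Interlacing⁼ d (f ⊕ X ⊗ h) f
  Interlacing-ascend {d} {f} {h} f₀≢0 t = record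
    { f↓ = Below-⊕ (Interlacing.f↓ t) (Below-X⊗ (Interlacing.g↓ t))
    ; g↓ = Interlacing.f↓ t
    ; K  = Definite-cong (λ s → ascend-K s f h) (Interlacing.L t)
    ; L  = ascend-L (Interlacing.f↓ t) f₀≢0 (Interlacing⇒PSD t) (Interlacing.K t)
    }

  Interlacing⁼-ascend : ∀ {d f h} → f · δ 0 ≢ 0ℚ → Interlacing⁼ d f h → Interlacing (suc d) (f ⊕ X ⊗ h) f
  Interlacing⁼-ascend {d} {f} {h} f₀≢0 t = record
    { f↓ = Below-⊕ (Below-≤ (ℕₚ.n≤1+n _) (Interlacing⁼.f↓ t)) (Below-X⊗ (Interlacing⁼.g↓ t))
    ; g↓ = Interlacing⁼.f↓ t
    ; K  = Definite-cong (λ s → ascend-K s f h) (Interlacing⁼.L t)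
    ; L  = ascend-L (Interlacing⁼.f↓ t) f₀≢0 (Chain⇒PSD (Interlacing⁼⇒Chain d t)) (Interlacing⁼.K t)
    }

  -- E m is D_{m+1}(x) / x, where D_n(x) = Σₖ D(n,k) xᵏ.
  E : ℕ → Poly
  E zero          = []
  E (suc zero)    = C 1ℚ
  E (suc (suc m)) = E (suc m) ⊕ X ⊗ Slope (∂ one (2 ℕ.+ m)) (E (suc m)) (E m)

  E-0 : ∀ m → 0ℚ < E (suc m) · δ 0
  E-0 zero    = 0<1
  E-0 (suc m) = subst (0ℚ <_) (sym (trans (⊕-· (E (suc m)) _ _) (trans (cong (E (suc m) · δ 0 +_) (trans (X⊗-· (Slope c (E (suc m)) (E m)) _) (·-0 (Slope c (E (suc m)) (E m))))) (+-identityʳ _)))) (E-0 m)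
    where c = ∂ one (2 ℕ.+ m)

  double : ℕ → ℕ
  double zero    = zero
  double (suc e) = suc (suc (double e))

  -- `E (suc m)` has degree ⌊m/2⌋, so neighbours have degrees that differ by one or agree, in turn.
  -- Each ascent passes from one kind of interlacing to the other.
  E-even : ∀ e → Interlacing e (E (suc (double e))) (E (double e))
  E-odd  : ∀ e → Interlacing⁼ e (E (suc (suc (double e)))) (E (suc (double e)))
  E-even zero    = record { f↓ = below λ s≡t → cong (λ x → 1ℚ * x + 0ℚ) (s≡t 0 (s≤s z≤n)) ; g↓ = below λ _ → refl ; K = λ _ _ _ () ; L = λ _ _ _ () }
  E-even (suc e) = Interlacing⁼-ascend (0<⇒≢0 (E-0 (suc (double e)))) (Interlacing⁼-Slope (∂one>0 (2 ℕ.+ double e)) (E-odd e))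
  E-odd e = Interlacing-ascend (0<⇒≢0 (E-0 (double e))) (Interlacing-Slope (∂one>0 (1 ℕ.+ double e)) (E-even e))

  E-realRooted : ∀ m → RealRooted ℕ.⌊ m /2⌋ (E (suc m))
  E-realRooted m with parity m
    where
    parity : ∀ m → (Σ ℕ λ e → m ≡ double e) ⊎ (Σ ℕ λ e → m ≡ suc (double e))
    parity zero = inj₁ (0 , refl)
    parity (suc m) with parity m
    ... | inj₁ (e , refl) = inj₂ (e , refl)
    ... | inj₂ (e , refl) = inj₁ (suc e , refl)
  ... | inj₁ (e , refl) = subst (λ d → RealRooted d (E (suc (double e)))) (sym (half e)) record { f₀>0 = E-0 (double e) ; g = _ ; interlacing = E-even e }
    where
    half : ∀ e → ℕ.⌊ double e /2⌋ ≡ e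
    half zero    = refl
    half (suc e) = cong suc (half e)
  ... | inj₂ (e , refl) = subst (λ d → RealRooted d (E (suc (suc (double e))))) (sym (half e))
          -- `E-odd` pairs polynomials of equal degree; one Euclidean step lowers the second below
          -- the first, as `RealRooted` demands.
          (let α , g₁ , 0<α , g≈ , t = Interlacing⁼-reduce (E-odd e) in record { f₀>0 = E-0 (suc (double e)) ; g = g₁ ; interlacing = t })
    where
    half : ∀ e → ℕ.⌊ suc (double e) /2⌋ ≡ e
    half zero    = refl
    half (suc e) = cong suc (half e)

-- The mean of D(n,k), its rounding and the peak

module Mean where

  open Counting using (S₂; S₂-recurrence; D₂≡S₂)
  open Polynomials
  open import Defs
  open import Data.Integer.Base as ℤ using (+_)
  import Data.Integer.DivMod as ℤ-DivMod
  import Data.Integer.Properties as ℤₚ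
  open import Data.List.Base using ([]; _∷_; upTo; applyUpTo)
  open import Data.List.Properties using (map-cong; map-applyUpTo)
  open import Data.Nat.Base as ℕ using (ℕ; zero; suc; z≤n; s≤s)
  open import Data.Nat.Coprimality using (1-coprimeTo) renaming (sym to coprime-sym)
  open import Data.Nat.ListAction using (sum)
  import Data.Nat.Properties as ℕₚ
  open import Data.Product.Base using (_×_; _,_)
  open import Data.Rational.Base hiding (NonZero)
  open import Data.Rational.Properties
  open import Data.Rational.Solver using (module +-*-Solver)
  import Data.Rational.Unnormalised.Base as ℚᵘ
  import Data.Rational.Unnormalised.Properties as ℚᵘₚ
  open import Data.Sum.Base using (_⊎_; inj₁; inj₂)
  open import Function.Base using (_∘_; id)
  open import Relation.Binary.PropositionalEquality using (_≡_; refl; sym; trans; cong; cong₂; subst; subst₂; module ≡-Reasoning)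
  open import Relation.Nullary using (¬_; contradiction)
  open +-*-Solver using (solve; _:+_; _:*_; _:-_; _:=_; con)

  ι : ℕ → ℚ
  ι = ∂ one

  ι-* : ∀ a b → ι (a ℕ.* b) ≡ ι a * ι b
  ι-* zero    b = sym (*-zeroˡ (ι b))
  ι-* (suc a) b = trans (∂one-+ b (a ℕ.* b)) (trans (cong (λ z → ι b + z) (ι-* a b))
    (solve 2 (λ x y → y :+ x :* y := (con 1ℚ :+ x) :* y) refl (ι a) (ι b)))

  ι-mono-≤ : ∀ {a b} → a ℕ.≤ b → ι a ≤ ι b
  ι-mono-≤ {b = b} z≤n     = ∂one≥0 b
  ι-mono-≤ (s≤s a≤b) = +-monoʳ-≤ 1ℚ (ι-mono-≤ a≤b)

  ι-cancel-< : ∀ {a b} → ι a < ι b → a ℕ.< b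
  ι-cancel-< {a} {b} h = ℕₚ.≰⇒> λ b≤a → <-irrefl refl (<-≤-trans h (ι-mono-≤ b≤a))

  ι≡0⇒≡0 : ∀ {a} → ι a ≡ 0ℚ → a ≡ 0
  ι≡0⇒≡0 {zero}  _  = refl
  ι≡0⇒≡0 {suc a} eq = contradiction eq (0<⇒≢0 (∂one>0 a))

  E-coeff : ∀ m j → E m · δ j ≡ ι (S₂ (suc j) (suc m))
  E-coeff zero          j       = refl
  E-coeff (suc zero)    zero    = refl
  E-coeff (suc zero)    (suc j) = refl
  E-coeff (suc (suc m)) zero    = begin
    (E (suc m) ⊕ X ⊗ h) · δ 0           ≡⟨ ⊕-· (E (suc m)) _ _ ⟩
    E (suc m) · δ 0 + (X ⊗ h) · δ 0     ≡⟨ cong₂ _+_ (E-coeff (suc m) 0) (trans (X⊗-· h _) (·-0 h)) ⟩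
    ι (S₂ 1 (2 ℕ.+ m)) + 0ℚ              ≡⟨ +-identityʳ _ ⟩
    ι (S₂ 1 (2 ℕ.+ m))                   ≡⟨ cong ι (sym (trans (S₂-recurrence 0 (2 ℕ.+ m)) (trans (cong₂ ℕ._+_ (ℕₚ.*-identityˡ (S₂ 1 (2 ℕ.+ m))) (ℕₚ.*-zeroʳ (2 ℕ.+ m))) (ℕₚ.+-identityʳ _)))) ⟩
    ι (S₂ 1 (3 ℕ.+ m))                   ∎
    where
    open ≡-Reasoning
    h = Slope (ι (2 ℕ.+ m)) (E (suc m)) (E m)
  E-coeff (suc (suc m)) (suc j) = begin
    (f ⊕ X ⊗ h) · δ (suc j)                             ≡⟨ ⊕-· f _ _ ⟩
    f · δ (suc j) + (X ⊗ h) · δ (suc j)                 ≡⟨ cong (λ z → f · δ (suc j) + z) (trans (X⊗-· h _) (⊕-· (deriv f) _ _)) ⟩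
    f · δ (suc j) + (deriv f · δ j + (C c ⊗ E m) · δ j) ≡⟨ cong₂ (λ x y → f · δ (suc j) + (x + y))
                                                            (trans (deriv-· f (δ j)) (trans (·-cong f (∂-δ j)) (·-* f (ι (suc j)) (δ (suc j))))) (C⊗-· c (E m) _) ⟩
    f · δ (suc j) + (ι (suc j) * f · δ (suc j) + c * E m · δ j) ≡⟨ solve 3 (λ x n y → x :+ (n :* x :+ y) := (con 1ℚ :+ n) :* x :+ y) refl (f · δ (suc j)) (ι (suc j)) (c * E m · δ j) ⟩
    ι (2 ℕ.+ j) * f · δ (suc j) + c * E m · δ j         ≡⟨ cong₂ (λ x y → ι (2 ℕ.+ j) * x + c * y) (E-coeff (suc m) (suc j)) (E-coeff m j) ⟩
    ι (2 ℕ.+ j) * ι (S₂ (2 ℕ.+ j) (2 ℕ.+ m)) + c * ι (S₂ (suc j) (suc m)) ≡⟨ cong₂ _+_ (sym (ι-* (2 ℕ.+ j) (S₂ (2 ℕ.+ j) (2 ℕ.+ m)))) (sym (ι-* (2 ℕ.+ m) (S₂ (suc j) (suc m)))) ⟩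
    ι ((2 ℕ.+ j) ℕ.* S₂ (2 ℕ.+ j) (2 ℕ.+ m)) + ι ((2 ℕ.+ m) ℕ.* S₂ (suc j) (suc m)) ≡⟨ sym (∂one-+ ((2 ℕ.+ j) ℕ.* S₂ (2 ℕ.+ j) (2 ℕ.+ m)) _) ⟩
    ι ((2 ℕ.+ j) ℕ.* S₂ (2 ℕ.+ j) (2 ℕ.+ m) ℕ.+ (2 ℕ.+ m) ℕ.* S₂ (suc j) (suc m))  ≡⟨ cong ι (sym (S₂-recurrence (suc j) (2 ℕ.+ m))) ⟩
    ι (S₂ (2 ℕ.+ j) (3 ℕ.+ m))                           ∎
    where
    open ≡-Reasoning
    c = ι (2 ℕ.+ m)
    f = E (suc m)
    h = Slope c f (E m)

  -- The length of the list `p` is unrelated to the cut-off `N`: beyond the list the equation makes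
  -- `h` vanish, and beyond `N` the bound makes the entries vanish.
  ·one≡∑coeff : ∀ p N (h : ℕ → ℕ) → (∀ j → p · δ j ≡ ι (h j)) → (∀ j → N ℕ.≤ j → h j ≡ 0) → p · one ≡ ι (sum (applyUpTo h N))
  ·one≡∑coeff []      zero    h eq bound = refl
  ·one≡∑coeff []      (suc N) h eq bound = trans (·one≡∑coeff [] N (h ∘ suc) (eq ∘ suc) (λ j N≤j → bound (suc j) (s≤s N≤j)))
    (cong (λ z → ι (z ℕ.+ sum (applyUpTo (h ∘ suc) N))) (sym (ι≡0⇒≡0 {h 0} (sym (eq 0)))))
  ·one≡∑coeff (a ∷ p) zero    h eq bound = trans (cong₂ (λ x y → x * 1ℚ + y) (trans (sym (coeff-0 a p)) (trans (eq 0) (cong ι (bound 0 z≤n))))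
    (·one≡∑coeff p zero (h ∘ suc) (λ j → trans (sym (coeff-∷ a p j)) (eq (suc j))) (λ j _ → bound (suc j) z≤n))) refl
  ·one≡∑coeff (a ∷ p) (suc N) h eq bound = trans (cong₂ _+_ (trans (*-identityʳ a) (trans (sym (coeff-0 a p)) (eq 0)))
    (·one≡∑coeff p N (h ∘ suc) (λ j → trans (sym (coeff-∷ a p j)) (eq (suc j))) (λ j N≤j → bound (suc j) (s≤s N≤j))))
    (sym (∂one-+ (h 0) _))

  D-E : ∀ m → ι (D (suc m)) ≡ E m · one
  D-E m = sym (trans (·one≡∑coeff (E m) (suc m) (λ j → S₂ (suc j) (suc m)) (E-coeff m) (λ j m<j → ι≡0⇒≡0 (trans (sym (E-coeff m j)) (vanish m m<j))))
    (cong ι (sym (trans (cong sum (map-cong (λ j → D₂≡S₂ (suc m) (suc j)) (upTo (suc m)))) (cong sum (map-applyUpTo id (λ j → S₂ (suc j) (suc m)) (suc m)))))))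
    where
    vanish : ∀ m {j} → m ℕ.< j → E m · δ j ≡ 0ℚ
    vanish zero    m<j = refl
    vanish (suc m) m<j = Below⇒coeff≡0 (Interlacing.f↓ (RealRooted.interlacing (E-realRooted m))) (ℕₚ.≤-trans (s≤s (ℕₚ.≤-trans (ℕₚ.⌊n/2⌋≤n m) (ℕₚ.n≤1+n m))) m<j)

  -- The recurrence at x = 1: the term with `E m` cancels, and the derivative of `X ⊗ E (suc m)` at
  -- 1 remains, which is Σₖ k D(n,k) for n = m + 2.
  E-mean : ∀ m → E (suc (suc m)) · one - ι (2 ℕ.+ m) * E m · one ≡ E (suc m) · one + E (suc m) · ∂ one
  E-mean m = begin
    (f ⊕ X ⊗ Slope c f (E m)) · one - c * E m · one
      ≡⟨ cong (_- c * E m · one) (trans (⊕-· f _ one) (cong (λ z → f · one + z) (trans (X⊗-· (Slope c f (E m)) one) (trans (⊕-· (deriv f) _ one)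
           (cong₂ _+_ (deriv-· f one) (C⊗-· c (E m) one)))))) ⟩
    f · one + (f · ∂ one + c * E m · one) - c * E m · one
      ≡⟨ solve 3 (λ x y z → x :+ (y :+ z) :- z := x :+ y) refl (f · one) (f · ∂ one) (c * E m · one) ⟩
    f · one + f · ∂ one ∎
    where
    open ≡-Reasoning
    c = ι (2 ℕ.+ m)
    f = E (suc m)

  -- The explicit normal form, with denominator 1, turns comparisons with `ι n` into integer
  -- inequalities between numerator and denominator.
  ι≡mkℚ : ∀ n → ι n ≡ mkℚ (+ n) 0 (coprime-sym (1-coprimeTo n))
  ι≡mkℚ zero    = refl
  ι≡mkℚ (suc n) = trans (cong (λ z → 1ℚ + z) (ι≡mkℚ n)) (trans (cong (λ k → (+ 1 ℤ.+ k) / 1) (ℤₚ.*-identityʳ (+ n)))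
    (normalize-coprime (coprime-sym (1-coprimeTo (suc n)))))

  ι≤⇒ : ∀ n p → ι n ≤ p → + n ℤ.* ↧ p ℤ.≤ ↥ p
  ι≤⇒ n p h = subst (+ n ℤ.* ↧ p ℤ.≤_) (ℤₚ.*-identityʳ (↥ p)) (drop-*≤* (subst (_≤ p) (ι≡mkℚ n) h))

  <ι⇒ : ∀ n p → p < ι n → ↥ p ℤ.< + n ℤ.* ↧ p
  <ι⇒ n p h = subst (ℤ._< + n ℤ.* ↧ p) (ℤₚ.*-identityʳ (↥ p)) (drop-*<* (subst (p <_) (ι≡mkℚ n) h))

  ≤ι⇒ : ∀ n p → p ≤ ι n → ↥ p ℤ.≤ + n ℤ.* ↧ p
  ≤ι⇒ n p h = subst (ℤ._≤ + n ℤ.* ↧ p) (ℤₚ.*-identityʳ (↥ p)) (drop-*≤* (subst (p ≤_) (ι≡mkℚ n) h))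

  ι<⇒ : ∀ n p → ι n < p → + n ℤ.* ↧ p ℤ.< ↥ p
  ι<⇒ n p h = subst (+ n ℤ.* ↧ p ℤ.<_) (ℤₚ.*-identityʳ (↥ p)) (drop-*<* (subst (_< p) (ι≡mkℚ n) h))

  floor-unique : ∀ p z → z ℤ.* ↧ p ℤ.≤ ↥ p → ↥ p ℤ.< ℤ.suc z ℤ.* ↧ p → z ≡ floor p
  floor-unique (mkℚ n d-1 _) z lo hi = ℤₚ.≤-antisym
    (≤-cancel (ℤₚ.≤-<-trans lo n<))
    (≤-cancel (ℤₚ.≤-<-trans qd≤n hi))
    where
    d = + suc d-1
    q = n ℤ./ d
    n≡ : n ≡ + (n ℤ.% d) ℤ.+ q ℤ.* d
    n≡ = ℤ-DivMod.a≡a%n+[a/n]*n n d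
    qd≤n : q ℤ.* d ℤ.≤ n
    qd≤n = subst (q ℤ.* d ℤ.≤_) (sym n≡) (ℤₚ.i≤j+i (q ℤ.* d) (+ (n ℤ.% d)))
    n< : n ℤ.< ℤ.suc q ℤ.* d
    n< = subst₂ ℤ._<_ (sym n≡) (sym (ℤₚ.suc-* q d)) (ℤₚ.+-monoˡ-< (q ℤ.* d) (ℤ.+<+ (ℤ-DivMod.n%d<d n d)))
    ≤-cancel : ∀ {i j} → i ℤ.* d ℤ.< ℤ.suc j ℤ.* d → i ℤ.≤ j
    ≤-cancel {i} {j} h = ℤₚ.≮⇒≥ λ j<i → ℤₚ.<⇒≱ (ℤₚ.*-cancelʳ-<-nonNeg d h) (ℤₚ.i<j⇒suc[i]≤j j<i)

  ceiling≡ : ∀ p → ceiling p ≡ ℤ.- floor (- p)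
  ceiling≡ (mkℚ _ _ _) = refl

  -- The position of `p` relative to `suc k` decides between floor and ceiling; the ceiling is
  -- handled as the negated floor of `- p`.
  round-bracket : ∀ k p → ι k < p → p < ι (2 ℕ.+ k) → + suc k ≡ floor p ⊎ + suc k ≡ ceiling p
  round-bracket k p lo hi with ≤-total (ι (suc k)) p
  ... | inj₁ h = inj₁ (floor-unique p (+ suc k) (ι≤⇒ (suc k) p h) (<ι⇒ (2 ℕ.+ k) p hi))
  ... | inj₂ h = inj₂ (sym (trans (ceiling≡ p) (cong ℤ.-_ (sym (floor-unique (- p) (ℤ.- + suc k)
      (subst₂ ℤ._≤_ (trans (ℤₚ.neg-distribˡ-* (+ suc k) (↧ p)) (cong (ℤ.- + suc k ℤ.*_) (sym (↧-neg p)))) (sym (↥-neg p)) (ℤₚ.neg-mono-≤ (≤ι⇒ (suc k) p h)))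
      (subst₂ ℤ._<_ (sym (↥-neg p)) (trans (ℤₚ.neg-distribˡ-* (+ k) (↧ p)) (cong₂ ℤ._*_ (-k≡ k) (sym (↧-neg p)))) (ℤₚ.neg-mono-< (ι<⇒ k p lo))))))))
    where
    -k≡ : ∀ k → ℤ.- + k ≡ ℤ.suc (ℤ.- + suc k)
    -k≡ zero    = refl
    -k≡ (suc k) = refl

  /-ι : ∀ a b .{{_ : ℕ.NonZero b}} → (+ a / b) * ι b ≡ ι a
  /-ι a b@(suc b-1) = trans (cong ((+ a / b) *_) (ι≡mkℚ b)) (trans (toℚᵘ-injective (begin-equality
      toℚᵘ ((+ a / b) * ⟨ b ⟩)                 ≃⟨ toℚᵘ-homo-* (+ a / b) ⟨ b ⟩ ⟩
      toℚᵘ (+ a / b) ℚᵘ.* toℚᵘ ⟨ b ⟩           ≃⟨ ℚᵘₚ.*-congʳ {toℚᵘ ⟨ b ⟩} (toℚᵘ-fromℚᵘ (ℚᵘ.mkℚᵘ (+ a) b-1)) ⟩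
      ℚᵘ.mkℚᵘ (+ a) b-1 ℚᵘ.* toℚᵘ ⟨ b ⟩        ≃⟨ ℚᵘ.*≡* (trans (ℤₚ.*-identityʳ (+ a ℤ.* + b)) (cong (λ k → + a ℤ.* + k) (sym (ℕₚ.*-identityʳ b)))) ⟩
      toℚᵘ ⟨ a ⟩                               ∎)) (sym (ι≡mkℚ a)))
    where
    open ℚᵘₚ.≤-Reasoning
    ⟨_⟩ : ℕ → ℚ
    ⟨ n ⟩ = mkℚ (+ n) 0 (coprime-sym (1-coprimeTo n))

  -- The coefficient of `f` at index j counts partitions into j + 1 blocks. Hence the peak `suc p`
  -- sits at index p, and `μₙ` is one more than the mean of `f`.
  mean-near-peak : ∀ {n} (2≤n : 2 ℕ.≤ n) {p} → IsPeak n (suc p) →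
    let μₙ = μ n {{D-nonZero 2≤n}} in ι p < μₙ × μₙ < ι (2 ℕ.+ p)
  mean-near-peak {n@(suc (suc r))} 2≤n {p} ((_ , s≤s p≤d) , peak) = lower , upper
    where
    instance _ = D-nonZero 2≤n
    μₙ = μ n
    f = E (suc r)
    d = ℕ.⌊ r /2⌋
    good : RealRooted d f
    good = E-realRooted r
    f1>0 : 0ℚ < f · one
    f1>0 = RealRooted⇒·one>0 good
    μ-mean : f · one * μₙ ≡ f · one + f · ∂ one
    μ-mean = begin
      f · one * (x - y)                                     ≡⟨ cong (_* (x - y)) (sym (D-E (suc r))) ⟩
      ι (D n) * (x - y)                                     ≡⟨ solve 3 (λ b x y → b :* (x :- y) := x :* b :- y :* b) refl (ι (D n)) x y ⟩
      x * ι (D n) - y * ι (D n)                             ≡⟨ cong₂ _-_ (/-ι (D (suc n)) (D n)) (/-ι (n ℕ.* D (suc r)) (D n)) ⟩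
      ι (D (suc n)) - ι (n ℕ.* D (suc r))                   ≡⟨ cong₂ _-_ (D-E (suc (suc r))) (trans (ι-* n (D (suc r))) (cong (ι n *_) (D-E r))) ⟩
      E (suc (suc r)) · one - ι n * E r · one               ≡⟨ E-mean r ⟩
      f · one + f · ∂ one                                   ∎
      where
      open ≡-Reasoning
      x = + D (suc n) / D n
      y = + (n ℕ.* D (suc r)) / D n
    coeff≡D₂ : ∀ j → f · δ j ≡ ι (D₂ n (suc j))
    coeff≡D₂ j = trans (E-coeff (suc r) j) (cong ι (sym (D₂≡S₂ n (suc j))))
    not-increasing : ∀ {j} → j ℕ.≤ d → ¬ f · δ p < f · δ j
    not-increasing {j} j≤d h = ℕₚ.<⇒≱ (ι-cancel-< (subst₂ _<_ (coeff≡D₂ p) (coeff≡D₂ j) h)) (peak (suc j) (s≤s z≤n) (s≤s j≤d))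
    scale : ∀ {x y} → f · one * x < f · one * y → x < y
    scale = *-cancelˡ-<-nonNeg (f · one) {{nonNegative (<⇒≤ f1>0)}}
    below-next : f · ∂ one < ι (suc p) * f · one
    -- If `suc p` exceeds the degree bound, the coefficient there is 0 and cannot be larger than the
    -- nonnegative one at p; otherwise the rise contradicts the peak.
    below-next = ≰⇒> λ h → let rise = darroch p d good h in not-increasing {suc p} (ℕₚ.≮⇒≥ λ d<1+p →
      <-irrefl (sym (Below⇒coeff≡0 (Interlacing.f↓ (RealRooted.interlacing good)) d<1+p)) (≤-<-trans (RealRooted⇒coeff≥0 good p) rise)) rise
    upper : μₙ < ι (2 ℕ.+ p)
    upper = scale (subst₂ _<_ (sym μ-mean) (solve 2 (λ x n → x :+ n :* x := x :* (con 1ℚ :+ n)) refl (f · one) (ι (suc p))) (+-monoʳ-< (f · one) below-next))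
    above-previous : ∀ p → p ℕ.≤ d → (∀ {j} → j ℕ.≤ d → ¬ f · δ p < f · δ j) → f · one * ι p < f · one + f · ∂ one
    -- At index 0 there is no earlier coefficient to compare with, and positivity of `μₙ` is all
    -- that is claimed.
    above-previous zero    _   _     = subst (_< f · one + f · ∂ one) (sym (*-zeroʳ (f · one))) (0<+ f1>0 (coeff≥0⇒·≥0 f ι (RealRooted⇒coeff≥0 good) ∂one≥0))
    above-previous (suc p) p<d notup = subst (_< f · one + f · ∂ one)
      (solve 2 (λ x n → x :+ n :* x := x :* (con 1ℚ :+ n)) refl (f · one) (ι p))
      (+-monoʳ-< (f · one) (≰⇒> λ h → notup {p} (ℕₚ.<⇒≤ p<d) (darroch-rev good p<d h)))
    lower : ι p < μₙ
    lower = scale (subst (f · one * ι p <_) (sym μ-mean) (above-previous p p≤d not-increasing))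

open import Defs
open import Data.Integer.Base using (+_)
open import Data.Nat.Base using (ℕ; _≤_; suc)
open import Data.Product.Base using (_,_)
open import Data.Rational.Base using (floor; ceiling)
open import Data.Sum.Base using (_⊎_)
open import Relation.Binary.PropositionalEquality using (_≡_)

mainTheorem2 : (n : ℕ) (2≤n : 2 ≤ n) (m : ℕ) → IsPeak n m →
    let μₙ = μ n {{D-nonZero 2≤n}} in
    + m ≡ floor μₙ ⊎ + m ≡ ceiling μₙ
mainTheorem2 n 2≤n (suc p) peak = let lower , upper = Mean.mean-near-peak 2≤n peak in Mean.round-bracket p _ lower upper
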